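{- Let $D$ be a connected locally-finite digraph with more than one end, and suppose that $D$ embeds a triangle. Then $D$ is connected-homogeneous if and only if it is isomorphic to $T(r)$ for some $r\in\mathbb{N}$.
   Context: A digraph is a set with an irreflexive antisymmetric arc relation $\to$; connectivity and ends refer to the underlying undirected graph (ends of a connected locally-finite graph are equivalence classes of rays, two rays being equivalent if some third ray meets each infinitely often). "Embeds a triangle" means the underlying undirected graph has three mutually adjacent vertices. Locally-finite: finite in- and out-degrees. Connected-homogeneous: every isomorphism between finite connected induced subdigraphs extends to an automorphism. $T(r)$ is the directed Cayley graph of the free product $\langle a_1\rangle*\cdots*\langle a_r\rangle$ with $a_i^3=1$, with respect to the generating set $\{a_1,\dots,a_r\}$, i.e. vertices are group elements and arcs are $g\to ga_i$. -}

module Defs where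

open import Algebra.Bundles using (Group)
import Algebra.Properties.Group as GroupProperties
open import Data.Fin.Base using (Fin)
open import Data.List.Base using (List; []; _∷_; _++_; [_])
import Data.List.Membership.Setoid as Membership
open import Data.List.Properties using (++-assoc; ++-identityʳ)
open import Data.Nat.Base using (ℕ; suc; _≤_)
open import Data.Product.Base using (Σ; ∃; ∃-syntax; _×_; _,_; proj₁)
open import Function.Bundles using (_⇔_; Inverse)
open import Level using (Level; _⊔_; 0ℓ) renaming (suc to lsuc)
open import Relation.Binary.Bundles using (Setoid)
open import Relation.Binary.Core using (Rel)
open import Relation.Binary.Definitions
  using (Irreflexive; Antisymmetric; _Respects₂_)
open import Relation.Binary.Construct.Closure.Equivalence using (EqClosure)
open import Relation.Binary.Construct.Closure.Symmetric using (SymClosure)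
import Relation.Binary.Construct.On as On
open import Relation.Binary.Construct.Union using (_∪_)
open import Relation.Binary.PropositionalEquality
  using (_≡_; refl; sym; trans; cong; cong₂; isEquivalence)
open import Relation.Nullary.Negation using (¬_; contradiction)
open import Relation.Unary using (Pred)

------------------------------------------------------------------------
-- Digraphs

-- The vertex set is a setoid, because the vertices of T(r) below are the
-- elements of a quotient.

record Digraph (c ℓ a : Level) : Set (lsuc (c ⊔ ℓ ⊔ a)) where
  infix 4 _⟶_
  field
    vertices : Setoid c ℓ
  open Setoid vertices public
    using (_≈_)
    renaming (Carrier to Vertex; refl to ≈-refl; sym to ≈-sym; trans to ≈-trans)
  field
    _⟶_       : Rel Vertex a
    ⟶-resp-≈  : _⟶_ Respects₂ _≈_
    ⟶-irrefl  : Irreflexive _≈_ _⟶_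
    ⟶-antisym : Antisymmetric _≈_ _⟶_

  infix 4 _∼_
  _∼_ : Rel Vertex a
  _∼_ = SymClosure _⟶_

  open Membership vertices public using (_∈_)

private
  variable
    c ℓ a c′ ℓ′ a′ p : Level

infix 4 _≅_

record _≅_ (D : Digraph c ℓ a) (E : Digraph c′ ℓ′ a′)
           : Set (c ⊔ ℓ ⊔ a ⊔ c′ ⊔ ℓ′ ⊔ a′) where
  private
    module D = Digraph D
    module E = Digraph E
  field
    bijection : Inverse D.vertices E.vertices
  open Inverse bijection public using (to; from)
  field
    arcs : ∀ x y → (x D.⟶ y) ⇔ (to x E.⟶ to y)

induced : (D : Digraph c ℓ a) → Pred (Digraph.Vertex D) p → Digraph (c ⊔ p) ℓ a
induced D P = record
  { vertices  = On.setoid vertices (proj₁ {B = P})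
  ; _⟶_       = λ x y → proj₁ x ⟶ proj₁ y
  ; ⟶-resp-≈  = let (r , l) = ⟶-resp-≈ in (λ e → r e) , (λ e → l e)
  ; ⟶-irrefl  = λ e → ⟶-irrefl e
  ; ⟶-antisym = λ xy yx → ⟶-antisym xy yx
  }
  where open Digraph D

module _ (D : Digraph c ℓ a) where
  open Digraph D

  -- Any two vertices are joined by a walk in the underlying undirected
  -- graph.  Steps along _≈_ are included because the closure of _⟶_ alone
  -- is reflexive only with respect to _≡_.

  Connected : Set (c ⊔ ℓ ⊔ a)
  Connected = ∀ x y → EqClosure (_≈_ ∪ _⟶_) x y

  Finite : Pred Vertex p → Set (c ⊔ ℓ ⊔ p)
  Finite P = ∃[ xs ] (∀ x → P x ⇔ x ∈ xs)

  LocallyFinite : Set (c ⊔ ℓ ⊔ a)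
  LocallyFinite = ∀ x → Finite (λ y → x ⟶ y) × Finite (λ y → y ⟶ x)

  EmbedsTriangle : Set (c ⊔ a)
  EmbedsTriangle = ∃[ x ] ∃[ y ] ∃[ z ] (x ∼ y) × (y ∼ z) × (z ∼ x)

  record Ray : Set (c ⊔ ℓ ⊔ a) where
    field
      at       : ℕ → Vertex
      adjacent : ∀ n → at n ∼ at (suc n)
      distinct : ∀ {m n} → at m ≈ at n → m ≡ n

  MeetsInfinitelyOften : Ray → Ray → Set ℓ
  MeetsInfinitelyOften ρ σ =
    ∀ n → ∃[ m ] n ≤ m × (∃[ k ] Ray.at ρ m ≈ Ray.at σ k)

  SameEnd : Rel Ray (c ⊔ ℓ ⊔ a)
  SameEnd ρ σ =
    ∃[ τ ] MeetsInfinitelyOften τ ρ × MeetsInfinitelyOften τ σ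

  MoreThanOneEnd : Set (c ⊔ ℓ ⊔ a)
  MoreThanOneEnd = ∃[ ρ ] ∃[ σ ] ¬ SameEnd ρ σ

-- Finite sets of vertices are given by lists; repetitions and order are
-- invisible in the induced subdigraph, whose equality is that of D.

ConnectedHomogeneous : Digraph c ℓ a → Set (c ⊔ ℓ ⊔ a)
ConnectedHomogeneous D =
  ∀ (xs ys : List Vertex) →
  let A = induced D (_∈ xs)
      B = induced D (_∈ ys)
  in Connected A → Connected B → (φ : A ≅ B) →
     ∃ λ (α : D ≅ D) → ∀ x → _≅_.to α (proj₁ x) ≈ proj₁ (_≅_.to φ x)
  where open Digraph D

------------------------------------------------------------------------
-- Free products of groups

-- The free product of a family of groups: words in the disjoint union of
-- the groups, modulo the congruence that multiplies adjacent letters from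
-- the same group and deletes identity letters.

module FreeProduct {i} {I : Set i} (G : I → Group c ℓ) where
  private
    module G j = Group (G j)

  Word : Set (i ⊔ c)
  Word = List (Σ I G.Carrier)

  infix 4 _≋_

  data _≋_ : Rel Word (i ⊔ c ⊔ ℓ) where
    ≋-refl  : ∀ {u} → u ≋ u
    ≋-sym   : ∀ {u v} → u ≋ v → v ≋ u
    ≋-trans : ∀ {u v w} → u ≋ v → v ≋ w → u ≋ w
    ≋-++    : ∀ {u u′ v v′} → u ≋ u′ → v ≋ v′ → u ++ v ≋ u′ ++ v′
    ≋-cong  : ∀ {j x y} → G._≈_ j x y → [ (j , x) ] ≋ [ (j , y) ]
    ≋-unit  : ∀ {j} → [ (j , G.ε j) ] ≋ []
    ≋-mult  : ∀ {j x y} → (j , x) ∷ (j , y) ∷ [] ≋ [ (j , G._∙_ j x y) ]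

  ≋-reflexive : ∀ {u v} → u ≡ v → u ≋ v
  ≋-reflexive refl = ≋-refl

  inv : Word → Word
  inv []            = []
  inv ((j , x) ∷ w) = inv w ++ [ (j , G._⁻¹ j x) ]

  inv-++ : ∀ u v → inv (u ++ v) ≡ inv v ++ inv u
  inv-++ []            v = sym (++-identityʳ (inv v))
  inv-++ ((j , x) ∷ u) v =
    trans (cong (_++ _) (inv-++ u v)) (++-assoc (inv v) (inv u) _)

  inv-cong : ∀ {u v} → u ≋ v → inv u ≋ inv v
  inv-cong ≋-refl        = ≋-refl
  inv-cong (≋-sym e)     = ≋-sym (inv-cong e)
  inv-cong (≋-trans e f) = ≋-trans (inv-cong e) (inv-cong f)
  inv-cong (≋-++ {u} {u′} {v} {v′} e f) =
    ≋-trans (≋-reflexive (inv-++ u v))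
      (≋-trans (≋-++ (inv-cong f) (inv-cong e))
        (≋-reflexive (sym (inv-++ u′ v′))))
  inv-cong (≋-cong {j} e) = ≋-cong (G.⁻¹-cong j e)
  inv-cong (≋-unit {j})   = ≋-trans (≋-cong ε⁻¹≈ε) ≋-unit
    where open GroupProperties (G j)
  inv-cong (≋-mult {j} {x} {y}) =
    ≋-trans ≋-mult (≋-cong (G.sym j (⁻¹-anti-homo-∙ x y)))
    where open GroupProperties (G j)

  cancel : ∀ u {v v′ w} → v ++ v′ ≋ [] → (u ++ v) ++ (v′ ++ w) ≋ u ++ w
  cancel u {v} {v′} {w} e =
    ≋-trans (≋-reflexive
      (trans (++-assoc u v (v′ ++ w)) (cong (u ++_) (sym (++-assoc v v′ w)))))
      (≋-++ (≋-refl {u}) (≋-++ e (≋-refl {w})))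

  inverseˡ : ∀ w → inv w ++ w ≋ []
  inverseˡ []            = ≋-refl
  inverseˡ ((j , x) ∷ w) =
    ≋-trans
      (cancel (inv w) {[ (j , G._⁻¹ j x) ]} {[ (j , x) ]} {w}
        (≋-trans ≋-mult (≋-trans (≋-cong (G.inverseˡ j x)) ≋-unit)))
      (inverseˡ w)

  inverseʳ : ∀ w → w ++ inv w ≋ []
  inverseʳ []            = ≋-refl
  inverseʳ ((j , x) ∷ w) =
    ≋-trans (≋-reflexive (cong ((j , x) ∷_) (sym (++-assoc w (inv w) _))))
      (≋-trans
        (≋-++ (≋-refl {[ (j , x) ]})
          (≋-++ (inverseʳ w) (≋-refl {[ (j , G._⁻¹ j x) ]})))
        (≋-trans ≋-mult (≋-trans (≋-cong (G.inverseʳ j x)) ≋-unit)))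

  group : Group (i ⊔ c) (i ⊔ c ⊔ ℓ)
  group = record
    { Carrier = Word
    ; _≈_     = _≋_
    ; _∙_     = _++_
    ; ε       = []
    ; _⁻¹     = inv
    ; isGroup = record
      { isMonoid = record
        { isSemigroup = record
          { isMagma = record
            { isEquivalence = record
              { refl = ≋-refl ; sym = ≋-sym ; trans = ≋-trans }
            ; ∙-cong = ≋-++
            }
          ; assoc = λ u v w → ≋-reflexive (++-assoc u v w)
          }
        ; identity = (λ _ → ≋-refl) , (λ w → ≋-reflexive (++-identityʳ w))
        }
      ; inverse = inverseˡ , inverseʳ
      ; ⁻¹-cong = inv-cong
      }
    }

------------------------------------------------------------------------
-- The cyclic group of order three

data C₃ : Set where
  1₃ ω ω² : C₃

infixl 7 _·_

_·_ : C₃ → C₃ → C₃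
1₃ · y  = y
ω  · 1₃ = ω
ω  · ω  = ω²
ω  · ω² = 1₃
ω² · 1₃ = ω²
ω² · ω  = 1₃
ω² · ω² = ω

·-assoc : ∀ x y z → (x · y) · z ≡ x · (y · z)
·-assoc 1₃ y  z  = refl
·-assoc ω  1₃ z  = refl
·-assoc ω  ω  1₃ = refl
·-assoc ω  ω  ω  = refl
·-assoc ω  ω  ω² = refl
·-assoc ω  ω² 1₃ = refl
·-assoc ω  ω² ω  = refl
·-assoc ω  ω² ω² = refl
·-assoc ω² 1₃ z  = refl
·-assoc ω² ω  1₃ = refl
·-assoc ω² ω  ω  = refl
·-assoc ω² ω  ω² = refl
·-assoc ω² ω² 1₃ = refl
·-assoc ω² ω² ω  = refl
·-assoc ω² ω² ω² = refl

·-identityʳ : ∀ x → x · 1₃ ≡ x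
·-identityʳ 1₃ = refl
·-identityʳ ω  = refl
·-identityʳ ω² = refl

C₃-group : Group 0ℓ 0ℓ
C₃-group = record
  { Carrier = C₃
  ; _≈_     = _≡_
  ; _∙_     = _·_
  ; ε       = 1₃
  ; _⁻¹     = λ x → x · x
  ; isGroup = record
    { isMonoid = record
      { isSemigroup = record
        { isMagma = record { isEquivalence = isEquivalence ; ∙-cong = cong₂ _·_ }
        ; assoc   = ·-assoc
        }
      ; identity = (λ _ → refl) , ·-identityʳ
      }
    ; inverse = (λ { 1₃ → refl ; ω → refl ; ω² → refl })
              , (λ { 1₃ → refl ; ω → refl ; ω² → refl })
    ; ⁻¹-cong = cong (λ x → x · x)
    }
  }

------------------------------------------------------------------------
-- The digraph T(r)

module _ (r : ℕ) where
  open FreeProduct {I = Fin r} (λ _ → C₃-group) using (Word; _≋_; group)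
  open FreeProduct._≋_

  generator : Fin r → Word
  generator i = [ (i , ω) ]

  -- The homomorphism to C₃ sending every generator to ω shows that the
  -- Cayley digraph is irreflexive and antisymmetric.

  private
    deg : Word → C₃
    deg []            = 1₃
    deg ((_ , x) ∷ w) = x · deg w

    deg-++ : ∀ u v → deg (u ++ v) ≡ deg u · deg v
    deg-++ []            v = refl
    deg-++ ((_ , x) ∷ u) v =
      trans (cong (x ·_) (deg-++ u v)) (sym (·-assoc x (deg u) (deg v)))

    deg-cong : ∀ {u v} → u ≋ v → deg u ≡ deg v
    deg-cong ≋-refl        = refl
    deg-cong (≋-sym e)     = sym (deg-cong e)
    deg-cong (≋-trans e f) = trans (deg-cong e) (deg-cong f)
    deg-cong (≋-++ {u} {u′} {v} {v′} e f) =
      trans (deg-++ u v)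
        (trans (cong₂ _·_ (deg-cong e) (deg-cong f)) (sym (deg-++ u′ v′)))
    deg-cong (≋-cong e)    = cong (_· 1₃) e
    deg-cong ≋-unit        = refl
    deg-cong (≋-mult {_} {x} {y}) = sym (·-assoc x y 1₃)

    x≢xω : ∀ x → ¬ x ≡ x · ω
    x≢xω 1₃ ()
    x≢xω ω  ()
    x≢xω ω² ()

    x≢xωω : ∀ x → ¬ x ≡ (x · ω) · ω
    x≢xωω 1₃ ()
    x≢xωω ω  ()
    x≢xωω ω² ()

  open Group group using () renaming (_∙_ to _∙ᵍ_; setoid to elements)

  private
    Arc : Rel Word 0ℓ
    Arc g h = ∃[ i ] h ≋ g ∙ᵍ generator i

    deg-arc : ∀ {g h} → Arc g h → deg h ≡ deg g · ω
    deg-arc {g} (i , e) = trans (deg-cong e) (deg-++ g (generator i))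

  T : Digraph 0ℓ 0ℓ 0ℓ
  T = record
    { vertices  = elements
    ; _⟶_       = Arc
    ; ⟶-resp-≈  =
        (λ { e (i , f) → i , ≋-trans (≋-sym e) f })
      , (λ { e (i , f) → i , ≋-trans f (≋-++ e ≋-refl) })
    ; ⟶-irrefl  = λ {g} e gh →
        contradiction (trans (deg-cong e) (deg-arc gh)) (x≢xω (deg g))
    ; ⟶-antisym = λ {g} gh hg →
        contradiction (trans (deg-arc hg) (cong (_· ω) (deg-arc gh)))
                      (x≢xωω (deg g))
    }

{-# OPTIONS --safe #-}

-- Suppose D is connected-homogeneous. Among the cuts with fewest boundary
-- edges, those crossed by the fewest others are pairwise nested (Dunwoody,
-- Krön); they form an invariant family, and every edge is separated by the same
-- positive finite number of them. Two neighbours of v lie on the same side of v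
-- if some cut of the family contains both but not v. Counting cuts, adjacent
-- neighbours lie on the same side; nestedness makes this an equivalence with
-- several classes, and homogeneity then forces the classes to be cliques. A
-- homogeneity argument on longest transitive tournaments shows that there are
-- no transitive triangles, so every arc lies in a unique triangle, which is
-- directed. A walk that changes triangle at each step moves monotonically
-- through the family of cuts, hence never returns, and reduced words in the
-- free product correspond to the vertices of D.
--
-- Conversely, a partial isomorphism of T r is extended one vertex at a time,
-- correcting it each time by an automorphism that exchanges two branches.
module Submission where

open import Defs
open import Axiom.ExcludedMiddle using (ExcludedMiddle)
open import Data.Bool.Base using (Bool; true; false; not; _∧_; _∨_; if_then_else_)
open import Data.Bool.Properties
  using (¬-not; not-¬; not-involutive; not-injective) renaming (_≟_ to _≟ᵇ_)
open import Data.Empty using (⊥; ⊥-elim)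
open import Data.Fin.Base using (Fin; zero; suc)
open import Data.Fin.Properties using () renaming (_≟_ to _≟ᶠ_)
open import Data.List.Base
  using (List; []; _∷_; _++_; [_]; length; map; concatMap; filter; foldr; zip)
open import Data.List.Membership.Propositional using (find; lose) renaming (_∈_ to _∈≡_)
open import Data.List.Properties
  using (length-++; length-map; foldr-++; ++-assoc; ++-identityʳ; map-++; ∷-injectiveˡ)
open import Data.List.Relation.Binary.Pointwise as Pointwise using (Pointwise; []; _∷_)
open import Data.List.Relation.Unary.All as All using (All; []; _∷_)
open import Data.List.Relation.Unary.AllPairs using (AllPairs; []; _∷_)
open import Data.List.Relation.Unary.Any as Any using (Any; here; there)
import Data.List.Relation.Unary.Any.Properties as Any
open import Data.Nat.Base
  using (ℕ; zero; suc; _+_; _∸_; _⊔_; _≤_; _<_; z≤n; s≤s; s≤s⁻¹; _≤′_; ≤′-refl; ≤′-step)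
open import Data.Nat.Properties
  using ( +-assoc; +-comm; +-suc; +-identityʳ; +-cancelˡ-≡; +-cancelˡ-≤; +-cancelʳ-≤
        ; +-mono-≤; +-monoʳ-≤; +-monoˡ-≤; ∸-monoˡ-≤; m+[n∸m]≡n; m+n∸m≡n
        ; ≤-refl; ≤-reflexive; ≤-trans; <-irrefl; <-trans; <⇒≤; ≤⇒≤′; n≤1+n
        ; m≤m+n; m≤m⊔n; m≤n⊔m; m≤n⇒m<n∨m≡n; m≤n⇒m≤1+n; m⊔n≤o⇒m≤o; m⊔n≤o⇒n≤o
        ; suc-injective )
open import Data.Product.Base using (∃-syntax; _×_; _,_; proj₁; proj₂; swap)
open import Data.Sum.Base using (_⊎_; inj₁; inj₂)
open import Data.Unit.Base using (⊤; tt)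
open import Function.Base using (_∘_; id)
open import Function.Bundles using (_⇔_; mk⇔; Equivalence; Inverse)
import Function.Construct.Composition as Composition
import Function.Construct.Identity as Identity
import Function.Construct.Symmetry as Symmetry
open import Level using (Level) renaming (_⊔_ to _⊔ˡ_)
open import Relation.Binary.Construct.Closure.Equivalence using (EqClosure)
open import Relation.Binary.Construct.Closure.ReflexiveTransitive using (Star; ε; _◅_; _◅◅_)
open import Relation.Binary.Construct.Closure.Symmetric using (fwd; bwd)
open import Relation.Binary.Construct.Union using () renaming (_∪_ to _∪ʳ_)
open import Relation.Binary.Core using (Rel)
open import Relation.Binary.Definitions using (Symmetric)
open import Relation.Binary.PropositionalEquality
  using (_≡_; _≢_; refl; sym; trans; cong; cong₂; subst)
open import Relation.Nullary.Decidable.Core using (Dec; yes; no; does; decidable-stable)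
open import Relation.Nullary.Negation using (¬_; contradiction)
open import Relation.Unary using (Pred)

-- Two minima produce the cuts: `k`, the fewest boundary edges of a cut with both sides infinite,
-- and `m`, the fewest thin cuts that cross a thin cut. One counting inequality serves for both; in
-- the second it is strict, because one of two crossing cuts crosses the other but neither of the
-- corners. Both minima are unaffected by automorphisms and complements, and homogeneity on single
-- arcs maps any edge to any other up to reversal, whence the equal counts. They are finite because
-- only finitely many thin cuts separate two given vertices. The classes of neighbours are cliques
-- for this reason: a nonadjacent pair on one side would spread, by homogeneity on paths of length
-- two, to all the neighbours of `v`, and a cut with all of them inside and `v` outside leaves
-- nothing but `v` outside. Sizes are never computed: an upper bound is a list that covers a
-- predicate up to the equality of the setoid, and minimality compares such bounds.

-- Excluded middle, least numbers and filtered lists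

module Classical (em : ∀ {ℓ} → ExcludedMiddle ℓ) where

  private
    variable
      a p q r : Level
      A : Set a

  dec : (P : Set p) → Dec P
  dec P = em

  by-contradiction : {P : Set p} → ¬ ¬ P → P
  by-contradiction = decidable-stable em

  least : (P : ℕ → Set p) → ∀ n → P n → ∃[ m ] P m × (∀ k → P k → m ≤ k)
  least P zero    pn = zero , pn , λ _ _ → z≤n
  least P (suc n) pn with dec (P zero)
  ... | yes p0 = zero , p0 , λ _ _ → z≤n
  ... | no ¬p0 with least (P ∘ suc) n pn
  ...   | m , pm , min = suc m , pm , λ { zero p0 → contradiction p0 ¬p0 ; (suc k) pk → s≤s (min k pk) }

  sift : Pred A p → List A → List A
  sift P = filter (λ x → dec (P x))

  sift⁺ : {P : Pred A p} {R : Pred A r} → (∀ {x} → R x → P x) →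
          ∀ {xs} → Any R xs → Any R (sift P xs)
  sift⁺ {P = P} imp {x ∷ xs} (here rx) with dec (P x)
  ... | yes _ = here rx
  ... | no ¬p = contradiction (imp rx) ¬p
  sift⁺ {P = P} imp {x ∷ xs} (there rxs) with dec (P x)
  ... | yes _ = there (sift⁺ imp rxs)
  ... | no  _ = sift⁺ imp rxs

  sift-disjoint : {P : Pred A p} {Q : Pred A q} → (∀ {x} → P x → ¬ Q x) →
                  ∀ xs → length (sift P xs) + length (sift Q xs) ≤ length xs
  sift-disjoint dis [] = z≤n
  sift-disjoint {P = P} {Q = Q} dis (x ∷ xs) with dec (P x) | dec (Q x) | sift-disjoint {P = P} {Q} dis xs
  ... | yes p | yes q | _  = contradiction q (dis p)
  ... | yes _ | no _  | ih = s≤s ih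
  ... | no _  | no _  | ih = m≤n⇒m≤1+n ih
  ... | no _  | yes _ | ih = ≤-trans (≤-reflexive (+-suc _ _)) (s≤s ih)

  sift-disjoint-< : {P : Pred A p} {Q : Pred A q} → (∀ {x} → P x → ¬ Q x) →
                    ∀ {xs} → Any (λ x → ¬ P x × ¬ Q x) xs →
                    length (sift P xs) + length (sift Q xs) < length xs
  sift-disjoint-< {P = P} {Q = Q} dis {x ∷ xs} (here (¬p , ¬q)) with dec (P x) | dec (Q x)
  ... | yes p | _     = contradiction p ¬p
  ... | no _  | yes q = contradiction q ¬q
  ... | no _  | no _  = s≤s (sift-disjoint dis xs)
  sift-disjoint-< {P = P} {Q = Q} dis {x ∷ xs} (there any)
    with dec (P x) | dec (Q x) | sift-disjoint-< {P = P} {Q} dis any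
  ... | yes p | yes q | _  = contradiction q (dis p)
  ... | yes _ | no _  | ih = s≤s ih
  ... | no _  | no _  | ih = m≤n⇒m≤1+n ih
  ... | no _  | yes _ | ih = ≤-trans (≤-reflexive (cong suc (+-suc _ _))) (s≤s ih)

  -- The measure behind `cut-edge`, `maximal-chain` and `exhaust`: removing whatever equals a listed
  -- element shortens the list, repetitions or not.
  sift-shorter : {P : Pred A p} → ∀ {xs} → Any (λ x → ¬ P x) xs → length (sift P xs) < length xs
  sift-shorter {P = P} any = ≤-trans (s≤s (m≤m+n _ _))
    (sift-disjoint-< {P = P} {Q = λ _ → ⊥} (λ _ ()) (Any.map (λ ¬p → ¬p , λ ()) any))

-- Counting by covering lists

module Counting (em : ∀ {ℓ} → ExcludedMiddle ℓ)
                {a ℓ} {A : Set a} (_≈_ : Rel A ℓ) (≈-sym : Symmetric _≈_) where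
  open Classical em

  CoveredBy : ∀ {p} → List A → Pred A p → Set _
  CoveredBy xs P = ∀ x → P x → Any (x ≈_) xs

  -- An upper bound in place of a cardinality: the list may repeat elements or contain strangers to
  -- `P`, so no quotient has to be counted exactly.
  AtMost : ∀ {p} → ℕ → Pred A p → Set _
  AtMost n P = ∃[ xs ] length xs ≤ n × CoveredBy xs P

  Invariant : ∀ {p} → Pred A p → Set _
  Invariant P = ∀ {x y} → x ≈ y → P x → P y

  private
    interchange : ∀ a b c d → (a + c) + (b + d) ≡ (a + b) + (c + d)
    interchange a b c d =
      trans (+-assoc a c (b + d))
        (trans (cong (a +_) (trans (sym (+-assoc c b d))
                 (trans (cong (_+ d) (+-comm c b)) (+-assoc b c d))))
          (sym (+-assoc a b (c + d))))

  -- With P, Q the boundaries of two sets and P′, Q′ those of their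
  -- intersection and union this is submodularity; the same count serves for
  -- the numbers of cuts crossing two cuts and two opposite corners of them.
  module _
    {p q p′ q′} {P : Pred A p} {Q : Pred A q} {P′ : Pred A p′} {Q′ : Pred A q′}
    (invP′ : Invariant P′) (invQ′ : Invariant Q′)
    (P′⊆ : ∀ x → P′ x → P x ⊎ Q x) (Q′⊆ : ∀ x → Q′ x → P x ⊎ Q x)
    (both : ∀ x → P′ x → Q′ x → P x × Q x)
    where

    private
      P∖ : Pred A _
      P∖ x = P′ x × ¬ P x
      Q∖ : Pred A _
      Q∖ x = Q′ x × ¬ Q x

      -- An element of `P′` is charged to the list of `P` if it lies in `P`, and to that of `Q`
      -- otherwise. Each entry pays only once: one of `xs` kept for `P′` is not kept for `Q∖` as
      -- well, since lying in both `P′` and `Q′` forces it into `Q`.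
      cover₁ : Invariant P → ∀ {xs ys} → CoveredBy xs P → CoveredBy ys Q →
               CoveredBy (sift P′ xs ++ sift P∖ ys) P′
      cover₁ invP {xs} cP cQ x p′ with dec (P x)
      ... | yes px = Any.++⁺ˡ (sift⁺ (λ e → invP′ e p′) (cP x px))
      ... | no ¬px with P′⊆ x p′
      ...   | inj₁ px = contradiction px ¬px
      ...   | inj₂ qx = Any.++⁺ʳ (sift P′ xs)
                          (sift⁺ (λ e → invP′ e p′ , λ py → ¬px (invP (≈-sym e) py)) (cQ x qx))

      cover₂ : Invariant Q → ∀ {xs ys} → CoveredBy xs P → CoveredBy ys Q →
               CoveredBy (sift Q∖ xs ++ sift Q′ ys) Q′
      cover₂ invQ {xs} cP cQ x q′ with dec (Q x)
      ... | yes qx = Any.++⁺ʳ (sift Q∖ xs) (sift⁺ (λ e → invQ′ e q′) (cQ x qx))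
      ... | no ¬qx with Q′⊆ x q′
      ...   | inj₂ qx = contradiction qx ¬qx
      ...   | inj₁ px = Any.++⁺ˡ
                          (sift⁺ (λ e → invQ′ e q′ , λ qy → ¬qx (invQ (≈-sym e) qy)) (cP x px))

      disjointˡ : ∀ {x} → P′ x → ¬ Q∖ x
      disjointˡ p′ (q′ , ¬q) = ¬q (proj₂ (both _ p′ q′))

      disjointʳ : ∀ {x} → P∖ x → ¬ Q′ x
      disjointʳ (p′ , ¬p) q′ = ¬p (proj₁ (both _ p′ q′))

      lengths : ∀ xs ys → length (sift P′ xs ++ sift P∖ ys) + length (sift Q∖ xs ++ sift Q′ ys) ≡
                (length (sift P′ xs) + length (sift Q∖ xs)) + (length (sift P∖ ys) + length (sift Q′ ys))
      lengths xs ys = trans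
        (cong₂ _+_ (length-++ (sift P′ xs)) (length-++ (sift Q∖ xs)))
        (interchange (length (sift P′ xs)) (length (sift Q∖ xs)) _ _)

    uncross : Invariant P → Invariant Q → ∀ {n m} → AtMost n P → AtMost m Q →
              ∃[ n′ ] ∃[ m′ ] AtMost n′ P′ × AtMost m′ Q′ × n′ + m′ ≤ n + m
    uncross invP invQ (xs , ln , cP) (ys , lm , cQ) =
      _ , _ , (_ , ≤-refl , cover₁ invP cP cQ) , (_ , ≤-refl , cover₂ invQ cP cQ) ,
      ≤-trans (≤-reflexive (lengths xs ys))
        (+-mono-≤ (≤-trans (sift-disjoint disjointˡ xs) ln) (≤-trans (sift-disjoint disjointʳ ys) lm))

    -- The entry of `xs` that covers `z` is kept in neither of the new lists.
    uncross-< : Invariant P → Invariant Q → ∀ {n m} → AtMost n P → AtMost m Q →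
                ∀ z → P z → ¬ P′ z → ¬ Q′ z →
                ∃[ n′ ] ∃[ m′ ] AtMost n′ P′ × AtMost m′ Q′ × n′ + m′ < n + m
    uncross-< invP invQ (xs , ln , cP) (ys , lm , cQ) z pz ¬p′ ¬q′ =
      _ , _ , (_ , ≤-refl , cover₁ invP cP cQ) , (_ , ≤-refl , cover₂ invQ cP cQ) ,
      ≤-trans (s≤s (≤-reflexive (lengths xs ys)))
        (+-mono-≤ (≤-trans (sift-disjoint-< disjointˡ
                     (Any.map (λ e → (λ p′ → ¬p′ (invP′ (≈-sym e) p′))
                                   , (λ q′ → ¬q′ (invQ′ (≈-sym e) (proj₁ q′)))) (cP z pz))) ln)
                  (≤-trans (sift-disjoint disjointʳ ys) lm))

  atMost-⊆ : ∀ {p q} {P : Pred A p} {Q : Pred A q} {n} → (∀ x → Q x → P x) → AtMost n P → AtMost n Q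
  atMost-⊆ Q⊆P (xs , l , c) = xs , l , λ x q → c x (Q⊆P x q)

-- Walks, subsets and boundaries in a digraph

module Graph {c ℓ a} (D : Digraph c ℓ a) where
  open Digraph D public

  ∼-sym : ∀ {x y} → x ∼ y → y ∼ x
  ∼-sym (fwd p) = bwd p
  ∼-sym (bwd p) = fwd p

  ⟶-respʳ : ∀ {x y z} → y ≈ z → x ⟶ y → x ⟶ z
  ⟶-respʳ = proj₁ ⟶-resp-≈

  ⟶-respˡ : ∀ {x y z} → y ≈ z → y ⟶ x → z ⟶ x
  ⟶-respˡ = proj₂ ⟶-resp-≈

  ∼-respʳ : ∀ {x y z} → y ≈ z → x ∼ y → x ∼ z
  ∼-respʳ e (fwd p) = fwd (⟶-respʳ e p)
  ∼-respʳ e (bwd p) = bwd (⟶-respˡ e p)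

  ∼-respˡ : ∀ {x y z} → y ≈ z → y ∼ x → z ∼ x
  ∼-respˡ e p = ∼-sym (∼-respʳ e (∼-sym p))

  ∼⇒≉ : ∀ {x y} → x ∼ y → ¬ x ≈ y
  ∼⇒≉ (fwd p) e = ⟶-irrefl e p
  ∼⇒≉ (bwd p) e = ⟶-irrefl (≈-sym e) p

  ⟶-asym : ∀ {x y} → x ⟶ y → ¬ y ⟶ x
  ⟶-asym p q = ⟶-irrefl (⟶-antisym p q) p

  ∈-resp : ∀ {x y xs} → x ≈ y → x ∈ xs → y ∈ xs
  ∈-resp e = Any.map (λ p → ≈-trans (≈-sym e) p)

  -- The Boolean lets one argument treat both orientations; `not s` is the opposite one.
  Neighbour : Bool → Rel Vertex a
  Neighbour true  v x = v ⟶ x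
  Neighbour false v x = x ⟶ v

  neighbour⇒∼ : ∀ s {v x} → Neighbour s v x → v ∼ x
  neighbour⇒∼ true  p = fwd p
  neighbour⇒∼ false p = bwd p

  neighbour-side : ∀ {v x} → v ∼ x → ∃[ s ] Neighbour s v x
  neighbour-side (fwd p) = true , p
  neighbour-side (bwd p) = false , p

  neighbour-resp : ∀ s {v v′ x x′} → v ≈ v′ → x ≈ x′ → Neighbour s v x → Neighbour s v′ x′
  neighbour-resp true  e f p = ⟶-respˡ e (⟶-respʳ f p)
  neighbour-resp false e f p = ⟶-respˡ f (⟶-respʳ e p)

  data Walk {r} (R : Rel Vertex r) : Rel Vertex (c ⊔ˡ ℓ ⊔ˡ r) where
    done : ∀ {x y} → x ≈ y → Walk R x y
    step : ∀ {x x′ y z} → x ≈ x′ → R x′ y → Walk R y z → Walk R x z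

  module _ {r} {R : Rel Vertex r} where
    walk-≈ : ∀ {x y z} → x ≈ y → Walk R y z → Walk R x z
    walk-≈ e (done f)     = done (≈-trans e f)
    walk-≈ e (step f r w) = step (≈-trans e f) r w

    walk-trans : ∀ {x y z} → Walk R x y → Walk R y z → Walk R x z
    walk-trans (done e)     w = walk-≈ e w
    walk-trans (step e r v) w = step e r (walk-trans v w)

    walk-step : ∀ {x y} → R x y → Walk R x y
    walk-step r = step ≈-refl r (done ≈-refl)

    walk-sym : Symmetric R → ∀ {x y} → Walk R x y → Walk R y x
    walk-sym s (done e)     = done (≈-sym e)
    walk-sym s (step e r w) = walk-trans (walk-sym s w) (step ≈-refl (s r) (done (≈-sym e)))

    walk-invariant : ∀ {q} (Q : Pred Vertex q) → (∀ {x y} → x ≈ y → Q x → Q y) →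
                     (∀ {x y} → R x y → Q x → Q y) → ∀ {x y} → Walk R x y → Q x → Q y
    walk-invariant Q resp cl (done e)     q = resp e q
    walk-invariant Q resp cl (step e r w) q = walk-invariant Q resp cl w (cl r (resp e q))

    walk-exit : ∀ {q} (Q : Pred Vertex q) → (∀ x → Dec (Q x)) → (∀ {x y} → x ≈ y → Q x → Q y) →
                ∀ {x y} → Walk R x y → Q x → ¬ Q y → ∃[ x′ ] ∃[ y′ ] R x′ y′ × Q x′ × ¬ Q y′
    walk-exit Q Q? resp (done e) q ¬q = contradiction (resp e q) ¬q
    walk-exit Q Q? resp (step {x′ = x′} {y} e r w) q ¬q with Q? y
    ... | yes qy = walk-exit Q Q? resp w qy ¬q
    ... | no ¬qy = x′ , y , r , resp e q , ¬qy

  walk-map : ∀ {r s} {R : Rel Vertex r} {S : Rel Vertex s} → (∀ {x y} → R x y → S x y) →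
             ∀ {x y} → Walk R x y → Walk S x y
  walk-map f (done e)     = done e
  walk-map f (step e r w) = step e (f r) (walk-map f w)

  connected⇒walk : Connected D → ∀ x y → Walk _∼_ x y
  connected⇒walk conn x y = go (conn x y)
    where
    go : ∀ {x y} → Star _ x y → Walk _∼_ x y
    go ε = done ≈-refl
    go (fwd (inj₁ e) ◅ w) = walk-≈ e (go w)
    go (fwd (inj₂ e) ◅ w) = step ≈-refl (fwd e) (go w)
    go (bwd (inj₁ e) ◅ w) = walk-≈ (≈-sym e) (go w)
    go (bwd (inj₂ e) ◅ w) = step ≈-refl (bwd e) (go w)

  -- Two-valued, so that complements and corners are Boolean operations; predicates become subsets
  -- by excluded middle.
  record Subset : Set (c ⊔ˡ ℓ) where
    field
      χ      : Vertex → Bool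
      χ-resp : ∀ {x y} → x ≈ y → χ x ≡ χ y
  open Subset public

  infix 4 _≐_
  _≐_ : Rel Subset c
  e ≐ f = ∀ x → χ e x ≡ χ f x

  ≐-sym : Symmetric _≐_
  ≐-sym p x = sym (p x)

  ∁ : Subset → Subset
  ∁ e = record { χ = not ∘ χ e ; χ-resp = cong not ∘ χ-resp e }

  infixr 7 _∩_
  _∩_ : Subset → Subset → Subset
  e ∩ f = record { χ = λ x → χ e x ∧ χ f x ; χ-resp = λ p → cong₂ _∧_ (χ-resp e p) (χ-resp f p) }

  ∩⁺ : ∀ e f {x} → χ e x ≡ true → χ f x ≡ true → χ (e ∩ f) x ≡ true
  ∩⁺ e f p q = cong₂ _∧_ p q

  ∩⁻ : ∀ e f {x} → χ (e ∩ f) x ≡ true → χ e x ≡ true × χ f x ≡ true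
  ∩⁻ e f {x} p with χ e x | χ f x
  ... | true | true = refl , refl
  ∩⁻ e f {x} () | true | false
  ∩⁻ e f {x} () | false | _

  Infinite : Pred Subset (c ⊔ˡ ℓ)
  Infinite e = ¬ (∃[ xs ] (∀ x → χ e x ≡ true → x ∈ xs))

  infinite-⊆ : ∀ e f → (∀ x → χ e x ≡ true → χ f x ≡ true) → Infinite e → Infinite f
  infinite-⊆ e f e⊆f inf (xs , cov) = inf (xs , λ x p → cov x (e⊆f x p))

  infixr 4 _≈²_
  _≈²_ : Rel (Vertex × Vertex) ℓ
  (x , y) ≈² (x′ , y′) = x ≈ x′ × y ≈ y′

  ≈²-sym : Symmetric _≈²_
  ≈²-sym (p , q) = ≈-sym p , ≈-sym q

  -- Pairs point from the inside to the outside, so that a boundary edge is counted once.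
  Boundary : Subset → Pred (Vertex × Vertex) a
  Boundary e (x , y) = x ∼ y × χ e x ≡ true × χ e y ≡ false

  boundary-resp : ∀ e {p q} → p ≈² q → Boundary e p → Boundary e q
  boundary-resp e (p , q) (a , i , o) =
    ∼-respˡ p (∼-respʳ q a) , trans (sym (χ-resp e p)) i , trans (sym (χ-resp e q)) o

-- From two ends to a finite cut

module Ends (em : ∀ {ℓ} → ExcludedMiddle ℓ) {c ℓ a} (D : Digraph c ℓ a) (lf : LocallyFinite D) where
  open Classical em
  open Graph D
  open Counting em _≈²_ ≈²-sym using (AtMost)

  at : Ray D → ℕ → Vertex
  at = Ray.at

  adjacent : ∀ (ρ : Ray D) n → at ρ n ∼ at ρ (suc n)
  adjacent = Ray.adjacent

  distinct : ∀ (ρ : Ray D) {m n} → at ρ m ≈ at ρ n → m ≡ n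
  distinct = Ray.distinct

  Respects : ∀ {p} → Pred Vertex p → Set _
  Respects P = ∀ {x y} → x ≈ y → P x → P y

  ⟦_⟧ : ∀ {p} (P : Pred Vertex p) → Respects P → Subset
  ⟦ P ⟧ resp = record { χ = λ x → does (dec (P x)) ; χ-resp = eq }
    where
    eq : ∀ {x y} → x ≈ y → does (dec (P x)) ≡ does (dec (P y))
    eq {x} {y} e with dec (P x) | dec (P y)
    ... | yes _ | yes _ = refl
    ... | yes p | no ¬q = contradiction (resp e p) ¬q
    ... | no ¬p | yes q = contradiction (resp (≈-sym e) q) ¬p
    ... | no _  | no _  = refl

  ∈⟦⟧⁺ : ∀ {p} {P : Pred Vertex p} (resp : Respects P) {x} → P x → χ (⟦ P ⟧ resp) x ≡ true
  ∈⟦⟧⁺ {P = P} resp {x} p with dec (P x)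
  ... | yes _ = refl
  ... | no ¬p = contradiction p ¬p

  ∈⟦⟧⁻ : ∀ {p} {P : Pred Vertex p} (resp : Respects P) {x} → χ (⟦ P ⟧ resp) x ≡ true → P x
  ∈⟦⟧⁻ {P = P} resp {x} e with dec (P x)
  ... | yes p = p

  ∉⟦⟧⁻ : ∀ {p} {P : Pred Vertex p} (resp : Respects P) {x} → χ (⟦ P ⟧ resp) x ≡ false → ¬ P x
  ∉⟦⟧⁻ {P = P} resp {x} e with dec (P x)
  ... | no ¬p = ¬p

  neighbours : Vertex → List Vertex
  neighbours x = proj₁ (proj₁ (lf x)) ++ proj₁ (proj₂ (lf x))

  ∈-neighbours : ∀ {x y} → x ∼ y → y ∈ neighbours x
  ∈-neighbours {x} {y} (fwd p) = Any.++⁺ˡ (Equivalence.to (proj₂ (proj₁ (lf x)) y) p)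
  ∈-neighbours {x} {y} (bwd p) = Any.++⁺ʳ (proj₁ (proj₁ (lf x))) (Equivalence.to (proj₂ (proj₂ (lf x)) y) p)

  Cut : Pred Subset _
  Cut e = Infinite e × Infinite (∁ e)

  FiniteCut : Pred Subset _
  FiniteCut e = Cut e × ∃[ n ] AtMost n (Boundary e)

  drop : ℕ → Ray D → Ray D
  drop n ρ = record
    { at       = λ i → at ρ (n + i)
    ; adjacent = λ i → subst (λ j → at ρ (n + i) ∼ at ρ j) (sym (+-suc n i)) (adjacent ρ (n + i))
    ; distinct = λ e → +-cancelˡ-≡ n _ _ (distinct ρ e)
    }

  cons : ∀ x (ρ : Ray D) → x ∼ at ρ 0 → (∀ n → ¬ x ≈ at ρ n) → Ray D
  cons x ρ x∼ new = record
    { at       = f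
    ; adjacent = λ { zero → x∼ ; (suc n) → adjacent ρ n }
    ; distinct = λ {m} {n} → dist m n
    }
    where
    f : ℕ → Vertex
    f zero    = x
    f (suc n) = at ρ n
    dist : ∀ m n → f m ≈ f n → m ≡ n
    dist zero    zero    _ = refl
    dist zero    (suc n) e = contradiction e (new n)
    dist (suc m) zero    e = contradiction (≈-sym e) (new m)
    dist (suc m) (suc n) e = cong suc (distinct ρ e)

  eventually-outside : ∀ (ρ : Ray D) xs → ∃[ m ] (∀ n → m ≤ n → ¬ at ρ n ∈ xs)
  eventually-outside ρ [] = 0 , λ _ _ ()
  eventually-outside ρ (x ∷ xs) with eventually-outside ρ xs | dec (∃[ n ] at ρ n ≈ x)
  ... | m , out | no ¬hit = m , λ { n m≤n (here e) → ¬hit (n , e) ; n m≤n (there i) → out n m≤n i }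
  ... | m , out | yes (k , hit) = m ⊔ suc k , λ
    { n le (here e) → <-irrefl (distinct ρ (≈-trans hit (≈-sym e))) (m⊔n≤o⇒n≤o m (suc k) le)
    ; n le (there i) → out n (m⊔n≤o⇒m≤o m (suc k) le) i }

  MeetsOften : Ray D → Ray D → Set _
  MeetsOften = MeetsInfinitelyOften D

  meets-drop : ∀ {ζ σ} n → MeetsOften ζ σ → MeetsOften (drop n ζ) σ
  meets-drop {ζ} n meets i with meets (n + i)
  ... | m , le , k , e = m ∸ n , subst (_≤ m ∸ n) (m+n∸m≡n n i) (∸-monoˡ-≤ n le) , k ,
    subst (λ j → at ζ j ≈ _) (sym (m+[n∸m]≡n (≤-trans (m≤m+n n i) le))) e

  meets-cons : ∀ {x ζ σ} x∼ new → MeetsOften ζ σ → MeetsOften (cons x ζ x∼ new) σ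
  meets-cons x∼ new meets i with meets i
  ... | m , le , k , e = suc m , m≤n⇒m≤1+n le , k , e

  -- The segment is moved in front of `ζ` from its last vertex backwards, one `cons` at a time.
  prepend : ∀ N (ξ ζ : Ray D) → at ξ N ∼ at ζ 0 → (∀ i n → i ≤ N → ¬ at ξ i ≈ at ζ n) →
            ∃[ ζ′ ] (∀ i → i ≤ N → at ζ′ i ≈ at ξ i) × (∀ j → at ζ′ (suc N + j) ≈ at ζ j)
  prepend zero ξ ζ adj new =
    cons (at ξ 0) ζ adj (λ n → new 0 n z≤n) , (λ { .0 z≤n → ≈-refl }) , λ _ → ≈-refl
  prepend (suc N) ξ ζ adj new
    with prepend N ξ (cons (at ξ (suc N)) ζ adj (λ n → new (suc N) n ≤-refl)) (adjacent ξ N)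
           (λ { i zero le e → <-irrefl (distinct ξ e) (s≤s le) ; i (suc n) le e → new i n (m≤n⇒m≤1+n le) e })
  ... | ζ′ , agree , tail = ζ′ , agree′ , λ j → subst (λ k → at ζ′ k ≈ at ζ j) (+-suc (suc N) j) (tail (suc j))
    where
    agree′ : ∀ i → i ≤ suc N → at ζ′ i ≈ at ξ i
    agree′ i le with m≤n⇒m<n∨m≡n le
    ... | inj₁ (s≤s lt) = agree i lt
    ... | inj₂ refl     = subst (λ k → at ζ′ k ≈ at ξ (suc N)) (+-identityʳ (suc N)) (tail 0)

  -- If there are no finite cuts, then any ray can be rerouted, beyond any of
  -- its initial segments, so as to meet any other ray.
  module NoCuts (no-cut : ¬ (∃[ e ] FiniteCut e)) where

    Avoiding : List Vertex → Rel Vertex _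
    Avoiding xs x y = x ∼ y × ¬ x ∈ xs × ¬ y ∈ xs

    -- The set `C` of vertices that can be reached from `ξ` without touching `xs` is infinite, and
    -- its boundary edges all end in `xs`. As there is no finite cut, its complement is finite, so a
    -- tail of `σ` lies in `C`.
    escape : ∀ xs (ξ σ : Ray D) → (∀ n → ¬ at ξ n ∈ xs) →
             ∃[ m ] (∀ n → m ≤ n → ¬ at σ n ∈ xs) × Walk (Avoiding xs) (at ξ 0) (at σ m)
    escape xs ξ σ out = outcome
      where
      resp : ∀ {x y} → x ≈ y → Walk (Avoiding xs) (at ξ 0) x → Walk (Avoiding xs) (at ξ 0) y
      resp e w = walk-trans w (done e)
      C = ⟦ Walk (Avoiding xs) (at ξ 0) ⟧ resp

      inside : ∀ {x} → Walk (Avoiding xs) (at ξ 0) x → ¬ x ∈ xs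
      inside w = walk-invariant (λ x → ¬ x ∈ xs) (λ e ∉ i → ∉ (∈-resp (≈-sym e) i)) (λ r _ → proj₂ (proj₂ r)) w (out 0)

      edges : List (Vertex × Vertex)
      edges = concatMap (λ s → map (_, s) (neighbours s)) xs

      edges-cover : ∀ ys {x y} → y ∈ ys → x ∼ y → Any ((x , y) ≈²_) (concatMap (λ s → map (_, s) (neighbours s)) ys)
      edges-cover (s ∷ ys) (here e)  adj = Any.++⁺ˡ (Any.map⁺ (Any.map (λ f → f , e) (∈-neighbours (∼-sym (∼-respʳ e adj)))))
      edges-cover (s ∷ ys) (there i) adj = Any.++⁺ʳ _ (edges-cover ys i adj)

      boundary : ∀ p → Boundary C p → Any (p ≈²_) edges
      boundary (x , y) (adj , i , o) with dec (y ∈ xs)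
      ... | yes y∈ = edges-cover xs y∈ adj
      ... | no y∉  = contradiction
        (walk-trans w (walk-step (adj , inside w , y∉))) (∉⟦⟧⁻ resp o)
        where w = ∈⟦⟧⁻ resp i

      reach : ∀ n → Walk (Avoiding xs) (at ξ 0) (at ξ n)
      reach zero    = done ≈-refl
      reach (suc n) = walk-trans (reach n) (walk-step (adjacent ξ n , out n , out (suc n)))

      infinite : Infinite C
      infinite (ys , cov) with eventually-outside ξ ys
      ... | m , out′ = out′ m ≤-refl (cov _ (∈⟦⟧⁺ resp (reach m)))

      outcome : ∃[ m ] (∀ n → m ≤ n → ¬ at σ n ∈ xs) × Walk (Avoiding xs) (at ξ 0) (at σ m)
      outcome with dec (Infinite (∁ C))
      ... | yes inf = contradiction (C , (infinite , inf) , length edges , edges , ≤-refl , boundary) no-cut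
      ... | no fin with by-contradiction fin
      ...   | ys , cov with eventually-outside σ (xs ++ ys)
      ...     | m , out″ = m , (λ n le i → out″ n le (Any.++⁺ˡ i)) , hit
        where
        hit : Walk (Avoiding xs) (at ξ 0) (at σ m)
        hit with χ C (at σ m) in eq
        ... | true  = ∈⟦⟧⁻ resp eq
        ... | false = contradiction (Any.++⁺ʳ xs (cov (at σ m) (cong not eq))) (out″ m ≤-refl)

    -- Loop erasure from the far end: a vertex of the walk is put in front of the ray already built
    -- or, if it lies on that ray, the ray is cut back to it.
    ray-along : ∀ xs (σ : Ray D) {m} → (∀ n → m ≤ n → ¬ at σ n ∈ xs) →
                ∀ {x y} → y ≈ at σ m → ¬ x ∈ xs → Walk (Avoiding xs) x y →
                ∃[ ζ ] at ζ 0 ≈ x × (∀ n → ¬ at ζ n ∈ xs) × MeetsOften ζ σ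
    ray-along xs σ {m} out y≈ x∉ (done e) =
      drop m σ , ≈-trans (subst (λ j → at σ j ≈ at σ m) (sym (+-identityʳ m)) ≈-refl) (≈-sym (≈-trans e y≈)) ,
      (λ n → out (m + n) (m≤m+n m n)) , λ n → n , ≤-refl , m + n , ≈-refl
    ray-along xs σ out {x} y≈ x∉ (step e (adj , _ , z∉) w) with ray-along xs σ out y≈ z∉ w
    ... | ζ , ζ0≈ , ζ∉ , meets with dec (∃[ n ] at ζ n ≈ x)
    ...   | yes (n , hit) = drop n ζ , subst (λ j → at ζ j ≈ x) (sym (+-identityʳ n)) hit ,
                            (λ i → ζ∉ (n + i)) , meets-drop {ζ} {σ} n meets
    ...   | no ¬hit = cons x ζ x∼ new , ≈-refl , (λ { zero → x∉ ; (suc n) → ζ∉ n }) ,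
                      meets-cons {ζ = ζ} {σ} x∼ new meets
      where
      x∼ : x ∼ at ζ 0
      x∼ = ∼-respˡ (≈-sym e) (∼-respʳ (≈-sym ζ0≈) adj)
      new : ∀ n → ¬ x ≈ at ζ n
      new n f = ¬hit (n , ≈-sym f)

    initial : Ray D → ℕ → List Vertex
    initial ξ zero    = at ξ 0 ∷ []
    initial ξ (suc n) = at ξ (suc n) ∷ initial ξ n

    ∈-initial⁻ : ∀ ξ N {x} → x ∈ initial ξ N → ∃[ i ] i ≤ N × x ≈ at ξ i
    ∈-initial⁻ ξ zero    (here e) = 0 , z≤n , e
    ∈-initial⁻ ξ (suc N) (here e) = suc N , ≤-refl , e
    ∈-initial⁻ ξ (suc N) (there p) with ∈-initial⁻ ξ N p
    ... | i , le , e = i , m≤n⇒m≤1+n le , e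

    ∈-initial⁺ : ∀ ξ N {i x} → i ≤ N → x ≈ at ξ i → x ∈ initial ξ N
    ∈-initial⁺ ξ zero    z≤n e = here e
    ∈-initial⁺ ξ (suc N) le e with m≤n⇒m<n∨m≡n le
    ... | inj₁ (s≤s lt) = there (∈-initial⁺ ξ N lt e)
    ... | inj₂ refl     = here e

    reroute : ∀ (ξ σ : Ray D) N → ∃[ ζ ] (∀ i → i ≤ N → at ζ i ≈ at ξ i) × (∃[ k ] N < k × (∃[ m ] at ζ k ≈ at σ m))
    reroute ξ σ N
      with escape (initial ξ N) (drop (suc N) ξ) σ
             (λ n p → let (i , le , e) = ∈-initial⁻ ξ N p in
                      <-irrefl (sym (distinct ξ e)) (≤-trans (s≤s le) (m≤m+n (suc N) n)))
    ... | m , out , w with ray-along (initial ξ N) σ out ≈-refl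
                             (λ p → let (i , le , e) = ∈-initial⁻ ξ N p in
                                <-irrefl (sym (distinct ξ e)) (≤-trans (s≤s le) (m≤m+n (suc N) 0))) w
    ...   | ζ , ζ0≈ , ζ∉ , meets
        with prepend N ξ ζ (∼-respʳ (≈-sym ζ0≈) (subst (λ j → at ξ N ∼ at ξ j) (sym (+-identityʳ (suc N))) (adjacent ξ N)))
               (λ i n le e → ζ∉ n (∈-initial⁺ ξ N le (≈-sym e)))
    ...     | ζ′ , agree , tail with meets 0
    ...       | k , _ , j , e = ζ′ , agree , suc N + k , m≤m+n (suc N) k , j , ≈-trans (tail k) e

    module _ (ρ σ : Ray D) where
      -- The meetings with `ρ` and `σ` lie beyond `N` but not beyond `bound`, the length up to which
      -- all later stages agree with this one. Hence they survive in the limit.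
      record Stage (ξ : Ray D) (N : ℕ) : Set (c ⊔ˡ ℓ ⊔ˡ a) where
        field
          ray    : Ray D
          bound  : ℕ
          grows  : N < bound
          agrees : ∀ i → i ≤ N → at ray i ≈ at ξ i
          meetsρ : ∃[ k ] N < k × k ≤ bound × (∃[ m ] at ray k ≈ at ρ m)
          meetsσ : ∃[ k ] N < k × k ≤ bound × (∃[ m ] at ray k ≈ at σ m)

      abstract
        next : ∀ ξ N → Stage ξ N
        next ξ N with reroute ξ ρ N
        ... | ζ , agree , k , N<k , m , e with reroute ζ σ k
        ...   | ζ′ , agree′ , k′ , k<k′ , m′ , e′ = record
          { ray = ζ′ ; bound = k′ ; grows = <-trans N<k k<k′
          ; agrees = λ i le → ≈-trans (agree′ i (≤-trans le (<⇒≤ N<k))) (agree i le)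
          ; meetsρ = k , N<k , <⇒≤ k<k′ , m , ≈-trans (agree′ k ≤-refl) e
          ; meetsσ = k′ , <-trans N<k k<k′ , ≤-refl , m′ , e′ }

      stages : ℕ → Ray D × ℕ
      stages zero    = ρ , 0
      stages (suc n) = let s = next (proj₁ (stages n)) (proj₂ (stages n)) in Stage.ray s , Stage.bound s

      ξ : ℕ → Ray D
      ξ n = proj₁ (stages n)
      N : ℕ → ℕ
      N n = proj₂ (stages n)

      n≤N : ∀ n → n ≤ N n
      n≤N zero    = z≤n
      n≤N (suc n) = ≤-trans (s≤s (n≤N n)) (Stage.grows (next (ξ n) (N n)))

      ξ-agree : ∀ {i j} → i ≤′ j → N i ≤ N j × (∀ x → x ≤ N i → at (ξ j) x ≈ at (ξ i) x)
      ξ-agree ≤′-refl = ≤-refl , λ _ _ → ≈-refl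
      ξ-agree (≤′-step {j} le) with ξ-agree le
      ... | N≤ , agree = ≤-trans N≤ (<⇒≤ (Stage.grows s)) , λ x p → ≈-trans (Stage.agrees s x (≤-trans p N≤)) (agree x p)
        where s = next (ξ j) (N j)

      -- Stage `x` is already fixed up to `N x`, which is at least `x`; it is compared with stage
      -- `i` at the later of the two.
      limit-at : ∀ i x → x ≤ N i → at (ξ x) x ≈ at (ξ i) x
      limit-at i x le = ≈-trans (≈-sym (proj₂ (ξ-agree (≤⇒≤′ (m≤m⊔n x i))) x (n≤N x)))
                                (proj₂ (ξ-agree (≤⇒≤′ (m≤n⊔m x i))) x le)

      limit : Ray D
      limit = record
        { at       = λ n → at (ξ n) n
        ; adjacent = λ n → ∼-respˡ (≈-sym (limit-at (suc n) n (≤-trans (n≤1+n n) (n≤N (suc n))))) (adjacent (ξ (suc n)) n)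
        ; distinct = λ {m} {n} e → distinct (ξ (m ⊔ n))
            (≈-trans (≈-sym (limit-at (m ⊔ n) m (≤-trans (m≤m⊔n m n) (n≤N _))))
              (≈-trans e (limit-at (m ⊔ n) n (≤-trans (m≤n⊔m m n) (n≤N _)))))
        }

      same-end : SameEnd D ρ σ
      same-end = limit ,
        (λ n → let (k , N<k , k≤ , m , e) = Stage.meetsρ (next (ξ n) (N n)) in
               k , ≤-trans (n≤N n) (<⇒≤ N<k) , m , ≈-trans (limit-at (suc n) k k≤) e) ,
        (λ n → let (k , N<k , k≤ , m , e) = Stage.meetsσ (next (ξ n) (N n)) in
               k , ≤-trans (n≤N n) (<⇒≤ N<k) , m , ≈-trans (limit-at (suc n) k k≤) e)

  finite-cut : MoreThanOneEnd D → ∃[ e ] FiniteCut e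
  finite-cut (ρ , σ , ρ≁σ) = by-contradiction λ no-cut → ρ≁σ (NoCuts.same-end no-cut ρ σ)

-- Isomorphisms of digraphs

module _ where
  private
    variable
      c ℓ a c′ ℓ′ a′ c″ ℓ″ a″ : Level

  ≅-refl : {D : Digraph c ℓ a} → D ≅ D
  ≅-refl {D = D} = record { bijection = Identity.inverse (Digraph.vertices D) ; arcs = λ _ _ → mk⇔ id id }

  ≅-sym : {D : Digraph c ℓ a} {E : Digraph c′ ℓ′ a′} → D ≅ E → E ≅ D
  ≅-sym {D = D} {E} α = record
    { bijection = Symmetry.inverse bijection
    ; arcs = λ x y → mk⇔
        (λ p → Equivalence.from (arcs (from x) (from y))
                 (E.⟶-respˡ (E.≈-sym (strictlyInverseˡ x)) (E.⟶-respʳ (E.≈-sym (strictlyInverseˡ y)) p)))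
        (λ p → E.⟶-respˡ (strictlyInverseˡ x) (E.⟶-respʳ (strictlyInverseˡ y)
                 (Equivalence.to (arcs (from x) (from y)) p)))
    }
    where
    module E = Graph E
    open _≅_ α
    open Inverse bijection using (strictlyInverseˡ)

  ≅-trans : {D : Digraph c ℓ a} {E : Digraph c′ ℓ′ a′} {F : Digraph c″ ℓ″ a″} → D ≅ E → E ≅ F → D ≅ F
  ≅-trans α β = record
    { bijection = Composition.inverse (_≅_.bijection α) (_≅_.bijection β)
    ; arcs = λ x y → mk⇔
        (λ p → Equivalence.to (_≅_.arcs β _ _) (Equivalence.to (_≅_.arcs α x y) p))
        (λ p → Equivalence.from (_≅_.arcs α x y) (Equivalence.from (_≅_.arcs β _ _) p))
    }

module Iso {c ℓ a c′ ℓ′ a′} {D : Digraph c ℓ a} {E : Digraph c′ ℓ′ a′} (α : D ≅ E) where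
  private
    module D = Graph D
    module E = Graph E
  open _≅_ α public using (to; from)
  open Inverse (_≅_.bijection α) public using (to-cong; from-cong)

  to-from : ∀ x → to (from x) E.≈ x
  to-from = Inverse.strictlyInverseˡ (_≅_.bijection α)

  from-to : ∀ x → from (to x) D.≈ x
  from-to = Inverse.strictlyInverseʳ (_≅_.bijection α)

  injective : ∀ {x y} → to x E.≈ to y → x D.≈ y
  injective {x} {y} e = D.≈-trans (D.≈-sym (from-to x)) (D.≈-trans (from-cong e) (from-to y))

  arc⁺ : ∀ {x y} → x D.⟶ y → to x E.⟶ to y
  arc⁺ = Equivalence.to (_≅_.arcs α _ _)

  arc⁻ : ∀ {x y} → to x E.⟶ to y → x D.⟶ y
  arc⁻ = Equivalence.from (_≅_.arcs α _ _)

  adj⁺ : ∀ {x y} → x D.∼ y → to x E.∼ to y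
  adj⁺ (fwd p) = fwd (arc⁺ p)
  adj⁺ (bwd p) = bwd (arc⁺ p)

  adj⁻ : ∀ {x y} → to x E.∼ to y → x D.∼ y
  adj⁻ (fwd p) = fwd (arc⁻ p)
  adj⁻ (bwd p) = bwd (arc⁻ p)

  neighbour⁺ : ∀ s {v x} → D.Neighbour s v x → E.Neighbour s (to v) (to x)
  neighbour⁺ true  = arc⁺
  neighbour⁺ false = arc⁺

-- Cuts with fewest boundary edges

module Cuts (em : ∀ {ℓ} → ExcludedMiddle ℓ) {c ℓ a} (D : Digraph c ℓ a) (conn : Connected D)
            (lf : LocallyFinite D) (some-cut : ∃[ e ] Ends.FiniteCut em D lf e) where
  open Classical em
  open Graph D
  open Ends em D lf using (Cut; ⟦_⟧; ∈⟦⟧⁺; ∈⟦⟧⁻; ∉⟦⟧⁻; Respects)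
  open Counting em _≈²_ ≈²-sym using (AtMost; uncross-<; atMost-⊆)
  ∉⟦⟧⁺ : ∀ {p} {P : Pred Vertex p} (resp : Respects P) {x} → ¬ P x → χ (⟦ P ⟧ resp) x ≡ false
  ∉⟦⟧⁺ {P = P} resp {x} ¬p with dec (P x)
  ... | yes p = contradiction p ¬p
  ... | no _  = refl

  true≢false : ∀ {b} → b ≡ true → b ≡ false → ⊥
  true≢false refl ()

  exit : ∀ {r} {R : Rel Vertex r} e {x y} → Walk R x y → χ e x ≡ true → χ e y ≡ false →
         ∃[ p ] ∃[ q ] R p q × χ e p ≡ true × χ e q ≡ false
  exit e w i o
    with walk-exit (λ x → χ e x ≡ true) (λ x → χ e x ≟ᵇ true) (λ p → trans (sym (χ-resp e p)))
           w i (λ p → true≢false p o)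
  ... | p , q , r , p∈ , q∉ = p , q , r , p∈ , ¬-not q∉

  atMost-∁ : ∀ e {n} → AtMost n (Boundary e) → AtMost n (Boundary (∁ e))
  atMost-∁ e (L , le , cov) = map swap L , subst (_≤ _) (sym (length-map swap L)) le , λ where
    (x , y) (adj , i , o) → Any.map⁺ (Any.map (λ (p , q) → q , p)
      (cov (y , x) (∼-sym adj , not-injective o , not-injective i)))

  cut-∁ : ∀ e → Cut e → Cut (∁ e)
  cut-∁ e (i , o) = o , infinite-⊆ e (∁ (∁ e)) (λ x p → trans (not-involutive (χ e x)) p) i

  private
    minimum = let (e , cut , n , b) = some-cut in
      least (λ n → ∃[ e ] Cut e × AtMost n (Boundary e)) n (e , cut , b)

  abstract
    k : ℕ
    k = proj₁ minimum

    k-attained : ∃[ e ] Cut e × AtMost k (Boundary e)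
    k-attained = proj₁ (proj₂ minimum)

    k-least : ∀ e {n} → Cut e → AtMost n (Boundary e) → k ≤ n
    k-least e cut b = proj₂ (proj₂ minimum) _ (e , cut , b)

  Thin : Pred Subset _
  Thin e = Cut e × AtMost k (Boundary e)

  thin-∁ : ∀ e → Thin e → Thin (∁ e)
  thin-∁ e (cut , b) = cut-∁ e cut , atMost-∁ e b

  thin-≐ : ∀ e f → e ≐ f → Thin e → Thin f
  thin-≐ e f e≐f ((i , o) , b) =
    (infinite-⊆ e f (λ x p → trans (sym (e≐f x)) p) i ,
     infinite-⊆ (∁ e) (∁ f) (λ x p → trans (cong not (sym (e≐f x))) p) o) ,
    atMost-⊆ (λ { (x , y) (adj , i , o) → adj , trans (e≐f x) i , trans (e≐f y) o }) b

  -- Dropping `z` from a list of `k` edges would beat `k`. The second pair of predicates given to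
  -- `uncross-<` is empty, so that it merely discards one entry.
  no-smaller-cut : ∀ e f → Thin e → Cut f → (∀ p → Boundary f p → Boundary e p) →
                   ∀ z → Boundary e z → ¬ Boundary f z → ⊥
  no-smaller-cut e f (_ , b) cut f⊆e z ze ¬zf
    with uncross-< {P = Boundary e} {Q = λ _ → ⊥} {P′ = Boundary f} {Q′ = λ _ → ⊥}
           (boundary-resp f) (λ _ ()) (λ p i → inj₁ (f⊆e p i)) (λ _ ()) (λ _ _ ())
           (boundary-resp e) (λ _ ()) b ([] , z≤n , λ _ ()) z ze ¬zf (λ ())
  ... | n , m , bf , _ , lt = <-irrefl refl
    (≤-trans (s≤s (k-least f cut bf)) (≤-trans (s≤s (m≤m+n n m)) (≤-trans lt (≤-reflexive (+-identityʳ k)))))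

  infinite-split : ∀ e f → Infinite e → Infinite (e ∩ f) ⊎ Infinite (e ∩ ∁ f)
  infinite-split e f inf with dec (Infinite (e ∩ f)) | dec (Infinite (e ∩ ∁ f))
  ... | yes p | _     = inj₁ p
  ... | no _  | yes q = inj₂ q
  ... | no ¬p | no ¬q with by-contradiction ¬p | by-contradiction ¬q
  ...   | xs , cx | ys , cy = contradiction (xs ++ ys , cov) inf
    where
    cov : ∀ x → χ e x ≡ true → x ∈ xs ++ ys
    cov x i with χ f x in eq
    ... | true  = Any.++⁺ˡ (cx x (∩⁺ e f i eq))
    ... | false = Any.++⁺ʳ xs (cy x (∩⁺ e (∁ f) i (cong not eq)))

  WithinSide : Bool → Subset → Rel Vertex _
  WithinSide b e x y = x ∼ y × χ e x ≡ b × χ e y ≡ b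

  -- Both sides are connected, that is, the boundary is a bond.
  Tight : Pred Subset _
  Tight e = ∀ b x y → χ e x ≡ b → χ e y ≡ b → Walk (WithinSide b e) x y

  -- If `x` and `y` lay in different components of `e`, the component `C` of `x` and the rest `C′`
  -- would have nonempty, disjoint boundaries inside that of `e`. One of `C` and `C′` is infinite,
  -- and it is a cut with fewer edges.
  thin-connected : ∀ e → Thin e → ∀ x y → χ e x ≡ true → χ e y ≡ true → Walk (WithinSide true e) x y
  thin-connected e thin x y x∈ y∈ = by-contradiction λ x≁y → disconnected x≁y
    where
    R = WithinSide true e
    resp : Respects (Walk R x)
    resp p w = walk-trans w (done p)
    C  = ⟦ Walk R x ⟧ resp
    C′ = e ∩ ∁ C

    C⊆e : ∀ {z} → Walk R x z → χ e z ≡ true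
    C⊆e w = walk-invariant (λ z → χ e z ≡ true) (λ p i → trans (sym (χ-resp e p)) i) (λ r _ → proj₂ (proj₂ r)) w x∈

    ∂C⊆ : ∀ p → Boundary C p → Boundary e p
    ∂C⊆ (p , q) (adj , i , o) with χ e q in eq
    ... | false = adj , C⊆e (∈⟦⟧⁻ resp i) , refl
    ... | true  = contradiction
      (walk-trans (∈⟦⟧⁻ resp i) (walk-step (adj , C⊆e (∈⟦⟧⁻ resp i) , eq))) (∉⟦⟧⁻ resp o)

    ∂C′⊆ : ∀ p → Boundary C′ p → Boundary e p
    ∂C′⊆ (p , q) (adj , i , o) with ∩⁻ e (∁ C) i
    ... | p∈ , p∉C with χ e q in eq
    ...   | false = adj , p∈ , refl
    ...   | true  = contradiction
      (walk-trans (∈⟦⟧⁻ resp (not-injective o)) (walk-step (∼-sym adj , eq , p∈)))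
      (∉⟦⟧⁻ resp (not-injective p∉C))

    co-infinite : ∀ f → (∀ z → χ f z ≡ true → χ e z ≡ true) → Infinite (∁ f)
    co-infinite f f⊆e = infinite-⊆ (∁ e) (∁ f)
      (λ z z∉ → cong not (¬-not λ z∈ → true≢false (f⊆e z z∈) (not-injective z∉))) (proj₂ (proj₁ thin))

    disconnected : ¬ Walk R x y → ⊥
    disconnected x≁y with infinite-split e C (proj₁ (proj₁ thin))
                        | exit C  (connected⇒walk conn x y) (∈⟦⟧⁺ resp (done ≈-refl)) (∉⟦⟧⁺ resp x≁y)
                        | exit C′ (connected⇒walk conn y x) (∩⁺ e (∁ C) y∈ (cong not (∉⟦⟧⁺ resp x≁y)))
                               (cong₂ _∧_ x∈ (cong not (∈⟦⟧⁺ resp (done ≈-refl))))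
    ... | inj₁ inf | _ | p , q , adj , p∈ , q∉ = no-smaller-cut e C thin
      (infinite-⊆ (e ∩ C) C (λ z i → proj₂ (∩⁻ e C i)) inf , co-infinite C (λ z i → C⊆e (∈⟦⟧⁻ resp i)))
      ∂C⊆ (p , q) (∂C′⊆ _ (adj , p∈ , q∉))
      (λ { (_ , p∈C , _) → true≢false p∈C (not-injective (proj₂ (∩⁻ e (∁ C) p∈))) })
    ... | inj₂ inf | p , q , adj , p∈ , q∉ | _ = no-smaller-cut e C′ thin
      (inf , co-infinite C′ (λ z i → proj₁ (∩⁻ e (∁ C) i)))
      ∂C′⊆ (p , q) (∂C⊆ _ (adj , p∈ , q∉))
      (λ { (_ , p∈C′ , _) → true≢false p∈ (not-injective (proj₂ (∩⁻ e (∁ C) p∈C′))) })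

  thin⇒tight : ∀ e → Thin e → Tight e
  thin⇒tight e thin true = thin-connected e thin
  thin⇒tight e thin false x y x∉ y∉ =
    walk-map (λ (adj , p , q) → adj , not-injective p , not-injective q)
      (thin-connected (∁ e) (thin-∁ e thin) x y (cong not x∉) (cong not y∉))

-- Finiteness of families of thin cuts, and nestedness

module NestedCuts (em : ∀ {ℓ} → ExcludedMiddle ℓ) {c ℓ a} (D : Digraph c ℓ a) (conn : Connected D)
                  (lf : LocallyFinite D) (some-cut : ∃[ e ] Ends.FiniteCut em D lf e) where
  open Classical em
  open Graph D
  open Ends em D lf using (Cut; ⟦_⟧; ∈⟦⟧⁺; Respects)
  open Counting em _≈²_ ≈²-sym using (CoveredBy)
  open Counting em _≐_ (λ {e} {f} → ≐-sym {e} {f}) using ()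
    renaming (AtMost to AtMostCuts; CoveredBy to CoveredByCuts; uncross-< to uncross-cuts-<; atMost-⊆ to atMostCuts-⊆)
  open Cuts em D conn lf some-cut

  infix 4 _∈²_
  _∈²_ : Vertex × Vertex → List (Vertex × Vertex) → Set _
  p ∈² F = Any (p ≈²_) F

  Outside : List (Vertex × Vertex) → Rel Vertex _
  Outside F x y = x ∼ y × ¬ (x , y) ∈² F × ¬ (y , x) ∈² F

  -- The bonds that cut all the edges in F and at most n others: as long as the
  -- ends of an edge in F are joined outside F, one of the edges of such a walk
  -- is cut too; otherwise the bond is the component of one of the ends.
  BondThrough : ℕ → List (Vertex × Vertex) → Subset → Set _
  BondThrough n F e =
    Tight e × (∀ p q → (p , q) ∈² F → χ e p ≡ true × χ e q ≡ false) ×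
    ∃[ L ] length L ≤ n × CoveredBy (F ++ L) (Boundary e)

  -- The edge joins `F` and leaves `L`, so the allowance of further edges drops by one.
  cut-edge : ∀ {n F e p q} → BondThrough (suc n) F e → Boundary e (p , q) → ¬ (p , q) ∈² F →
             BondThrough n ((p , q) ∷ F) e
  cut-edge {n} {F} {e} {p} {q} (tight , through , L , len , cov) pq∂ pq∉ =
    tight ,
    (λ { p′ q′ (here (a , b)) → trans (χ-resp e a) (proj₁ (proj₂ pq∂)) , trans (χ-resp e b) (proj₂ (proj₂ pq∂))
       ; p′ q′ (there i) → through p′ q′ i }) ,
    L′ , s≤s⁻¹ (≤-trans shorter len) , cov′
    where
    L′ = sift (λ r → ¬ (p , q) ≈² r) L

    pq∈L : (p , q) ∈² L
    pq∈L with Any.++⁻ F (cov _ pq∂)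
    ... | inj₁ i = contradiction i pq∉
    ... | inj₂ i = i

    shorter : length L′ < length L
    shorter = sift-shorter (Any.map (λ e ¬e → ¬e e) pq∈L)

    cov′ : CoveredBy ((p , q) ∷ F ++ L′) (Boundary e)
    cov′ r r∂ with Any.++⁻ F (cov r r∂) | dec ((p , q) ≈² r)
    ... | _      | yes eq = here (≈²-sym eq)
    ... | inj₁ i | no _   = there (Any.++⁺ˡ i)
    ... | inj₂ i | no ¬eq = there (Any.++⁺ʳ F (sift⁺
      (λ (a , b) (a′ , b′) → ¬eq (≈-trans a′ (≈-sym a) , ≈-trans b′ (≈-sym b))) i))

  bonds-finite : ∀ n F {x y} → (x , y) ∈² F → ∃[ Z ] CoveredByCuts Z (BondThrough n F)
  bonds-finite n F {x} {y} xy∈ with dec (Walk (Outside F) x y)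
  ... | no x≁y = K ∷ [] , λ e bond → here (same e bond)
    where
    resp : Respects (Walk (Outside F) x)
    resp p w = walk-trans w (done p)
    K = ⟦ Walk (Outside F) x ⟧ resp

    same : ∀ e → BondThrough n F e → e ≐ K
    same e (tight , through , _) z with χ e z in eq
    ... | true  = sym (∈⟦⟧⁺ resp (walk-map
      (λ (adj , i , j) → adj , (λ m → true≢false j (proj₂ (through _ _ m))) , (λ m → true≢false i (proj₂ (through _ _ m))))
      (tight true x z (proj₁ (through x y xy∈)) eq)))
    ... | false = sym (∉⟦⟧⁺ resp λ w → x≁y (walk-trans w (walk-map
      (λ (adj , i , j) → adj , (λ m → true≢false (proj₁ (through _ _ m)) i) , (λ m → true≢false (proj₁ (through _ _ m)) j))
      (tight false z y eq (proj₂ (through x y xy∈))))))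
  bonds-finite zero F {x} {y} xy∈ | yes w = [] , none
    where
    none : CoveredByCuts [] (BondThrough zero F)
    none e (_ , through , [] , _ , cov) with exit e w (proj₁ (through x y xy∈)) (proj₂ (through x y xy∈))
    ... | p , q , (adj , pq∉ , _) , i , o with Any.++⁻ F (cov (p , q) (adj , i , o))
    ...   | inj₁ m = contradiction m pq∉
  bonds-finite (suc n) F {x} {y} xy∈ | yes w with along w
    where
    -- Every bond is accounted for at the first edge of the walk that leaves `e`; with that edge in
    -- `F`, the smaller allowance applies.
    along : ∀ {x′} → Walk (Outside F) x′ y →
            ∃[ Z ] CoveredByCuts Z (λ e → χ e x′ ≡ true × BondThrough (suc n) F e)
    along (done x′≈y) = [] , λ e (i , _ , through , _) →
      ⊥-elim (true≢false i (trans (χ-resp e x′≈y) (proj₂ (through x y xy∈))))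
    along (step {x′ = p} {q} x′≈p (adj , pq∉ , _) w)
      with bonds-finite n ((p , q) ∷ F) (here (≈-refl , ≈-refl)) | along w
    ... | Z , cov | Z′ , cov′ = Z ++ Z′ , cov″
      where
      cov″ : CoveredByCuts (Z ++ Z′) (λ e → χ e _ ≡ true × BondThrough (suc n) F e)
      cov″ e (i , bond) with χ e q in eq
      ... | true  = Any.++⁺ʳ Z (cov′ e (eq , bond))
      ... | false = Any.++⁺ˡ (cov e (cut-edge {F = F} {e = e} bond (adj , trans (sym (χ-resp e x′≈p)) i , eq) pq∉))
  ... | Z , cov = Z , λ e bond@(_ , through , _) → cov e (proj₁ (through x y xy∈) , bond)

  abstract
    thin-finite : ∀ x y → ∃[ Z ] CoveredByCuts Z (λ e → Thin e × χ e x ≡ true × χ e y ≡ false)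
    -- The pair `(x , y)` need not be an edge: its presence in `F` only records that `x` is inside
    -- and `y` outside, so all `k` boundary edges may go into `L`.
    thin-finite x y with bonds-finite k ((x , y) ∷ []) (here (≈-refl , ≈-refl))
    ... | Z , cov = Z , λ e (thin@(_ , L , len , covL) , i , o) → cov e
      ( thin⇒tight e thin
      , (λ { p q (here (a , b)) → trans (χ-resp e a) i , trans (χ-resp e b) o })
      , L , len , λ r r∂ → there (covL r r∂))

    thin-separating-finite : ∀ {x y} → Walk _∼_ x y → ∃[ Z ] CoveredByCuts Z (λ e → Thin e × χ e x ≢ χ e y)
    thin-separating-finite (done x≈y) = [] , λ e (_ , ne) → contradiction (χ-resp e x≈y) ne
    thin-separating-finite {x} {y} (step {x′ = p} {q} x≈p _ w)
      with thin-finite p q | thin-finite q p | thin-separating-finite w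
    ... | Z , cov | Z′ , cov′ | Z″ , cov″ = Z ++ Z′ ++ Z″ , covering
      where
      onward : ∀ e → χ e x ≢ χ e y → χ e p ≡ χ e q → χ e q ≢ χ e y
      onward e ne p≡q eq = ne (trans (χ-resp e x≈p) (trans p≡q eq))
      covering : CoveredByCuts (Z ++ Z′ ++ Z″) (λ e → Thin e × χ e x ≢ χ e y)
      covering e (thin , ne) with χ e p in eqp | χ e q in eqq
      ... | true  | false = Any.++⁺ˡ (cov e (thin , eqp , eqq))
      ... | false | true  = Any.++⁺ʳ Z (Any.++⁺ˡ (cov′ e (thin , eqq , eqp)))
      ... | true  | true  = Any.++⁺ʳ Z (Any.++⁺ʳ Z′ (cov″ e (thin , onward e ne (trans eqp (sym eqq)))))
      ... | false | false = Any.++⁺ʳ Z (Any.++⁺ʳ Z′ (cov″ e (thin , onward e ne (trans eqp (sym eqq)))))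

  -- `s` and `t` name which of the four corners is empty.
  Nested : Rel Subset _
  Nested e f = ∃[ s ] ∃[ t ] (∀ x → χ e x ≡ s → χ f x ≡ t → ⊥)

  nested-∁ˡ : ∀ e f → Nested e f → Nested (∁ e) f
  nested-∁ˡ e f (s , t , n) = not s , t , λ x p q → n x (not-injective p) q

  nested-≐ʳ : ∀ e f g → f ≐ g → Nested e f → Nested e g
  nested-≐ʳ e f g f≐g (s , t , n) = s , t , λ x p q → n x p (trans (f≐g x) q)

  infixr 6 _∪_
  _∪_ : Subset → Subset → Subset
  e ∪ f = record { χ = λ x → χ e x ∨ χ f x ; χ-resp = λ p → cong₂ _∨_ (χ-resp e p) (χ-resp f p) }

  module _ (e f : Subset) where
    ∩-false : ∀ x → χ (e ∩ f) x ≡ false → χ e x ≡ false ⊎ χ f x ≡ false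
    ∩-false x p with χ e x
    ... | true  = inj₂ p
    ... | false = inj₁ refl

    ∪-true : ∀ x → χ (e ∪ f) x ≡ true → χ e x ≡ true ⊎ χ f x ≡ true
    ∪-true x p with χ e x
    ... | true  = inj₁ refl
    ... | false = inj₂ p

    ∪-false : ∀ x → χ (e ∪ f) x ≡ false → χ e x ≡ false × χ f x ≡ false
    ∪-false x p with χ e x
    ... | false = refl , p

    ∪⁺ˡ : ∀ x → χ e x ≡ true → χ (e ∪ f) x ≡ true
    ∪⁺ˡ x p = cong (_∨ χ f x) p

    -- The delicate case is that `∁ e` misses one side of `g` and `∁ f` misses the other. Then `∁ e`
    -- and `∁ f` are disjoint, which `cross` excludes.
    nested-∩ : ∀ g → ¬ Nested e f → Nested e g → Nested f g → Nested (e ∩ f) g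
    nested-∩ g cross (true , t , n) _ = true , t , λ x p q → n x (proj₁ (∩⁻ e f p)) q
    nested-∩ g cross (false , _ , _) (true , t , n) = true , t , λ x p q → n x (proj₂ (∩⁻ e f p)) q
    nested-∩ g cross (false , s , n) (false , t , m) with s ≟ᵇ t
    ... | yes refl = false , s , λ x p q → case x p q
      where
      case : ∀ x → χ (e ∩ f) x ≡ false → χ g x ≡ s → ⊥
      case x p q with ∩-false x p
      ... | inj₁ a = n x a q
      ... | inj₂ b = m x b q
    ... | no s≢t = contradiction (false , false , disjoint) cross
      where
      disjoint : ∀ x → χ e x ≡ false → χ f x ≡ false → ⊥
      disjoint x p q with χ g x ≟ᵇ s
      ... | yes g≡s = n x p g≡s
      ... | no g≢s  = m x q (trans (¬-not g≢s) (sym (¬-not (λ t≡s → s≢t (sym t≡s)))))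

    -- Used contrapositively: a cut that crosses both corners crosses `e`, as the second count by
    -- `uncross-<` requires.
    nested-one : ∀ g → Nested e g → Nested (e ∩ f) g ⊎ Nested (e ∪ f) g
    nested-one g (true , t , n)  = inj₁ (true , t , λ x p q → n x (proj₁ (∩⁻ e f p)) q)
    nested-one g (false , t , n) = inj₂ (false , t , λ x p q → n x (proj₁ (∪-false x p)) q)

  ∁-∪ : ∀ e f → ∁ e ∩ ∁ f ≐ ∁ (e ∪ f)
  ∁-∪ e f x with χ e x
  ... | true  = refl
  ... | false = refl

  nested-∪ : ∀ e f g → ¬ Nested e f → Nested e g → Nested f g → Nested (e ∪ f) g
  nested-∪ e f g cross n n′ with nested-∩ (∁ e) (∁ f) g cross′ (nested-∁ˡ e g n) (nested-∁ˡ f g n′)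
    where
    cross′ : ¬ Nested (∁ e) (∁ f)
    cross′ (s , t , d) = cross (not s , not t , λ x p q →
      d x (trans (cong not p) (not-involutive s)) (trans (cong not q) (not-involutive t)))
  ... | s , t , d = not s , t , λ x p q →
    d x (trans (∁-∪ e f x) (trans (cong not p) (not-involutive s))) q

  Crosses : Subset → Pred Subset _
  Crosses e g = Thin g × ¬ Nested e g

  crosses-≐ : ∀ e {f g} → f ≐ g → Crosses e f → Crosses e g
  crosses-≐ e {f} {g} f≐g (thin , cross) =
    thin-≐ f g f≐g thin , λ n → cross (nested-≐ʳ e g f (≐-sym {f} {g} f≐g) n)

  inhabited : ∀ e → Infinite e → ∃[ x ] χ e x ≡ true
  inhabited e inf with dec (∃[ x ] χ e x ≡ true)
  ... | yes p = p
  ... | no ¬p = contradiction ([] , λ x i → contradiction (x , i) ¬p) inf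

  inhabited-side : ∀ e → Cut e → ∀ b → ∃[ x ] χ e x ≡ b
  inhabited-side e (inf , _) true  = inhabited e inf
  inhabited-side e (_ , inf) false with inhabited (∁ e) inf
  ... | x , p = x , not-injective p

  module _ (o : Vertex) where
    Splits : Subset → Vertex × Vertex → Set
    Splits g (p , q) = χ g o ≢ χ g p ⊎ χ g o ≢ χ g q

    splitting-finite : ∀ L → ∃[ Z ] CoveredByCuts Z (λ g → Thin g × Any (Splits g) L)
    splitting-finite [] = [] , λ g ()
    splitting-finite ((p , q) ∷ L)
      with thin-separating-finite (connected⇒walk conn o p)
         | thin-separating-finite (connected⇒walk conn o q) | splitting-finite L
    ... | Z , cov | Z′ , cov′ | Z″ , cov″ = Z ++ Z′ ++ Z″ , λ where
      g (thin , here (inj₁ ne)) → Any.++⁺ˡ (cov g (thin , ne))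
      g (thin , here (inj₂ ne)) → Any.++⁺ʳ Z (Any.++⁺ˡ (cov′ g (thin , ne)))
      g (thin , there any)      → Any.++⁺ʳ Z (Any.++⁺ʳ Z′ (cov″ g (thin , any)))

  -- A thin cut that does not split the ends of the boundary edges of e has a
  -- side, connected as all sides are, on which e is constant.
  crossing-finite : ∀ e → Thin e → ∃[ Z ] CoveredByCuts Z (Crosses e)
  crossing-finite e (cut , L , _ , covL) = Z , covering
    where
    o = proj₁ (inhabited e (proj₁ cut))
    Z = proj₁ (splitting-finite o L)

    covering : CoveredByCuts Z (Crosses e)
    covering g (thin , cross) with dec (Any (Splits o g) L)
    ... | yes any = proj₂ (splitting-finite o L) g (thin , any)
    ... | no none = contradiction (not (χ e w) , not (χ g o) , empty) cross
      where
      w = proj₁ (inhabited-side g (proj₁ thin) (not (χ g o)))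
      w-side = proj₂ (inhabited-side g (proj₁ thin) (not (χ g o)))

      split : ∀ {x p q} → x ≈ p → χ g x ≡ not (χ g o) → Splits o g (p , q)
      split a gx = inj₁ λ eq → not-¬ refl (sym (trans (sym gx) (trans (χ-resp g a) (sym eq))))

      constant : ∀ {x y} → WithinSide (not (χ g o)) g x y → χ e x ≡ χ e y
      constant {x} {y} (adj , gx , gy) with χ e x in ex | χ e y in ey
      ... | true  | true  = refl
      ... | false | false = refl
      ... | true  | false = contradiction (Any.map (λ (a , _) → split a gx) (covL (x , y) (adj , ex , ey))) none
      ... | false | true  = contradiction (Any.map (λ (a , _) → split a gy) (covL (y , x) (∼-sym adj , ey , ex))) none

      empty : ∀ x → χ e x ≡ not (χ e w) → χ g x ≡ not (χ g o) → ⊥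
      empty x ex gx = not-¬ refl (sym (trans (sym ex) (sym
        (walk-invariant (λ z → χ e w ≡ χ e z) (λ p eq → trans eq (χ-resp e p)) (λ r eq → trans eq (constant r))
          (thin⇒tight g thin (not (χ g o)) w x w-side gx) refl))))

-- Thin cuts crossed by fewest others

module OptimalCuts (em : ∀ {ℓ} → ExcludedMiddle ℓ) {c ℓ a} (D : Digraph c ℓ a) (conn : Connected D)
                   (lf : LocallyFinite D) (some-cut : ∃[ e ] Ends.FiniteCut em D lf e) where
  open Classical em
  open Graph D
  open Ends em D lf using (Cut)
  open Counting em _≈²_ ≈²-sym using (AtMost; uncross)
  open Counting em _≐_ (λ {e} {f} → ≐-sym {e} {f}) using ()
    renaming (AtMost to AtMostCuts; CoveredBy to CoveredByCuts; uncross-< to uncross-cuts-<; atMost-⊆ to atMostCuts-⊆)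
  open Cuts em D conn lf some-cut
  open NestedCuts em D conn lf some-cut

  private
    Crossed : ℕ → Set _
    Crossed n = ∃[ e ] Thin e × AtMostCuts n (Crosses e)

    minimum : ∃[ m ] Crossed m × (∀ n → Crossed n → m ≤ n)
    minimum with k-attained
    ... | e , thin with crossing-finite e thin
    ...   | Z , cov = least Crossed (length Z) (e , thin , Z , ≤-refl , cov)

  abstract
    m : ℕ
    m = proj₁ minimum

    m-attained : ∃[ e ] Thin e × AtMostCuts m (Crosses e)
    m-attained = proj₁ (proj₂ minimum)

    m-least : ∀ e {n} → Thin e → AtMostCuts n (Crosses e) → m ≤ n
    m-least e thin b = proj₂ (proj₂ minimum) _ (e , thin , b)

  Optimal : Pred Subset _
  Optimal e = Thin e × AtMostCuts m (Crosses e)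

  optimal-∁ : ∀ e → Optimal e → Optimal (∁ e)
  optimal-∁ e (thin , b) = thin-∁ e thin , atMostCuts-⊆ crosses b
    where
    crosses : ∀ g → Crosses (∁ e) g → Crosses e g
    crosses g (thin , cross) = thin , λ n → cross (nested-∁ˡ e g n)

  optimal-≐ : ∀ e f → e ≐ f → Optimal e → Optimal f
  optimal-≐ e f e≐f (thin , b) = thin-≐ e f e≐f thin , atMostCuts-⊆ crosses b
    where
    crosses : ∀ g → Crosses f g → Crosses e g
    crosses g (thin , cross) = thin , λ (s , t , n) → cross (s , t , λ x p q → n x (trans (e≐f x) p) q)

  private
    squeeze : ∀ {n a b} → n ≤ a → n ≤ b → a + b ≤ n + n → a ≤ n × b ≤ n
    squeeze {n} {a} {b} p q r = +-cancelʳ-≤ n a n (≤-trans (+-monoʳ-≤ a q) r) , +-cancelˡ-≤ n b n (≤-trans (+-monoˡ-≤ b p) r)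

  -- By submodularity both `e ∩ f` and `e ∪ f` are thin. A cut crossing one of them crosses `e` or
  -- `f`, and one crossing both crosses `e` and `f`; but `f` itself crosses `e` and neither corner.
  -- So together the corners are crossed by fewer than `m + m` cuts, against the choice of `m`.
  optimal-opposite-corners : ∀ e f → Optimal e → Optimal f → ¬ Nested e f →
                             Infinite (e ∩ f) → Infinite (∁ e ∩ ∁ f) → ⊥
  optimal-opposite-corners e f ((cutₑ , bₑ) , mₑ) ((cutᶠ , bᶠ) , mᶠ) cross infᵢ infₒ
    with uncross {P = Boundary e} {Boundary f} {Boundary (e ∩ f)} {Boundary (e ∪ f)}
           (boundary-resp (e ∩ f)) (boundary-resp (e ∪ f)) ∂∩ ∂∪ ∂both (boundary-resp e) (boundary-resp f) bₑ bᶠ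
    where
    ∂∩ : ∀ p → Boundary (e ∩ f) p → Boundary e p ⊎ Boundary f p
    ∂∩ (x , y) (adj , i , o) with ∩⁻ e f i | ∩-false e f y o
    ... | p , _ | inj₁ q = inj₁ (adj , p , q)
    ... | _ , p | inj₂ q = inj₂ (adj , p , q)
    ∂∪ : ∀ p → Boundary (e ∪ f) p → Boundary e p ⊎ Boundary f p
    ∂∪ (x , y) (adj , i , o) with ∪-true e f x i | ∪-false e f y o
    ... | inj₁ p | q , _ = inj₁ (adj , p , q)
    ... | inj₂ p | _ , q = inj₂ (adj , p , q)
    ∂both : ∀ p → Boundary (e ∩ f) p → Boundary (e ∪ f) p → Boundary e p × Boundary f p
    ∂both (x , y) (adj , i , _) (_ , _ , o) with ∩⁻ e f i | ∪-false e f y o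
    ... | p , q | r , s = (adj , p , r) , (adj , q , s)
  ... | _ , _ , b∩ , b∪ , le = outcome
    where
    cut∩ : Cut (e ∩ f)
    cut∩ = infᵢ , infinite-⊆ (∁ e) (∁ (e ∩ f)) (λ x p → cong (λ b → not (b ∧ χ f x)) (not-injective p)) (proj₂ cutₑ)

    cut∪ : Cut (e ∪ f)
    cut∪ = infinite-⊆ e (e ∪ f) (∪⁺ˡ e f) (proj₁ cutₑ) ,
      infinite-⊆ (∁ e ∩ ∁ f) (∁ (e ∪ f))
        (λ x p → let (q , r) = ∩⁻ (∁ e) (∁ f) p in cong not (cong₂ _∨_ (not-injective q) (not-injective r))) infₒ

    sizes = squeeze (k-least (e ∩ f) cut∩ b∩) (k-least (e ∪ f) cut∪ b∪) le

    thin∩ : Thin (e ∩ f)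
    thin∩ = cut∩ , proj₁ b∩ , ≤-trans (proj₁ (proj₂ b∩)) (proj₁ sizes) , proj₂ (proj₂ b∩)

    thin∪ : Thin (e ∪ f)
    thin∪ = cut∪ , proj₁ b∪ , ≤-trans (proj₁ (proj₂ b∪)) (proj₂ sizes) , proj₂ (proj₂ b∪)

    either : (c : Subset) → (∀ g → Nested e g → Nested f g → Nested c g) →
             ∀ g → Crosses c g → Crosses e g ⊎ Crosses f g
    either c nested g (thin , cross) with dec (Nested e g) | dec (Nested f g)
    ... | no ¬n | _     = inj₁ (thin , ¬n)
    ... | yes _ | no ¬n = inj₂ (thin , ¬n)
    ... | yes n | yes n′ = contradiction (nested g n n′) cross

    both : ∀ g → Crosses (e ∩ f) g → Crosses (e ∪ f) g → Crosses e g × Crosses f g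
    both g (thin , cross) (_ , cross′) = (thin , crossₑ) , (thin , crossᶠ)
      where
      crossₑ : ¬ Nested e g
      crossₑ n with nested-one e f g n
      ... | inj₁ n′ = cross n′
      ... | inj₂ n′ = cross′ n′
      crossᶠ : ¬ Nested f g
      crossᶠ (true , t , n)  = cross (true , t , λ x p q → n x (proj₂ (∩⁻ e f p)) q)
      crossᶠ (false , t , n) = cross′ (false , t , λ x p q → n x (proj₂ (∪-false e f x p)) q)

    outcome : ⊥
    outcome with uncross-cuts-< {P = Crosses e} {Crosses f} {Crosses (e ∩ f)} {Crosses (e ∪ f)}
                   (λ {g} {h} → crosses-≐ (e ∩ f) {g} {h}) (λ {g} {h} → crosses-≐ (e ∪ f) {g} {h})
                   (either (e ∩ f) (λ g → nested-∩ e f g cross)) (either (e ∪ f) (λ g → nested-∪ e f g cross)) both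
                   (λ {g} {h} → crosses-≐ e {g} {h}) (λ {g} {h} → crosses-≐ f {g} {h}) mₑ mᶠ
                   f ((cutᶠ , bᶠ) , cross)
                   (λ (_ , n) → n (true , false , λ x p q → true≢false (proj₂ (∩⁻ e f p)) q))
                   (λ (_ , n) → n (false , true , λ x p q → true≢false q (proj₂ (∪-false e f x p))))
    ... | _ , _ , c∩ , c∪ , lt =
      <-irrefl refl (≤-trans lt (+-mono-≤ (m-least (e ∩ f) thin∩ c∩) (m-least (e ∪ f) thin∪ c∪)))

  private
    ∩-comm-infinite : ∀ e f → Infinite (e ∩ f) → Infinite (f ∩ e)
    ∩-comm-infinite e f = infinite-⊆ (e ∩ f) (f ∩ e) (λ x p → let (q , r) = ∩⁻ e f p in ∩⁺ f e r q)

  optimal-nested : ∀ e f → Optimal e → Optimal f → Nested e f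
  optimal-nested e f optₑ optᶠ = by-contradiction λ cross → refute cross
    where
    module _ (cross : ¬ Nested e f) where
      cross′ : ¬ Nested e (∁ f)
      cross′ (s , t , n) = cross (s , not t , λ x p q → n x p (trans (cong not q) (not-involutive t)))

      diagonal : Infinite (e ∩ f) → Infinite (∁ e ∩ ∁ f) → ⊥
      diagonal = optimal-opposite-corners e f optₑ optᶠ cross

      antidiagonal : Infinite (e ∩ ∁ f) → Infinite (∁ e ∩ f) → ⊥
      antidiagonal i o = optimal-opposite-corners e (∁ f) optₑ (optimal-∁ f optᶠ) cross′ i
        (infinite-⊆ (∁ e ∩ f) (∁ e ∩ ∁ (∁ f))
          (λ x p → let (q , r) = ∩⁻ (∁ e) f p in ∩⁺ (∁ e) (∁ (∁ f)) q (trans (not-involutive (χ f x)) r)) o)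

      -- Each of e, ∁ e, f, ∁ f is infinite, so two opposite corners are.
      refute : ⊥
      refute with infinite-split e f (proj₁ (proj₁ (proj₁ optₑ))) | infinite-split (∁ e) f (proj₂ (proj₁ (proj₁ optₑ)))
                | infinite-split f e (proj₁ (proj₁ (proj₁ optᶠ))) | infinite-split (∁ f) e (proj₂ (proj₁ (proj₁ optᶠ)))
      ... | inj₁ p | inj₂ q | _      | _      = diagonal p q
      ... | inj₂ p | inj₁ q | _      | _      = antidiagonal p q
      ... | inj₁ p | inj₁ q | _      | inj₂ r = diagonal p (∩-comm-infinite (∁ f) (∁ e) r)
      ... | inj₁ p | inj₁ q | _      | inj₁ r = antidiagonal (∩-comm-infinite (∁ f) e r) q
      ... | inj₂ p | inj₂ q | inj₁ r | _      = diagonal (∩-comm-infinite f e r) q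
      ... | inj₂ p | inj₂ q | inj₂ r | _      = antidiagonal p (∩-comm-infinite f (∁ e) r)

  -- Pulling back is mere composition; images are preimages under `≅-sym α`.
  preimage : D ≅ D → Subset → Subset
  preimage α e = record { χ = λ x → χ e (Iso.to α x) ; χ-resp = λ p → χ-resp e (Iso.to-cong α p) }

  module _ (α : D ≅ D) where
    open Iso α

    infinite-preimage : ∀ e → Infinite e → Infinite (preimage α e)
    infinite-preimage e inf (xs , cov) = inf (map to xs , λ x i →
      Any.map⁺ (Any.map (λ p → ≈-trans (≈-sym (to-from x)) (to-cong p))
        (cov (from x) (trans (χ-resp e (to-from x)) i))))

    thin-preimage : ∀ e → Thin e → Thin (preimage α e)
    thin-preimage e ((inf , inf′) , L , len , cov) =
      (infinite-preimage e inf , infinite-preimage (∁ e) inf′) ,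
      map back L , subst (_≤ k) (sym (length-map back L)) len ,
      λ { (x , y) (adj , i , o) → Any.map⁺ (Any.map
            (λ (p , q) → ≈-trans (≈-sym (from-to x)) (from-cong p) , ≈-trans (≈-sym (from-to y)) (from-cong q))
            (cov (to x , to y) (adj⁺ adj , i , o))) }
      where
      back : Vertex × Vertex → Vertex × Vertex
      back (x , y) = from x , from y

  optimal-preimage : ∀ α e → Optimal e → Optimal (preimage α e)
  optimal-preimage α e (thin , L , len , cov) = thin-preimage α e thin ,
    map (preimage α) L , subst (_≤ m) (sym (length-map (preimage α) L)) len ,
    λ g crosses → Any.map⁺ (Any.map (λ p x → trans (χ-resp g (≈-sym (from-to x))) (p (to x)))
      (cov (preimage (≅-sym α) g) (transport g crosses)))
    where
    open Iso α
    transport : ∀ g → Crosses (preimage α e) g → Crosses e (preimage (≅-sym α) g)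
    transport g (thin , cross) = thin-preimage (≅-sym α) g thin , λ (s , t , n) → cross
      (s , t , λ x p q → n (to x) p (trans (χ-resp g (from-to x)) q))

-- Automorphisms obtained from homogeneity

module Homogeneity {c ℓ a} (D : Digraph c ℓ a) (ch : ConnectedHomogeneous D) where
  open Graph D

  -- A partial map is a list of pairs. Pairwise `Same` entries make it well defined, injective and
  -- an isomorphism of induced subdigraphs.
  record Same (p q : Vertex × Vertex) : Set (ℓ ⊔ˡ a) where
    constructor same
    field
      ≈⁺ : proj₁ p ≈ proj₁ q → proj₂ p ≈ proj₂ q
      ≈⁻ : proj₂ p ≈ proj₂ q → proj₁ p ≈ proj₁ q
      ⟶⁺ : proj₁ p ⟶ proj₁ q → proj₂ p ⟶ proj₂ q
      ⟶⁻ : proj₂ p ⟶ proj₂ q → proj₁ p ⟶ proj₁ q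
      ⟵⁺ : proj₁ q ⟶ proj₁ p → proj₂ q ⟶ proj₂ p
      ⟵⁻ : proj₂ q ⟶ proj₂ p → proj₁ q ⟶ proj₁ p

    ∼⁺ : proj₁ p ∼ proj₁ q → proj₂ p ∼ proj₂ q
    ∼⁺ (fwd e) = fwd (⟶⁺ e)
    ∼⁺ (bwd e) = bwd (⟵⁺ e)

  open Same

  same-sym : ∀ {p q} → Same p q → Same q p
  same-sym s = same (λ e → ≈-sym (≈⁺ s (≈-sym e))) (λ e → ≈-sym (≈⁻ s (≈-sym e))) (⟵⁺ s) (⟵⁻ s) (⟶⁺ s) (⟶⁻ s)

  same-refl : ∀ p → Same p p
  same-refl p = same (λ _ → ≈-refl) (λ _ → ≈-refl)
    (λ e → ⊥-elim (⟶-irrefl ≈-refl e)) (λ e → ⊥-elim (⟶-irrefl ≈-refl e))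
    (λ e → ⊥-elim (⟶-irrefl ≈-refl e)) (λ e → ⊥-elim (⟶-irrefl ≈-refl e))

  same-arc : ∀ {x x′ y y′} → x ⟶ y → x′ ⟶ y′ → Same (x , x′) (y , y′)
  same-arc p q = same (λ e → ⊥-elim (⟶-irrefl e p)) (λ e → ⊥-elim (⟶-irrefl e q)) (λ _ → q) (λ _ → p)
    (λ p′ → ⊥-elim (⟶-asym p p′)) (λ q′ → ⊥-elim (⟶-asym q q′))

  same-diagonal : ∀ {x y} → Same (x , x) (y , y)
  same-diagonal = same id id id id id id

  same-apart : ∀ {x x′ y y′} → ¬ x ≈ y → ¬ x ∼ y → ¬ x′ ≈ y′ → ¬ x′ ∼ y′ → Same (x , x′) (y , y′)
  same-apart p q p′ q′ = same (λ e → ⊥-elim (p e)) (λ e → ⊥-elim (p′ e))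
    (λ e → ⊥-elim (q (fwd e))) (λ e → ⊥-elim (q′ (fwd e))) (λ e → ⊥-elim (q (bwd e))) (λ e → ⊥-elim (q′ (bwd e)))

  -- Only partial isomorphisms whose domain is a star are needed.
  module _ (h h′ : Vertex) (ps : List (Vertex × Vertex))
           (pairs : AllPairs Same ((h , h′) ∷ ps)) (star : All (λ q → proj₁ q ∼ h) ps) where
    private
      qs = (h , h′) ∷ ps

      lookup-pairs : ∀ {qs} → AllPairs Same qs → ∀ {p q} → p ∈≡ qs → q ∈≡ qs → Same p q
      lookup-pairs (_ ∷ _)  (here refl) (here refl) = same-refl _
      lookup-pairs (s ∷ _)  (here refl) (there j)   = All.lookup s j
      lookup-pairs (s ∷ _)  (there i)   (here refl) = same-sym (All.lookup s i)
      lookup-pairs (_ ∷ ss) (there i)   (there j)   = lookup-pairs ss i j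

      A = induced D (_∈ map proj₁ qs)
      B = induced D (_∈ map proj₂ qs)

      entry₁ : ∀ {x} → x ∈ map proj₁ qs → ∃[ q ] q ∈≡ qs × x ≈ proj₁ q
      entry₁ i = find (Any.map⁻ i)

      entry₂ : ∀ {x} → x ∈ map proj₂ qs → ∃[ q ] q ∈≡ qs × x ≈ proj₂ q
      entry₂ i = find (Any.map⁻ i)

      image : Digraph.Vertex A → Digraph.Vertex B
      image (x , i) = let (q , j , _) = entry₁ i in proj₂ q , Any.map⁺ (lose j ≈-refl)

      coimage : Digraph.Vertex B → Digraph.Vertex A
      coimage (x , i) = let (q , j , _) = entry₂ i in proj₁ q , Any.map⁺ (lose j ≈-refl)

      φ : A ≅ B
      φ = record
        { bijection = record
          { to = image ; from = coimage
          ; to-cong = λ {x} {y} → to-cong x y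
          ; from-cong = λ {x} {y} → from-cong x y
          ; inverse = (λ {x} {y} → inverseˡ x y) , (λ {x} {y} → inverseʳ x y) }
        ; arcs = arcs }
        where
        to-cong : ∀ x y → proj₁ x ≈ proj₁ y → proj₁ (image x) ≈ proj₁ (image y)
        to-cong (x , i) (y , j) e = let (_ , k , d) = entry₁ i ; (_ , l , f) = entry₁ j in
          ≈⁺ (lookup-pairs pairs k l) (≈-trans (≈-sym d) (≈-trans e f))
        from-cong : ∀ x y → proj₁ x ≈ proj₁ y → proj₁ (coimage x) ≈ proj₁ (coimage y)
        from-cong (x , i) (y , j) e = let (_ , k , d) = entry₂ i ; (_ , l , f) = entry₂ j in
          ≈⁻ (lookup-pairs pairs k l) (≈-trans (≈-sym d) (≈-trans e f))
        inverseˡ : ∀ x y → proj₁ y ≈ proj₁ (coimage x) → proj₁ (image y) ≈ proj₁ x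
        inverseˡ (x , i) (y , j) e = let (_ , k , d) = entry₂ i ; (_ , l , f) = entry₁ j in
          ≈-trans (≈⁺ (lookup-pairs pairs l k) (≈-trans (≈-sym f) e)) (≈-sym d)
        inverseʳ : ∀ x y → proj₁ y ≈ proj₁ (image x) → proj₁ (coimage y) ≈ proj₁ x
        inverseʳ (x , i) (y , j) e = let (_ , k , d) = entry₁ i ; (_ , l , f) = entry₂ j in
          ≈-trans (≈⁻ (lookup-pairs pairs l k) (≈-trans (≈-sym f) e)) (≈-sym d)
        arcs : ∀ x y → (proj₁ x ⟶ proj₁ y) ⇔ (proj₁ (image x) ⟶ proj₁ (image y))
        arcs (x , i) (y , j) = let (_ , k , d) = entry₁ i ; (_ , l , f) = entry₁ j in mk⇔
          (λ r → ⟶⁺ (lookup-pairs pairs k l) (⟶-respˡ d (⟶-respʳ f r)))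
          (λ r → ⟶-respˡ (≈-sym d) (⟶-respʳ (≈-sym f) (⟶⁻ (lookup-pairs pairs k l) r)))

      star-connected : ∀ zs {z} (z∈ : z ∈ zs) → (∀ {x} → x ∈ zs → x ≈ z ⊎ x ∼ z) → Connected (induced D (_∈ zs))
      star-connected zs {z} z∈ near x y = inward (proj₂ x) (near (proj₂ x)) ◅◅ outward (proj₂ y) (near (proj₂ y))
        where
        module Z = Digraph (induced D (_∈ zs))
        _⇝_ : Rel Z.Vertex _
        _⇝_ = EqClosure (Z._≈_ ∪ʳ Z._⟶_)
        outward : ∀ {x} (i : x ∈ zs) → x ≈ z ⊎ x ∼ z → (z , z∈) ⇝ (x , i)
        outward i (inj₁ e)       = bwd (inj₁ e) ◅ ε
        outward i (inj₂ (fwd e)) = bwd (inj₂ e) ◅ ε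
        outward i (inj₂ (bwd e)) = fwd (inj₂ e) ◅ ε
        inward : ∀ {x} (i : x ∈ zs) → x ≈ z ⊎ x ∼ z → (x , i) ⇝ (z , z∈)
        inward i (inj₁ e)       = fwd (inj₁ e) ◅ ε
        inward i (inj₂ (fwd e)) = fwd (inj₂ e) ◅ ε
        inward i (inj₂ (bwd e)) = bwd (inj₂ e) ◅ ε

      near₁ : ∀ {x} → x ∈ map proj₁ qs → x ≈ h ⊎ x ∼ h
      near₁ i with entry₁ i
      ... | _ , here refl , e = inj₁ e
      ... | _ , there j , e   = inj₂ (∼-respˡ (≈-sym e) (All.lookup star j))

      near₂ : ∀ {x} → x ∈ map proj₂ qs → x ≈ h′ ⊎ x ∼ h′
      near₂ i with entry₂ i
      ... | _ , here refl , e = inj₁ e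
      ... | _ , there j , e   = inj₂ (∼-respˡ (≈-sym e)
        (∼⁺ (lookup-pairs pairs (there j) (here refl)) (All.lookup star j)))

    abstract
      extend : ∃[ α ] All (λ q → Iso.to {D = D} {E = D} α (proj₁ q) ≈ proj₂ q) qs
      extend with ch (map proj₁ qs) (map proj₂ qs)
                     (star-connected _ (here ≈-refl) near₁) (star-connected _ (here ≈-refl) near₂) φ
      -- The lookup inside `φ` may return another pair whose first entry equals that of `q`; `≈⁺`
      -- identifies the second entries.
      ... | α , agree = α , All.tabulate λ {q} j →
        let i = Any.map⁺ (lose {P = λ r → proj₁ q ≈ proj₁ r} j ≈-refl) ; (_ , k , e) = entry₁ i in
        ≈-trans (agree (proj₁ q , i)) (≈-sym (≈⁺ (lookup-pairs pairs j k) e))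

  same-neighbour : ∀ s {v v′ x x′} → Neighbour s v x → Neighbour s v′ x′ → Same (v , v′) (x , x′)
  same-neighbour true  p q = same-arc p q
  same-neighbour false p q = same-sym (same-arc p q)

  neighbour-transitive : ∀ s {v v′ x x′} → Neighbour s v x → Neighbour s v′ x′ →
                         ∃[ α ] Iso.to {D = D} {E = D} α v ≈ v′ × Iso.to α x ≈ x′
  neighbour-transitive s {v} {v′} {x} {x′} p q
    with extend v v′ ((x , x′) ∷ []) ((same-neighbour s p q ∷ []) ∷ [] ∷ []) (∼-sym (neighbour⇒∼ s p) ∷ [])
  ... | α , e ∷ f ∷ [] = α , e , f

  cherry-transitive : ∀ s t {v v′ x x′ y y′} → Neighbour s v x → Neighbour s v′ x′ → Neighbour t v y → Neighbour t v′ y′ →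
                      ¬ x ≈ y → ¬ x ∼ y → ¬ x′ ≈ y′ → ¬ x′ ∼ y′ →
                      ∃[ α ] Iso.to {D = D} {E = D} α v ≈ v′ × Iso.to α x ≈ x′ × Iso.to α y ≈ y′
  cherry-transitive s t {v} {v′} {x} {x′} {y} {y′} p p′ q q′ ne na ne′ na′
    with extend v v′ ((x , x′) ∷ (y , y′) ∷ [])
           ((same-neighbour s p p′ ∷ same-neighbour t q q′ ∷ []) ∷ (same-apart ne na ne′ na′ ∷ []) ∷ [] ∷ [])
           (∼-sym (neighbour⇒∼ s p) ∷ ∼-sym (neighbour⇒∼ t q) ∷ [])
  ... | α , e ∷ f ∷ g ∷ [] = α , e , f , g

-- The sides of a vertex

module Sides (em : ∀ {ℓ} → ExcludedMiddle ℓ) {c ℓ a} (D : Digraph c ℓ a) (conn : Connected D)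
             (lf : LocallyFinite D) (some-cut : ∃[ e ] Ends.FiniteCut em D lf e)
             (ch : ConnectedHomogeneous D) (triangle : EmbedsTriangle D) where
  open Classical em
  open Graph D
  open Ends em D lf using (neighbours; ∈-neighbours)
  open Cuts em D conn lf some-cut using (true≢false; exit; thin⇒tight)
  open NestedCuts em D conn lf some-cut using (inhabited-side; thin-finite)
  open OptimalCuts em D conn lf some-cut
  open Counting em _≐_ (λ {e} {f} → ≐-sym {e} {f}) using (AtMost; uncross)
  open Homogeneity D ch
  open Iso using (to; from; from-cong; to-from; from-to)

  Separates : Vertex → Vertex → Pred Subset _
  Separates x y e = Optimal e × χ e x ≡ true × χ e y ≡ false

  separates-∁ : ∀ {x y} e → Separates x y e → Separates y x (∁ e)
  separates-∁ e (opt , i , o) = optimal-∁ e opt , cong not o , cong not i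

  separates-preimage : ∀ (α : D ≅ D) {x y x′ y′} e → to α x ≈ x′ → to α y ≈ y′ →
                       Separates x′ y′ e → Separates x y (preimage α e)
  separates-preimage α e p q (opt , i , o) =
    optimal-preimage α e opt , trans (χ-resp e p) i , trans (χ-resp e q) o

  -- Up to complementing the cuts, all edges look alike.
  edge-transitive : ∀ {x y p q} → x ∼ y → p ∼ q →
    (∃[ α ] to {D = D} {D} α x ≈ p × to α y ≈ q) ⊎ (∃[ α ] to {D = D} {D} α x ≈ q × to α y ≈ p)
  edge-transitive (fwd e) (fwd f) = inj₁ (neighbour-transitive true e f)
  edge-transitive (bwd e) (bwd f) = inj₁ (neighbour-transitive false e f)
  edge-transitive (fwd e) (bwd f) = inj₂ (neighbour-transitive true e f)
  edge-transitive (bwd e) (fwd f) = inj₂ (neighbour-transitive false e f)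

  abstract
    edge-separated : ∀ {x y} → x ∼ y → ∃[ e ] Separates x y e
    edge-separated {x} {y} x∼y with m-attained
    ... | e , opt@(thin@(cut , _) , _) with inhabited-side e cut true | inhabited-side e cut false
    ...   | p , p∈ | q , q∉ with exit e (connected⇒walk conn p q) p∈ q∉
    ...     | p′ , q′ , adj , i , o with edge-transitive x∼y adj
    ...       | inj₁ (α , f , g) = preimage α e , separates-preimage α e f g (opt , i , o)
    ...       | inj₂ (α , f , g) = preimage α (∁ e) , separates-preimage α (∁ e) f g (separates-∁ e (opt , i , o))

    separating-finite : ∀ x y → ∃[ n ] AtMost n (Separates x y)
    separating-finite x y with thin-finite x y
    ... | Z , cov = length Z , Z , ≤-refl , λ e ((thin , _) , i , o) → cov e (thin , i , o)

  separates-≐ : ∀ x y {e f} → e ≐ f → Separates x y e → Separates x y f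
  separates-≐ x y {e} {f} e≐f (opt , i , o) =
    optimal-≐ e f e≐f opt , trans (sym (e≐f x)) i , trans (sym (e≐f y)) o

  -- A covering list is carried along by an automorphism, and its cuts are complemented if the edge
  -- is reversed. So every bound for one edge holds for all.
  atMost-separates : ∀ {x y p q n} → x ∼ y → p ∼ q → AtMost n (Separates x y) → AtMost n (Separates p q)
  atMost-separates {x} {y} {p} {q} x∼y p∼q (Z , len , cov) with edge-transitive x∼y p∼q
  ... | inj₁ (α , f , g) = map (preimage (≅-sym α)) Z , subst (_≤ _) (sym (length-map _ Z)) len ,
    λ e sep → Any.map⁺ (Any.map (λ {e′} eq v → trans (χ-resp e (≈-sym (to-from α v))) (eq (from α v)))
      (cov (preimage α e) (separates-preimage α e f g sep)))
  ... | inj₂ (α , f , g) = map (λ e → ∁ (preimage (≅-sym α) e)) Z , subst (_≤ _) (sym (length-map _ Z)) len ,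
    λ e sep → Any.map⁺ (Any.map
      (λ {e′} eq v → trans (χ-resp e (≈-sym (to-from α v))) (trans (sym (not-involutive _)) (cong not (eq (from α v)))))
      (cov (preimage α (∁ e)) (separates-preimage α (∁ e) f g (separates-∁ e sep))))

  Side : Vertex → Rel Vertex _
  Side v x y = ∃[ e ] Optimal e × χ e v ≡ false × χ e x ≡ true × χ e y ≡ true

  side-sym : ∀ {v x y} → Side v x y → Side v y x
  side-sym (e , opt , o , i , j) = e , opt , o , j , i

  side-refl : ∀ {v x} → v ∼ x → Side v x x
  side-refl v∼x with edge-separated (∼-sym v∼x)
  ... | e , opt , i , o = e , opt , o , i , i

  side-resp : ∀ {v v′ x x′ y y′} → v ≈ v′ → x ≈ x′ → y ≈ y′ → Side v x y → Side v′ x′ y′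
  side-resp p q r (e , opt , o , i , j) =
    e , opt , trans (sym (χ-resp e p)) o , trans (sym (χ-resp e q)) i , trans (sym (χ-resp e r)) j

  side-image : ∀ (α : D ≅ D) {v v′ x x′ y y′} → to α v ≈ v′ → to α x ≈ x′ → to α y ≈ y′ → Side v x y → Side v′ x′ y′
  side-image α p q r (e , opt , o , i , j) =
    preimage (≅-sym α) e , optimal-preimage (≅-sym α) e opt , move p o , move q i , move r j
    where
    move : ∀ {z z′ b} → to α z ≈ z′ → χ e z ≡ b → χ e (from α z′) ≡ b
    move {z} s eq = trans (χ-resp e (≈-trans (from-cong α (≈-sym s)) (from-to α z))) eq

  private
    -- The corner containing `y` and the one containing `v` are not empty, and emptiness of either
    -- remaining corner is an inclusion.
    larger : ∀ {v y} e f → Optimal e → Optimal f → χ e v ≡ false → χ f v ≡ false → χ e y ≡ true → χ f y ≡ true →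
             (∀ z → χ e z ≡ true → χ f z ≡ true) ⊎ (∀ z → χ f z ≡ true → χ e z ≡ true)
    larger {v} {y} e f opt opt′ p q r s with optimal-nested e f opt opt′
    ... | true  , true  , n = contradiction s (n y r)
    ... | false , false , n = contradiction q (n v p)
    ... | true  , false , n = inj₁ λ z i → ¬-not (λ o → n z i o)
    ... | false , true  , n = inj₂ λ z i → ¬-not (λ o → n z o i)

  side-trans : ∀ {v x y z} → Side v x y → Side v y z → Side v x z
  side-trans (e , opt , o , i , j) (f , opt′ , o′ , i′ , j′) with larger e f opt opt′ o o′ j i′
  ... | inj₁ e⊆f = f , opt′ , o′ , e⊆f _ i , j′
  ... | inj₂ f⊆e = e , opt , o , i , f⊆e _ j′

  -- Otherwise every cut separating x from v, and every cut separating v from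
  -- y, separates x from y, although all edges lie in equally many cuts.
  adjacent⇒side : ∀ {v x y} → v ∼ x → v ∼ y → x ∼ y → Side v x y
  adjacent⇒side {v} {x} {y} v∼x v∼y x∼y = by-contradiction λ ¬side →
    let (n , am) = separating-finite x y
        (d , am-d , d-least) = least (λ n → AtMost n (Separates x y)) n am
        (n₁ , n₂ , am₁ , am₂ , le) = uncross {P = Separates x y} {λ _ → ⊥} {Separates x v} {Separates v y}
          (λ {e} {f} → separates-≐ x v {e} {f}) (λ {e} {f} → separates-≐ v y {e} {f})
          (λ e (opt , i , o) → inj₁ (opt , i , ¬-not λ i′ → ¬side (e , opt , o , i , i′)))
          (λ e (opt , i , o) → inj₁
            (opt , ¬-not (λ o′ → ¬side (∁ e , optimal-∁ e opt , cong not i , cong not o′ , cong not o)) , o))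
          (λ e (_ , _ , o) (_ , i , _) → ⊥-elim (true≢false i o))
          (λ {e} {f} → separates-≐ x y {e} {f}) (λ _ ()) am-d ([] , z≤n , λ _ ())
        d≤n₁ = d-least n₁ (atMost-separates (∼-sym v∼x) x∼y am₁)
        d≤n₂ = d-least n₂ (atMost-separates v∼y x∼y am₂)
        d>0 = positive am-d
    in <-irrefl refl (≤-trans (≤-trans (+-monoˡ-≤ d d>0) (≤-trans (+-mono-≤ d≤n₁ d≤n₂) le)) (≤-reflexive (+-identityʳ d)))
    where
    positive : ∀ {d} → AtMost d (Separates x y) → 0 < d
    positive {zero} ([] , _ , cov) with cov (proj₁ (edge-separated x∼y)) (proj₂ (edge-separated x∼y))
    ... | ()
    positive {suc d} _ = s≤s z≤n

  -- Cuts that contain `x` but not `v` form a chain, so finitely many can be replaced by the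
  -- largest, which then contains every neighbour of `v`. Its outside is connected and therefore
  -- consists of `v` alone, but it has to be infinite.
  not-one-side : ∀ {v x} → v ∼ x → (∀ y → v ∼ y → Side v x y) → ⊥
  not-one-side {v} {x} v∼x all with common (neighbours v)
    where
    common : ∀ ys → ∃[ e ] Optimal e × χ e v ≡ false × χ e x ≡ true × (∀ y → v ∼ y → y ∈ ys → χ e y ≡ true)
    common [] with edge-separated (∼-sym v∼x)
    ... | e , opt , i , o = e , opt , o , i , λ _ _ ()
    common (y ∷ ys) with common ys | dec (v ∼ y)
    ... | e , opt , o , i , cov | no v≁y = e , opt , o , i , λ
      { z v∼z (here z≈y) → contradiction (∼-respʳ z≈y v∼z) v≁y ; z v∼z (there m) → cov z v∼z m }
    ... | e , opt , o , i , cov | yes v∼y with all y v∼y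
    ...   | f , opt′ , o′ , i′ , j with larger e f opt opt′ o o′ i i′
    ...     | inj₁ e⊆f = f , opt′ , o′ , i′ , λ
      { z v∼z (here z≈y) → trans (χ-resp f z≈y) j ; z v∼z (there m) → e⊆f z (cov z v∼z m) }
    ...     | inj₂ f⊆e = e , opt , o , i , λ
      { z v∼z (here z≈y) → trans (χ-resp e z≈y) (f⊆e y j) ; z v∼z (there m) → cov z v∼z m }
  ... | e , opt@(thin@((_ , co-infinite) , _) , _) , o , _ , cov =
    co-infinite (v ∷ [] , λ y y∉ → here (only y (not-injective y∉)))
    where
    only : ∀ y → χ e y ≡ false → y ≈ v
    only y y∉ with thin⇒tight e thin false v y o y∉
    ... | done v≈y = ≈-sym v≈y
    ... | step {y = z} v≈x′ (adj , _ , z∉) _ =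
      let v∼z = ∼-respˡ (≈-sym v≈x′) adj in ⊥-elim (true≢false (cov z v∼z (∈-neighbours v∼z)) z∉)

  -- Whether cyclic or transitive, an oriented triangle has a corner with one arc in and one arc
  -- out.
  out-in-adjacent : ∃[ v ] ∃[ x ] ∃[ y ] Neighbour true v x × Neighbour false v y × x ∼ y
  out-in-adjacent = corner triangle
    where
    corner : EmbedsTriangle D → ∃[ v ] ∃[ x ] ∃[ y ] Neighbour true v x × Neighbour false v y × x ∼ y
    corner (x , y , z , fwd xy , fwd yz , zx) = y , z , x , yz , xy , zx
    corner (x , y , z , fwd xy , bwd zy , fwd zx) = x , y , z , xy , zx , bwd zy
    corner (x , y , z , fwd xy , bwd zy , bwd xz) = z , y , x , zy , xz , bwd xy
    corner (x , y , z , bwd yx , fwd yz , fwd zx) = z , x , y , zx , yz , bwd yx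
    corner (x , y , z , bwd yx , fwd yz , bwd xz) = x , z , y , xz , yx , bwd yz
    corner (x , y , z , bwd yx , bwd zy , zx) = y , x , z , yx , zy , ∼-sym zx

  opposite-neighbour : ∀ s {v x} → Neighbour s v x → ∃[ y ] Neighbour (not s) v y × Side v x y
  opposite-neighbour s {v} {x} p with out-in-adjacent
  opposite-neighbour true {v} {x} p | v₀ , x₀ , y₀ , vx , yv , x∼y with neighbour-transitive true vx p
  ... | α , e , f = to α y₀ , ⟶-respʳ e (Iso.arc⁺ α yv) ,
                    side-image α e f ≈-refl (adjacent⇒side (fwd vx) (bwd yv) x∼y)
  opposite-neighbour false {v} {x} p | v₀ , x₀ , y₀ , vx , yv , x∼y with neighbour-transitive false yv p
  ... | α , e , f = to α x₀ , ⟶-respˡ e (Iso.arc⁺ α vx) ,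
                    side-image α e f ≈-refl (adjacent⇒side (bwd yv) (fwd vx) (∼-sym x∼y))

  -- Suppose `x` and `y` share a side without being equal or adjacent. Homogeneity on such pairs
  -- puts every `s`-neighbour of `v` on the side of every `t`-neighbour (`full`), and each remaining
  -- neighbour shares a side with some `s`-neighbour. So all neighbours of `v` are on one side.
  side⇒adjacent : ∀ {v x y} → v ∼ x → v ∼ y → Side v x y → x ≈ y ⊎ x ∼ y
  side⇒adjacent {v} {x} {y} v∼x v∼y side with dec (x ≈ y) | dec (x ∼ y)
  ... | yes e | _     = inj₁ e
  ... | no _  | yes e = inj₂ e
  ... | no ne | no na = ⊥-elim (not-one-side v∼x (λ z v∼z → side-x z v∼z))
    where
    s = proj₁ (neighbour-side v∼x)
    vx = proj₂ (neighbour-side v∼x)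
    t = proj₁ (neighbour-side v∼y)
    vy = proj₂ (neighbour-side v∼y)

    full : ∀ x′ y′ → Neighbour s v x′ → Neighbour t v y′ → Side v x′ y′
    full x′ y′ p q with dec (x′ ≈ y′) | dec (x′ ∼ y′)
    ... | yes e | _     = side-resp ≈-refl ≈-refl e (side-refl (neighbour⇒∼ s p))
    ... | no _  | yes e = adjacent⇒side (neighbour⇒∼ s p) (neighbour⇒∼ t q) e
    ... | no ne′ | no na′ with cherry-transitive s t vx p vy q ne na ne′ na′
    ...   | α , e , f , g = side-image α e f g side

    into-s : ∀ z → v ∼ z → ∃[ w ] Neighbour s v w × Side v w z
    into-s z v∼z with neighbour-side v∼z
    ... | u , vz with u ≟ᵇ s
    ...   | yes refl = z , vz , side-refl v∼z
    ...   | no u≢s with opposite-neighbour u vz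
    ...     | w , vw , side′ = w , subst (λ b → Neighbour b v w) (sym (¬-not (λ s≡u → u≢s (sym s≡u)))) vw , side-sym side′

    side-x : ∀ z → v ∼ z → Side v x z
    side-x z v∼z with into-s z v∼z
    ... | w , vw , wz = side-trans side (side-trans (side-sym (full w y vw vy)) wz)

  abstract
    -- Apart from `out-in-adjacent`, all that the analysis of triangles takes from the cuts.
    adjacent-trans : ∀ {v x y z} → v ∼ x → v ∼ y → v ∼ z → x ∼ y → y ∼ z → x ≈ z ⊎ x ∼ z
    adjacent-trans vx vy vz xy yz = side⇒adjacent vx vz (side-trans (adjacent⇒side vx vy xy) (adjacent⇒side vy vz yz))

-- Transitive tournaments and directed triangles

module Triangles (em : ∀ {ℓ} → ExcludedMiddle ℓ) {c ℓ a} (D : Digraph c ℓ a) (conn : Connected D)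
                 (lf : LocallyFinite D) (some-cut : ∃[ e ] Ends.FiniteCut em D lf e)
                 (ch : ConnectedHomogeneous D) (triangle : EmbedsTriangle D) where
  open Classical em
  open Graph D
  open Homogeneity D ch
  open Sides em D conn lf some-cut ch triangle using (adjacent-trans; out-in-adjacent)
  open Iso using (to; arc⁺)

  Above : List Vertex → Pred Vertex _
  Above s z = All (_⟶ z) s

  -- Transitive tournaments, listed from the sink to the source.
  Chain : Pred (List Vertex) _
  Chain = AllPairs (λ x y → y ⟶ x)

  Matches : (α : D ≅ D) → List Vertex → List Vertex → Set _
  Matches α = Pointwise (λ x x′ → to α x ≈ x′)

  above-image : ∀ α {s s′ z} → Matches α s s′ → Above s z → Above s′ (to α z)
  above-image α []       []       = []
  above-image α (e ∷ es) (p ∷ ps) = ⟶-respˡ e (arc⁺ α p) ∷ above-image α es ps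

  below-all : ∀ {s s′ x x′} → Above s x → Above s′ x′ → All (Same (x , x′)) (zip s s′)
  below-all []       _        = []
  below-all (_ ∷ _)  []       = []
  below-all (p ∷ ps) (q ∷ qs) = same-sym (same-arc p q) ∷ below-all ps qs

  chain-same : ∀ {s s′} → Chain s → Chain s′ → AllPairs Same (zip s s′)
  chain-same []       _        = []
  chain-same (_ ∷ _)  []       = []
  chain-same (p ∷ ps) (q ∷ qs) = below-all p q ∷ chain-same ps qs

  zip-adjacent : ∀ {s s′ : List Vertex} {x} → Above s x → All (λ q → proj₁ q ∼ x) (zip s s′)
  zip-adjacent []                   = []
  zip-adjacent {s′ = []}    (_ ∷ _) = []
  zip-adjacent {s′ = _ ∷ _} (p ∷ ps) = fwd p ∷ zip-adjacent ps

  zip-matches : ∀ α s s′ → length s ≡ length s′ → All (λ q → to α (proj₁ q) ≈ proj₂ q) (zip s s′) → Matches α s s′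
  zip-matches α []      []       _  _        = []
  zip-matches α (_ ∷ s) (_ ∷ s′) eq (e ∷ es) = e ∷ zip-matches α s s′ (suc-injective eq) es

  -- Every vertex of a chain is adjacent to its sink, so the chain is a star about `x`.
  chain-transitive : ∀ {x s x′ s′} → Chain (x ∷ s) → Chain (x′ ∷ s′) → length s ≡ length s′ →
                     ∃[ α ] Matches α (x ∷ s) (x′ ∷ s′)
  chain-transitive {x} {s} {x′} {s′} c@(p ∷ _) c′ eq with extend x x′ (zip s s′) (chain-same c c′) (zip-adjacent p)
  ... | α , es = α , zip-matches α (x ∷ s) (x′ ∷ s′) (cong suc eq) es

  Maximal : Pred (List Vertex) _
  Maximal s = ¬ (∃[ z ] Above s z)

  -- The candidates `xs` for a new sink shrink at each extension: the chosen `z` has no arc to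
  -- itself, so it drops out.
  maximal-chain : ∀ n xs {s} → length xs ≤ n → (∀ z → Above s z → z ∈ xs) → Chain s →
                  ∃[ s′ ] Chain s′ × length s ≤ length s′ × Maximal s′
  maximal-chain n xs {s} le cov chain with dec (∃[ z ] Above s z)
  ... | no max = s , chain , ≤-refl , max
  maximal-chain zero [] le cov chain | yes (z , up) with cov z up
  ... | ()
  maximal-chain (suc n) xs {s} le cov chain | yes (z , up)
    with maximal-chain n (sift (λ y → ¬ z ≈ y) xs) {z ∷ s}
           (s≤s⁻¹ (≤-trans (sift-shorter (Any.map (λ e ne → ne e) (cov z up))) le))
           (λ { w (z⟶w ∷ up′) → sift⁺ (λ e ne → ⟶-irrefl (≈-trans ne (≈-sym e)) z⟶w) (cov w up′) })
           (up ∷ chain)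
  ... | s′ , chain′ , le′ , max = s′ , chain′ , <⇒≤ le′ , max

  -- Over a longest chain the vertices completing a ∷ v ∷ s at the top, or
  -- between v and a, are unique. Hence, for the chain t ∷ m ∷ s, there are just
  -- two common out-neighbours of s and m that are in-neighbours of n. Being
  -- joined by an arc they cannot be exchanged, contrary to homogeneity.
  module LongestChain {t m n : Vertex} {s : List Vertex}
                      (mt : m ⟶ t) (nt : n ⟶ t) (st : Above s t) (nm : n ⟶ m) (sm : Above s m)
                      (sn : Above s n) (cs : Chain s) (maximal : Maximal (t ∷ m ∷ n ∷ s)) where

    longest : Chain (t ∷ m ∷ n ∷ s)
    longest = (mt ∷ nt ∷ st) ∷ (nm ∷ sm) ∷ sn ∷ cs

    -- `maximal` forbids only to prolong this one chain. The tail `y ∷ u` is as long as `longest`,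
    -- however, so an automorphism carries it there, and the image of `z` prolongs it.
    too-long : ∀ {z y u} → Chain (z ∷ y ∷ u) → length u ≡ 2 + length s → ⊥
    too-long {z} {y} {u} ((up ∷ ups) ∷ chain) eq with chain-transitive chain longest eq
    ... | α , matches = maximal (to α z , above-image α matches (up ∷ ups))

    top-unique : ∀ {a v x x′} → Chain (a ∷ v ∷ s) → Above (a ∷ v ∷ s) x → Above (a ∷ v ∷ s) x′ → x ≈ x′
    top-unique c@((va ∷ _) ∷ _) p@(ax ∷ vx ∷ _) p′@(ax′ ∷ vx′ ∷ _)
      with adjacent-trans (fwd ax) (bwd va) (fwd ax′) (bwd vx) (fwd vx′)
    ... | inj₁ e = e
    ... | inj₂ (fwd q) = ⊥-elim (too-long ((q ∷ p′) ∷ p ∷ c) refl)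
    ... | inj₂ (bwd q) = ⊥-elim (too-long ((q ∷ p) ∷ p′ ∷ c) refl)

    middle-unique : ∀ {a v y y′} → Chain (a ∷ v ∷ s) → Above (v ∷ s) y → y ⟶ a → Above (v ∷ s) y′ → y′ ⟶ a → y ≈ y′
    middle-unique ((va ∷ pa) ∷ c) p@(vy ∷ _) ya p′@(vy′ ∷ _) y′a
      with adjacent-trans (bwd ya) (bwd va) (bwd y′a) (bwd vy) (fwd vy′)
    ... | inj₁ e = e
    ... | inj₂ (fwd q) = ⊥-elim (too-long ((y′a ∷ ya ∷ va ∷ pa) ∷ (q ∷ p′) ∷ p ∷ c) refl)
    ... | inj₂ (bwd q) = ⊥-elim (too-long ((ya ∷ y′a ∷ va ∷ pa) ∷ (q ∷ p) ∷ p′ ∷ c) refl)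

    -- `t` lies on top of `m ∷ n ∷ s`, and `m` lies in the middle of `t ∷ n ∷ s`; both chains can be
    -- carried to `a ∷ v ∷ s`. The arc between the two images goes from `x` to `y`, as the reverse
    -- would make a chain that is too long.
    completions : ∀ {a v} → Chain (a ∷ v ∷ s) →
                  ∃[ x ] ∃[ y ] Above (a ∷ v ∷ s) x × Above (v ∷ s) y × y ⟶ a × x ⟶ y
    completions {a} {v} c@((va ∷ pa) ∷ cᵥ) = x , y , x-top , y-mid , ya , xy x-top y-mid
      where
      upper = chain-transitive ((nm ∷ sm) ∷ sn ∷ cs) c refl
      lower = chain-transitive ((nt ∷ st) ∷ sn ∷ cs) c refl
      x = to (proj₁ upper) t
      y = to (proj₁ lower) m
      x-top : Above (a ∷ v ∷ s) x
      x-top = above-image (proj₁ upper) (proj₂ upper) (mt ∷ nt ∷ st)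
      y-mid : Above (v ∷ s) y
      y-mid = above-image (proj₁ lower) (Pointwise.tail (proj₂ lower)) (nm ∷ sm)
      ya : y ⟶ a
      ya = ⟶-respʳ (Pointwise.head (proj₂ lower)) (arc⁺ (proj₁ lower) mt)
      xy : Above (a ∷ v ∷ s) x → Above (v ∷ s) y → x ⟶ y
      xy (ax ∷ vx ∷ sx) (vy ∷ _) with adjacent-trans (fwd ax) (bwd va) (bwd ya) (bwd vx) (fwd vy)
      ... | inj₁ e       = ⊥-elim (⟶-asym ax (⟶-respˡ (≈-sym e) ya))
      ... | inj₂ (fwd q) = q
      ... | inj₂ (bwd q) = ⊥-elim (too-long ((ax ∷ q ∷ vx ∷ sx) ∷ (ya ∷ va ∷ pa) ∷ y-mid ∷ cᵥ) refl)

    diagonal : List Vertex → List (Vertex × Vertex)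
    diagonal = map (λ x → x , x)

    diagonal-same : ∀ x u → All (Same (x , x)) (diagonal u)
    diagonal-same x []      = []
    diagonal-same x (y ∷ u) = same-diagonal ∷ diagonal-same x u

    diagonal-pairs : ∀ u → AllPairs Same (diagonal u)
    diagonal-pairs []      = []
    diagonal-pairs (x ∷ u) = diagonal-same x u ∷ diagonal-pairs u

    diagonal-below : ∀ {u x x′} → Above u x → Above u x′ → All (Same (x , x′)) (diagonal u)
    diagonal-below []       []       = []
    diagonal-below (p ∷ ps) (q ∷ qs) = same-sym (same-arc p q) ∷ diagonal-below ps qs

    diagonal-adjacent : ∀ {u x} → Above u x → All (λ q → proj₁ q ∼ x) (diagonal u)
    diagonal-adjacent []       = []
    diagonal-adjacent (p ∷ ps) = fwd p ∷ diagonal-adjacent ps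

    diagonal-matches : ∀ α u → All (λ q → to α (proj₁ q) ≈ proj₂ q) (diagonal u) → Matches α u u
    diagonal-matches α []      []       = []
    diagonal-matches α (x ∷ u) (e ∷ es) = e ∷ diagonal-matches α u es

    private
      mns : Chain (m ∷ n ∷ s)
      mns = (nm ∷ sm) ∷ sn ∷ cs

      tms : Chain (t ∷ m ∷ s)
      tms = (mt ∷ st) ∷ sm ∷ cs

      -- `n` and `z` are adjacent, both being adjacent to `t` among the neighbours of `m`. With an
      -- arc from `n` to `z`, the adjacent vertices `t` and `z` would both lie on top of
      -- `m ∷ n ∷ s`.
      returns : ∀ {z} → m ⟶ z → t ∼ z → Above s z → z ⟶ n
      returns mz tz sz with adjacent-trans (bwd nm) (fwd mt) (fwd mz) (fwd nt) tz
      ... | inj₁ e       = ⊥-elim (⟶-asym nm (⟶-respʳ (≈-sym e) mz))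
      ... | inj₂ (bwd q) = q
      ... | inj₂ (fwd q) = ⊥-elim (∼⇒≉ tz (top-unique mns (mt ∷ nt ∷ st) (mz ∷ q ∷ sz)))

      module _ {c d} (top : Above (t ∷ m ∷ s) c) (mid : Above (m ∷ s) d) (dt : d ⟶ t) (cd : c ⟶ d) where

        -- `z` and `t` are adjacent: with an arc to `t`, `z` fills the middle of `t ∷ m ∷ s`; with
        -- an arc from `t`, it lies on top.
        classified : ∀ {z} → m ⟶ z → z ⟶ n → Above s z → z ≈ c ⊎ z ≈ d
        classified mz zn sz with adjacent-trans (fwd mz) (bwd nm) (fwd mt) (fwd zn) (fwd nt)
        ... | inj₁ e       = ⊥-elim (⟶-asym nt (⟶-respˡ e zn))
        ... | inj₂ (fwd q) = inj₂ (middle-unique tms (mz ∷ sz) q mid dt)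
        ... | inj₂ (bwd q) = inj₁ (top-unique tms (q ∷ mz ∷ sz) top)

        not-exchangeable : ∀ α → to α m ≈ m → to α c ≈ d → to α n ≈ n → Matches α s s → m ⟶ d → d ⟶ n → Above s d → ⊥
        not-exchangeable α eₘ e eₙ es md dn sd
          with classified (⟶-respˡ eₘ (arc⁺ α md)) (⟶-respʳ eₙ (arc⁺ α dn)) (above-image α es sd)
        ... | inj₁ f = ⟶-asym cd (⟶-respˡ e (⟶-respʳ f (arc⁺ α cd)))
        ... | inj₂ f = ⟶-irrefl (≈-trans e (≈-sym f)) (arc⁺ α cd)

      exchange : ∀ {c d} → m ⟶ c → m ⟶ d → c ⟶ n → d ⟶ n → Above s c → Above s d →
                 ∃[ α ] All (λ q → to {D = D} {D} α (proj₁ q) ≈ proj₂ q) ((m , m) ∷ (c , d) ∷ (n , n) ∷ diagonal s)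
      exchange {c} {d} mc md cn dn sc sd = extend m m ((c , d) ∷ (n , n) ∷ diagonal s)
        ((same-arc mc md ∷ same-diagonal ∷ diagonal-same m s)
         ∷ (same-arc cn dn ∷ diagonal-below sc sd) ∷ diagonal-same n s ∷ diagonal-pairs s)
        (bwd mc ∷ fwd nm ∷ diagonal-adjacent sm)

    absurd : ⊥
    absurd with completions tms
    ... | c , d , top@(tc ∷ mc ∷ sc) , mid@(md ∷ sd) , dt , cd
        with exchange mc md (returns mc (fwd tc) sc) (returns md (bwd dt) sd) sc sd
    ...   | α , eₘ ∷ e ∷ eₙ ∷ es =
      not-exchangeable top mid dt cd α eₘ e eₙ (diagonal-matches α s es) md (returns md (bwd dt) sd) sd

  no-transitive-triangle : ∀ {u v w} → u ⟶ v → v ⟶ w → u ⟶ w → ⊥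
  no-transitive-triangle {u} {v} {w} uv vw uw
    -- Whatever prolongs the chain is an out-neighbour of its sink `w`, and these are finitely many.
    with maximal-chain _ (proj₁ (proj₁ (lf w))) {w ∷ v ∷ u ∷ []} ≤-refl
           (λ { z (wz ∷ _) → Equivalence.to (proj₂ (proj₁ (lf w)) z) wz })
           ((vw ∷ uw ∷ []) ∷ (uv ∷ []) ∷ [] ∷ [])
  ... | t ∷ m ∷ n ∷ s , (mt ∷ nt ∷ st) ∷ (nm ∷ sm) ∷ sn ∷ cs , _ , max = LongestChain.absurd mt nt st nm sm sn cs max
  ... | _ ∷ _ ∷ [] , _ , s≤s (s≤s ()) , _
  ... | _ ∷ [] , _ , s≤s () , _

  abstract
    completes : ∀ {v x} → v ⟶ x → ∃[ y ] x ⟶ y × y ⟶ v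
    completes {v} {x} vx with out-in-adjacent
    ... | v₀ , x₀ , y₀ , v₀x₀ , y₀v₀ , bwd y₀x₀ = ⊥-elim (no-transitive-triangle y₀v₀ v₀x₀ y₀x₀)
    ... | v₀ , x₀ , y₀ , v₀x₀ , y₀v₀ , fwd x₀y₀ with neighbour-transitive true v₀x₀ vx
    ...   | α , e , f = to α y₀ , ⟶-respˡ f (arc⁺ α x₀y₀) , ⟶-respʳ e (arc⁺ α y₀v₀)

  completion-unique : ∀ {v x y y′} → v ⟶ x → x ⟶ y → y ⟶ v → x ⟶ y′ → y′ ⟶ v → y ≈ y′
  completion-unique vx xy yv xy′ y′v with adjacent-trans (fwd xy) (bwd vx) (fwd xy′) (fwd yv) (bwd y′v)
  ... | inj₁ e       = e
  ... | inj₂ (fwd q) = ⊥-elim (no-transitive-triangle xy q xy′)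
  ... | inj₂ (bwd q) = ⊥-elim (no-transitive-triangle xy′ q xy)

-- Normal forms in the free product

module NormalForm (r : ℕ) where
  open FreeProduct {I = Fin r} (λ _ → C₃-group) public
    using (Word; _≋_; ≋-refl; ≋-sym; ≋-trans; ≋-++; ≋-cong; ≋-unit; ≋-mult; ≋-reflexive; inv; inverseˡ; inverseʳ)

  push : Fin r → C₃ → Word → Word
  push i 1₃ w = w
  push i ω  w = (i , ω) ∷ w
  push i ω² w = (i , ω²) ∷ w

  insert : Fin r → C₃ → Word → Word
  insert i x [] = push i x []
  insert i x ((j , y) ∷ w) with i ≟ᶠ j
  ... | yes _ = push i (x · y) w
  ... | no _  = push i x ((j , y) ∷ w)

  -- Van der Waerden's device: words act on reduced words, where the defining relations hold as
  -- equations, so that no confluence argument is required.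
  act : Word → Word → Word
  act u w = foldr (λ (i , x) → insert i x) w u

  nf : Word → Word
  nf u = act u []

  Fresh : Fin r → Word → Set
  Fresh i []            = ⊤
  Fresh i ((j , _) ∷ _) = i ≢ j

  data Reduced : Word → Set where
    []  : Reduced []
    letter : ∀ {i x w} → x ≢ 1₃ → Fresh i w → Reduced w → Reduced ((i , x) ∷ w)

  push-≢1₃ : ∀ i {x} w → x ≢ 1₃ → push i x w ≡ (i , x) ∷ w
  push-≢1₃ i {1₃} w ne = contradiction refl ne
  push-≢1₃ i {ω}  w ne = refl
  push-≢1₃ i {ω²} w ne = refl

  insert-fresh : ∀ i x w → Fresh i w → insert i x w ≡ push i x w
  insert-fresh i x []            _  = refl
  insert-fresh i x ((j , y) ∷ w) ne with i ≟ᶠ j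
  ... | yes e = contradiction e ne
  ... | no _  = refl

  insert-same : ∀ i x y w → insert i x ((i , y) ∷ w) ≡ push i (x · y) w
  insert-same i x y w with i ≟ᶠ i
  ... | yes _ = refl
  ... | no ne = contradiction refl ne

  insert-push : ∀ i x y w → Fresh i w → insert i x (push i y w) ≡ push i (x · y) w
  insert-push i x 1₃ w fr = trans (insert-fresh i x w fr) (cong (λ z → push i z w) (sym (·-identityʳ x)))
  insert-push i x ω  w fr = insert-same i x ω w
  insert-push i x ω² w fr = insert-same i x ω² w

  push-reduced : ∀ i x {w} → Fresh i w → Reduced w → Reduced (push i x w)
  push-reduced i 1₃ fr red = red
  push-reduced i ω  fr red = letter (λ ()) fr red
  push-reduced i ω² fr red = letter (λ ()) fr red

  -- Splits off a possibly trivial leading power of the generator `i`; this reduces each law of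
  -- `insert` to `insert-push`.
  decompose : ∀ i {w} → Reduced w → ∃[ y ] ∃[ u ] Fresh i u × Reduced u × w ≡ push i y u
  decompose i [] = 1₃ , [] , tt , [] , refl
  decompose i {(j , x) ∷ w} red@(letter ne fr redʷ) with i ≟ᶠ j
  ... | yes refl = x , w , fr , redʷ , sym (push-≢1₃ i w ne)
  ... | no i≢j   = 1₃ , (j , x) ∷ w , i≢j , red , refl

  insert-reduced : ∀ i x {w} → Reduced w → Reduced (insert i x w)
  insert-reduced i x red with decompose i red
  ... | y , u , fr , redᵘ , refl = subst Reduced (sym (insert-push i x y u fr)) (push-reduced i (x · y) fr redᵘ)

  insert-· : ∀ i x y {w} → Reduced w → insert i x (insert i y w) ≡ insert i (x · y) w
  insert-· i x y red with decompose i red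
  ... | z , u , fr , _ , refl = trans (cong (insert i x) (insert-push i y z u fr))
    (trans (insert-push i x (y · z) u fr)
      (trans (cong (λ t → push i t u) (sym (·-assoc x y z))) (sym (insert-push i (x · y) z u fr))))

  insert-1₃ : ∀ i {w} → Reduced w → insert i 1₃ w ≡ w
  insert-1₃ i red with decompose i red
  ... | z , u , fr , _ , refl = insert-push i 1₃ z u fr

  act-reduced : ∀ u {w} → Reduced w → Reduced (act u w)
  act-reduced []            red = red
  act-reduced ((i , x) ∷ u) red = insert-reduced i x (act-reduced u red)

  act-++ : ∀ u v w → act (u ++ v) w ≡ act u (act v w)
  act-++ u v w = foldr-++ _ w u v

  act-cong : ∀ {u v} → u ≋ v → ∀ {w} → Reduced w → act u w ≡ act v w
  act-cong ≋-refl        red = refl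
  act-cong (≋-sym e)     red = sym (act-cong e red)
  act-cong (≋-trans e f) red = trans (act-cong e red) (act-cong f red)
  act-cong (≋-++ {u} {u′} {v} {v′} e f) {w} red =
    trans (act-++ u v w) (trans (cong (act u) (act-cong f red))
      (trans (act-cong e (act-reduced v′ red)) (sym (act-++ u′ v′ w))))
  act-cong (≋-cong refl) red = refl
  act-cong (≋-unit {i})  red = insert-1₃ i red
  act-cong (≋-mult {i} {x} {y}) red = insert-· i x y red

  nf-reduced : ∀ u → Reduced (nf u)
  nf-reduced u = act-reduced u []

  nf-cong : ∀ {u v} → u ≋ v → nf u ≡ nf v
  nf-cong e = act-cong e []

  push-sound : ∀ i x w → push i x w ≋ (i , x) ∷ w
  push-sound i 1₃ w = ≋-sym (≋-++ {v = w} (≋-unit {j = i}) ≋-refl)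
  push-sound i ω  w = ≋-refl
  push-sound i ω² w = ≋-refl

  insert-sound : ∀ i x w → insert i x w ≋ (i , x) ∷ w
  insert-sound i x [] = push-sound i x []
  insert-sound i x ((j , y) ∷ w) with i ≟ᶠ j
  ... | yes refl = ≋-trans (push-sound i (x · y) w) (≋-++ {v = w} (≋-sym (≋-mult {j = i} {x} {y})) ≋-refl)
  ... | no _     = push-sound i x ((j , y) ∷ w)

  nf-sound : ∀ u → nf u ≋ u
  nf-sound []            = ≋-refl
  nf-sound ((i , x) ∷ u) = ≋-trans (insert-sound i x (nf u)) (≋-++ {u = [ (i , x) ]} ≋-refl (nf-sound u))

  nf-injective : ∀ {u v} → nf u ≡ nf v → u ≋ v
  nf-injective {u} {v} e = ≋-trans (≋-sym (nf-sound u)) (≋-trans (≋-reflexive e) (nf-sound v))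

  nf-idempotent : ∀ {w} → Reduced w → nf w ≡ w
  nf-idempotent [] = refl
  nf-idempotent {(i , x) ∷ w} (letter ne fr red) =
    trans (cong (insert i x) (nf-idempotent red)) (trans (insert-fresh i x w fr) (push-≢1₃ i w ne))

  push-[] : ∀ i x → push i x [] ≡ [] ⊎ push i x [] ≡ (i , x) ∷ []
  push-[] i 1₃ = inj₁ refl
  push-[] i ω  = inj₂ refl
  push-[] i ω² = inj₂ refl

  -- A generator appended on the right reaches the leading letter only if no letter lies between.
  data Append (i : Fin r) (x : C₃) (k : Fin r) : Word → Word → Set where
    merge  : i ≡ k → Append i x k [] (push i (x · ω) [])
    extend : ∀ {u} → u ≢ [] ⊎ i ≢ k → Append i x k u ((i , x) ∷ nf (u ++ [ (k , ω) ]))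

  append : ∀ {i x w} k → Reduced ((i , x) ∷ w) → Append i x k w (nf ((i , x) ∷ w ++ [ (k , ω) ]))
  append {i} {x} {[]} k (letter ne _ _) with i ≟ᶠ k
  ... | yes refl = merge refl
  ... | no i≢k   = subst (Append i x k []) (sym (push-≢1₃ i _ ne)) (extend (inj₂ i≢k))
  append {i} {x} {(j , y) ∷ w} k (letter ne i≢j red) =
    subst (Append i x k ((j , y) ∷ w))
      (sym (trans (insert-fresh i x _ (fresh (append k red))) (push-≢1₃ i _ ne)))
      (extend (inj₁ λ ()))
    where
    fresh : ∀ {v} → Append j y k w v → Fresh i v
    fresh (extend _) = i≢j
    fresh (merge e) with push j (y · ω) [] | push-[] j (y · ω)
    ... | _ | inj₁ refl = tt
    ... | _ | inj₂ refl = i≢j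

-- Enumeration of finite sets without repetition

module Enumeration (em : ∀ {ℓ} → ExcludedMiddle ℓ) {c ℓ a} (D : Digraph c ℓ a) where
  open Classical em
  open Graph D

  -- `Finite` permits repetitions, whereas generators of `T r` have to match out-neighbours one to
  -- one.
  record Enumerates {p} (P : Pred Vertex p) : Set (c ⊔ˡ ℓ ⊔ˡ p) where
    field
      size      : ℕ
      element   : Fin size → Vertex
      sound     : ∀ i → P (element i)
      complete  : ∀ y → P y → ∃[ i ] y ≈ element i
      injective : ∀ {i j} → element i ≈ element j → i ≡ j

  enumerate-list : ∀ xs → Enumerates (_∈ xs)
  enumerate-list [] = record { size = 0 ; element = λ () ; sound = λ () ; complete = λ _ () ; injective = λ {} }
  enumerate-list (x ∷ xs) with enumerate-list xs | dec (x ∈ xs)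
  ... | en | yes x∈ = record
    { size = size ; element = element ; sound = λ i → there (sound i)
    ; complete = λ { y (here e) → complete y (∈-resp (≈-sym e) x∈) ; y (there i) → complete y i }
    ; injective = injective }
    where open Enumerates en
  ... | en | no x∉ = record
    { size = suc size ; element = f ; sound = λ { zero → here ≈-refl ; (suc i) → there (sound i) }
    ; complete = λ { y (here e) → zero , e ; y (there i) → let (j , e) = complete y i in suc j , e }
    ; injective = λ {i} {j} → f-injective i j }
    where
    open Enumerates en
    f : Fin (suc size) → Vertex
    f zero    = x
    f (suc i) = element i
    f-injective : ∀ i j → f i ≈ f j → i ≡ j
    f-injective zero    zero    _ = refl
    f-injective zero    (suc j) e = contradiction (∈-resp (≈-sym e) (sound j)) x∉
    f-injective (suc i) zero    e = contradiction (∈-resp e (sound i)) x∉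
    f-injective (suc i) (suc j) e = cong suc (injective e)

  enumerate : ∀ {p} {P : Pred Vertex p} → Finite D P → Enumerates P
  enumerate (xs , P⇔) = record
    { size = size ; element = element ; sound = λ i → Equivalence.from (P⇔ (element i)) (sound i)
    ; complete = λ y p → complete y (Equivalence.to (P⇔ y) p) ; injective = injective }
    where open Enumerates (enumerate-list xs)

-- The isomorphism between `T r` and the digraph

module Classification (em : ∀ {ℓ} → ExcludedMiddle ℓ) {c ℓ a} (D : Digraph c ℓ a) (conn : Connected D)
                      (lf : LocallyFinite D) (some-cut : ∃[ e ] Ends.FiniteCut em D lf e)
                      (ch : ConnectedHomogeneous D) (triangle : EmbedsTriangle D) where
  open Classical em
  open Graph D
  open OptimalCuts em D conn lf some-cut using (Optimal; optimal-∁; optimal-preimage; optimal-nested; preimage)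
  open Cuts em D conn lf some-cut using (true≢false)
  open Homogeneity D ch using (neighbour-transitive)
  open Sides em D conn lf some-cut ch triangle
  open Triangles em D conn lf some-cut ch triangle using (no-transitive-triangle; completes; completion-unique)
  open Iso using (to; from; to-cong; from-cong; to-from; from-to; arc⁺; arc⁻)

  o : Vertex
  o = proj₁ triangle

  -- `r` is the out-degree of `o`: one generator for each triangle at `o`.
  open Enumeration.Enumerates (Enumeration.enumerate em D (proj₁ (lf o)))
    using () renaming (size to r; element to out; sound to o⟶out; complete to out-complete; injective to out-injective)

  open NormalForm r

  third : Fin r → Vertex
  third i = proj₁ (completes (o⟶out i))

  out⟶third : ∀ i → out i ⟶ third i
  out⟶third i = proj₁ (proj₂ (completes (o⟶out i)))

  third⟶o : ∀ i → third i ⟶ o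
  third⟶o i = proj₂ (proj₂ (completes (o⟶out i)))

  -- The vertex that is to correspond to the power aᵢˣ in T r.
  corner : Fin r → C₃ → Vertex
  corner i 1₃ = o
  corner i ω  = out i
  corner i ω² = third i

  corner-arc : ∀ i x → corner i x ⟶ corner i (x · ω)
  corner-arc i 1₃ = o⟶out i
  corner-arc i ω  = out⟶third i
  corner-arc i ω² = third⟶o i

  o∼corner : ∀ i x → x ≢ 1₃ → o ∼ corner i x
  o∼corner i 1₃ ne = contradiction refl ne
  o∼corner i ω  _  = fwd (o⟶out i)
  o∼corner i ω² _  = bwd (third⟶o i)

  -- The automorphisms g with g o = corner i x chosen here need not satisfy
  -- g³ = 1, so that words act on D only through their normal forms.
  rotation : ∀ i x → ∃[ α ] to {D = D} {D} α o ≈ corner i x × to α (out i) ≈ corner i (x · ω)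
  rotation i x = neighbour-transitive true (o⟶out i) (corner-arc i x)

  abstract
    g : Fin r → C₃ → D ≅ D
    g i x = proj₁ (rotation i x)

    g-o : ∀ i x → to (g i x) o ≈ corner i x
    g-o i x = proj₁ (proj₂ (rotation i x))

    g-out : ∀ i x → to (g i x) (out i) ≈ corner i (x · ω)
    g-out i x = proj₂ (proj₂ (rotation i x))

  -- Only the images of `o` and `out i` are prescribed; the third corner follows since triangles are
  -- determined by an arc.
  g-third : ∀ i x → to (g i x) (third i) ≈ corner i (x · ω²)
  g-third i x = completion-unique (corner-arc i x)
    (⟶-respˡ (g-out i x) (arc⁺ (g i x) (out⟶third i)))
    (⟶-respʳ (g-o i x) (arc⁺ (g i x) (third⟶o i)))
    (subst (corner i (x · ω) ⟶_) (cong (corner i) (·-assoc x ω ω)) (corner-arc i (x · ω)))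
    (subst (corner i (x · ω²) ⟶_) (cong (corner i) (trans (·-assoc x ω² ω) (·-identityʳ x))) (corner-arc i (x · ω²)))

  g-corner : ∀ i x y → to (g i x) (corner i y) ≈ corner i (x · y)
  g-corner i x 1₃ = ≈-trans (g-o i x) (subst (corner i x ≈_) (cong (corner i) (sym (·-identityʳ x))) ≈-refl)
  g-corner i x ω  = g-out i x
  g-corner i x ω² = g-third i x

  -- Being on one side means being equal or adjacent. Between corners of different triangles at `o`,
  -- either would reverse an arc, create a transitive triangle or give one arc two completions.
  corners-apart : ∀ i j x y → x ≢ 1₃ → y ≢ 1₃ → i ≢ j → ¬ Side o (corner i x) (corner j y)
  corners-apart i j x y x≢1 y≢1 i≢j side =
    refute x y x≢1 y≢1 (side⇒adjacent (o∼corner i x x≢1) (o∼corner j y y≢1) side)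
    where
    same-out : ∀ i j → corner i ω ⟶ corner j ω² → i ≡ j
    same-out i j p = out-injective (completion-unique (third⟶o j) (o⟶out i) p (o⟶out j) (out⟶third j))
    refute : ∀ x y → x ≢ 1₃ → y ≢ 1₃ → corner i x ≈ corner j y ⊎ corner i x ∼ corner j y → ⊥
    refute 1₃ _  ne _  _ = ne refl
    refute _  1₃ _  ne _ = ne refl
    refute ω  ω  _ _ (inj₁ e)       = i≢j (out-injective e)
    refute ω  ω  _ _ (inj₂ (fwd p)) = no-transitive-triangle (o⟶out i) p (o⟶out j)
    refute ω  ω  _ _ (inj₂ (bwd p)) = no-transitive-triangle (o⟶out j) p (o⟶out i)
    refute ω  ω² _ _ (inj₁ e)       = ⟶-asym (o⟶out i) (⟶-respˡ (≈-sym e) (third⟶o j))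
    refute ω  ω² _ _ (inj₂ (fwd p)) = i≢j (same-out i j p)
    refute ω  ω² _ _ (inj₂ (bwd p)) = no-transitive-triangle (third⟶o j) (o⟶out i) p
    refute ω² ω  _ _ (inj₁ e)       = ⟶-asym (o⟶out j) (⟶-respˡ e (third⟶o i))
    refute ω² ω  _ _ (inj₂ (fwd p)) = no-transitive-triangle (third⟶o i) (o⟶out j) p
    refute ω² ω  _ _ (inj₂ (bwd p)) = i≢j (sym (same-out j i p))
    refute ω² ω² _ _ (inj₁ e)       = i≢j (same-out i j (⟶-respʳ e (out⟶third i)))
    refute ω² ω² _ _ (inj₂ (fwd p)) = no-transitive-triangle p (third⟶o j) (third⟶o i)
    refute ω² ω² _ _ (inj₂ (bwd p)) = no-transitive-triangle p (third⟶o i) (third⟶o j)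

  Isolates : Fin r → C₃ → Pred Subset _
  Isolates i x e = Optimal e × χ e (corner i x) ≡ true × χ e (corner i (x · ω)) ≡ false × χ e (corner i (x · ω²)) ≡ false

  ·-divide : ∀ y x → (y · (x · x)) · x ≡ y
  ·-divide y x = trans (·-assoc y (x · x) x) (trans (cong (y ·_) (cube x)) (·-identityʳ y))
    where
    cube : ∀ x → (x · x) · x ≡ 1₃
    cube 1₃ = refl
    cube ω  = refl
    cube ω² = refl

  isolates-move : ∀ i y x e → Isolates i y e → ∃[ f ] Isolates i x f
  isolates-move i y x e (opt , p , q , q′) =
    preimage (g i z) e , optimal-preimage (g i z) e opt , move (·-divide y x) p , move (shift ω) q , move (shift ω²) q′
    where
    -- `x · x` is the inverse of `x`, so this rotation carries corner `x` to corner `y`.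
    z = y · (x · x)
    move : ∀ {t t′ b} → z · t ≡ t′ → χ e (corner i t′) ≡ b → χ e (to (g i z) (corner i t)) ≡ b
    move {t} refl eq = trans (χ-resp e (g-corner i z t)) eq
    shift : ∀ t → z · (x · t) ≡ y · t
    shift t = trans (sym (·-assoc z x t)) (cong (_· t) (·-divide y x))

  -- A cut separating two corners of a triangle isolates one of the corners.
  isolated : ∀ i x → ∃[ e ] Isolates i x e
  isolated i x with edge-separated (fwd (o⟶out i))
  ... | e , opt , p , q with χ e (third i) in eq
  ...   | false = isolates-move i 1₃ x e (opt , p , q , eq)
  ...   | true  = isolates-move i ω x (∁ e) (optimal-∁ e opt , cong not q , cong not eq , cong not p)

  act-on : Word → Vertex → Vertex
  act-on []            v = v
  act-on ((i , x) ∷ w) v = to (g i x) (act-on w v)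

  f : Word → Vertex
  f w = act-on w o

  act-cong-≈ : ∀ w {u v} → u ≈ v → act-on w u ≈ act-on w v
  act-cong-≈ []            e = e
  act-cong-≈ ((i , x) ∷ w) e = to-cong (g i x) (act-cong-≈ w e)

  act-arc : ∀ w {u v} → u ⟶ v → act-on w u ⟶ act-on w v
  act-arc []            p = p
  act-arc ((i , x) ∷ w) p = arc⁺ (g i x) (act-arc w p)

  f-out : ∀ w {v} → f w ⟶ v → ∃[ k ] v ≈ act-on w (out k)
  f-out w p = go w p
    where
    go : ∀ w {v} → act-on w o ⟶ v → ∃[ k ] v ≈ act-on w (out k)
    go [] p = out-complete _ p
    go ((i , x) ∷ w) {v} p with go w (arc⁻ (g i x) (⟶-respʳ (≈-sym (to-from (g i x) v)) p))
    ... | k , e = k , ≈-trans (≈-sym (to-from (g i x) v)) (to-cong (g i x) e)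

  f-push : ∀ i x → f (push i x []) ≈ corner i x
  f-push i 1₃ = ≈-refl
  f-push i ω  = g-o i ω
  f-push i ω² = g-o i ω²

  -- Normalising can change only the last letter of a reduced word, and there `g-out` replaces the
  -- group relation that the chosen automorphisms may violate.
  f-append : ∀ {w} k → Reduced w → f (nf (w ++ [ (k , ω) ])) ≈ act-on w (out k)
  f-append {[]} k [] = g-o k ω
  f-append {(i , x) ∷ w} k red@(letter _ _ redʷ) = go (append k red)
    where
    go : ∀ {v} → Append i x k w v → f v ≈ to (g i x) (act-on w (out k))
    go (merge refl) = ≈-trans (f-push i (x · ω)) (≈-sym (g-out i x))
    go (extend _)   = to-cong (g i x) (f-append k redʷ)

  -- If w = (i , x) ∷ (j , y) ∷ u is reduced, then any cut containing the corner
  -- (i , x) but not o contains the first two steps of w, and then all of w.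
  reduced-beyond : ∀ {i x u} → Reduced ((i , x) ∷ u) → ∀ e → Optimal e → χ e o ≡ false → χ e (corner i x) ≡ true →
                   χ e (f ((i , x) ∷ u)) ≡ true
  reduced-beyond {i} {x} {[]} _ e opt o∉ c∈ = trans (χ-resp e (g-o i x)) c∈
  reduced-beyond {i} {x} {(j , y) ∷ u} (letter x≢1 i≢j red@(letter y≢1 _ _)) e opt o∉ c∈ = outcome
    where
    v = to (g i x) o
    q = to (g i x) (corner j y)
    v∈ : χ e v ≡ true
    v∈ = trans (χ-resp e (g-o i x)) c∈

    inverse-≢1 : ∀ x → x ≢ 1₃ → x · x ≢ 1₃
    inverse-≢1 1₃ ne _ = ne refl

    from-o : from (g i x) o ≈ corner i (x · x)
    from-o = ≈-trans (from-cong (g i x) (≈-sym (≈-trans (g-corner i x (x · x))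
        (subst (λ t → corner i t ≈ o) (sym (trans (sym (·-assoc x x x)) (·-divide 1₃ x))) ≈-refl))))
      (from-to (g i x) (corner i (x · x)))

    apart : ¬ Side v o q
    apart side = corners-apart i j (x · x) y (inverse-≢1 x x≢1) y≢1 i≢j
      (side-image (≅-sym (g i x)) (from-to (g i x) o) from-o (from-to (g i x) (corner j y)) side)

    q∈ : χ e q ≡ true
    q∈ = ¬-not λ q∉ → apart (∁ e , optimal-∁ e opt , cong not v∈ , cong not o∉ , cong not q∉)

    outcome : χ e (to (g i x) (f ((j , y) ∷ u))) ≡ true
    -- `e′` contains `q` but neither `v` nor `o`. The recursion, applied to its preimage, puts the
    -- end of the whole word into `e′`; and since `q`, `v` and `o` occupy three of the corners,
    -- nestedness leaves only `e′ ⊆ e`.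
    outcome with edge-separated (Iso.adj⁺ (g i x) (∼-sym (o∼corner j y y≢1)))
    ... | e′ , opt′ , q∈′ , v∉′
        with optimal-nested e e′ opt opt′
           | reduced-beyond red (preimage (g i x) e′) (optimal-preimage (g i x) e′ opt′) v∉′ q∈′
    ...   | true  , true  , n | _ = ⊥-elim (n q q∈ q∈′)
    ...   | true  , false , n | _ = ⊥-elim (n v v∈ v∉′)
    ...   | false , false , n | _ = ⊥-elim (n o o∉ (¬-not λ o∈′ → apart (e′ , opt′ , v∉′ , o∈′ , q∈′)))
    ...   | false , true  , n | i∈ = ¬-not λ i∉ → n _ i∉ i∈

  private
    ≢-· : ∀ x y → x ≢ 1₃ → y ≢ 1₃ → x ≢ y → x ≡ y · ω × 1₃ ≡ y · ω² ⊎ x ≡ y · ω² × 1₃ ≡ y · ω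
    ≢-· 1₃ _  ne _  _ = contradiction refl ne
    ≢-· _  1₃ _  ne _ = contradiction refl ne
    ≢-· ω  ω  _  _  n = contradiction refl n
    ≢-· ω  ω² _  _  _ = inj₂ (refl , refl)
    ≢-· ω² ω  _  _  _ = inj₁ (refl , refl)
    ≢-· ω² ω² _  _  n = contradiction refl n

  isolating : ∀ i x y → x ≢ 1₃ → y ≢ 1₃ → x ≢ y →
              ∃[ e ] Optimal e × χ e o ≡ false × χ e (corner i x) ≡ false × χ e (corner i y) ≡ true
  isolating i x y x≢1 y≢1 x≢y with isolated i y | ≢-· x y x≢1 y≢1 x≢y
  ... | e , opt , p , q , q′ | inj₁ (eq , eq′) =
    e , opt , trans (cong (λ t → χ e (corner i t)) eq′) q′ , trans (cong (λ t → χ e (corner i t)) eq) q , p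
  ... | e , opt , p , q , q′ | inj₂ (eq , eq′) =
    e , opt , trans (cong (λ t → χ e (corner i t)) eq′) q , trans (cong (λ t → χ e (corner i t)) eq) q′ , p

  _≟³_ : (x y : C₃) → Dec (x ≡ y)
  x ≟³ y = dec (x ≡ y)

  reduced≉o : ∀ {i x u} → Reduced ((i , x) ∷ u) → ¬ o ≈ f ((i , x) ∷ u)
  reduced≉o {i} {x} red@(letter ne _ _) e with edge-separated (∼-sym (o∼corner i x ne))
  ... | c , opt , p , q = true≢false (reduced-beyond red c opt q p) (trans (χ-resp c (≈-sym e)) q)

  -- Equal first letters cancel. If their indices differ, the common end is on the side of both
  -- first corners, which are apart. If only the exponents differ, the cuts isolating the two
  -- corners both contain the common end, while each corner and `o` occupy the other three
  -- combinations, so the cuts are not nested.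
  f-injective : ∀ {w w′} → Reduced w → Reduced w′ → f w ≈ f w′ → w ≡ w′
  f-injective [] [] e = refl
  f-injective [] red@(letter _ _ _) e = contradiction e (reduced≉o red)
  f-injective red@(letter _ _ _) [] e = contradiction (≈-sym e) (reduced≉o red)
  f-injective {(i , x) ∷ u} {(j , y) ∷ u′} red@(letter x≢1 _ redᵘ) red′@(letter y≢1 _ redᵘ′) e with i ≟ᶠ j | x ≟³ y
  ... | yes refl | yes refl = cong (_ ∷_) (f-injective redᵘ redᵘ′ (Iso.injective (g i x) e))
  ... | no i≢j   | _ = contradiction
    (side-trans (step₁ (edge-separated (∼-sym (o∼corner i x x≢1)))) (step₂ (edge-separated (∼-sym (o∼corner j y y≢1)))))
    (corners-apart i j x y x≢1 y≢1 i≢j)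
    where
    step₁ : ∃[ c ] Separates (corner i x) o c → Side o (corner i x) (f ((i , x) ∷ u))
    step₁ (c , opt , p , q) = c , opt , q , p , reduced-beyond red c opt q p
    step₂ : ∃[ c ] Separates (corner j y) o c → Side o (f ((i , x) ∷ u)) (corner j y)
    step₂ (c , opt , p , q) = c , opt , q , trans (χ-resp c e) (reduced-beyond red′ c opt q p) , p
  ... | yes refl | no x≢y with isolating i x y x≢1 y≢1 x≢y | isolating i y x y≢1 x≢1 (λ eq → x≢y (sym eq))
  ...   | c , opt , oc , xc , yc | c′ , opt′ , oc′ , yc′ , xc′ with optimal-nested c c′ opt opt′
  ...     | true  , true  , n = ⊥-elim
    (n _ (trans (χ-resp c e) (reduced-beyond red′ c opt oc yc)) (reduced-beyond red c′ opt′ oc′ xc′))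
  ...     | true  , false , n = ⊥-elim (n _ yc yc′)
  ...     | false , true  , n = ⊥-elim (n _ xc xc′)
  ...     | false , false , n = ⊥-elim (n _ oc oc′)

  f-out-arc : ∀ {w v} → Reduced w → f w ⟶ v → ∃[ k ] v ≈ f (nf (w ++ [ (k , ω) ]))
  f-out-arc {w} red p with f-out w p
  ... | k , e = k , ≈-trans e (≈-sym (f-append k red))

  Reached : Pred Vertex _
  Reached v = ∃[ w ] Reduced w × f w ≈ v

  reached-out : ∀ {u v} → u ⟶ v → Reached u → Reached v
  reached-out p (w , red , e) with f-out-arc red (⟶-respˡ (≈-sym e) p)
  ... | k , e′ = nf (w ++ [ (k , ω) ]) , nf-reduced (w ++ [ (k , ω) ]) , ≈-sym e′

  f-surjective : ∀ v → Reached v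
  f-surjective v = walk-invariant Reached (λ p (w , red , e) → w , red , ≈-trans e p) reached-adjacent
    (connected⇒walk conn o v) ([] , [] , ≈-refl)
    where
    reached-adjacent : ∀ {u v} → u ∼ v → Reached u → Reached v
    reached-adjacent (fwd p) ru = reached-out p ru
    -- Against an arc, the other two arcs of its triangle lead to the same vertex.
    reached-adjacent (bwd p) ru with completes p
    ... | _ , q , s = reached-out s (reached-out q ru)

  T≅D : T r ≅ D
  T≅D = record
    { bijection = record
      { to = λ w → f (nf w) ; from = λ v → proj₁ (f-surjective v)
      ; to-cong = λ e → f-≡ (nf-cong e)
      ; from-cong = λ {u} {v} e → ≋-reflexive (f-injective (red u) (red v) (≈-trans (hits u) (≈-trans e (≈-sym (hits v)))))
      ; inverse =
          (λ {v} {w} e → ≈-trans (f-≡ (trans (nf-cong e) (nf-idempotent (red v)))) (hits v))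
        , (λ {w} {v} e → ≋-trans (≋-reflexive (f-injective (red v) (nf-reduced w) (≈-trans (hits v) e))) (nf-sound w)) }
    ; arcs = λ w w′ → mk⇔ (preserves w w′) (reflects w w′) }
    where
    red : ∀ v → Reduced (proj₁ (f-surjective v))
    red v = proj₁ (proj₂ (f-surjective v))
    hits : ∀ v → f (proj₁ (f-surjective v)) ≈ v
    hits v = proj₂ (proj₂ (f-surjective v))

    f-≡ : ∀ {w w′} → w ≡ w′ → f w ≈ f w′
    f-≡ refl = ≈-refl

    nf-append : ∀ w k → nf (w ++ [ (k , ω) ]) ≡ nf (nf w ++ [ (k , ω) ])
    nf-append w k = nf-cong (≋-++ (≋-sym (nf-sound w)) ≋-refl)

    preserves : ∀ w w′ → Digraph._⟶_ (T r) w w′ → f (nf w) ⟶ f (nf w′)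
    preserves w w′ (k , e) = ⟶-respʳ
      (≈-trans (≈-sym (f-append k (nf-reduced w))) (f-≡ (sym (trans (nf-cong e) (nf-append w k)))))
      (act-arc (nf w) (o⟶out k))

    reflects : ∀ w w′ → f (nf w) ⟶ f (nf w′) → Digraph._⟶_ (T r) w w′
    reflects w w′ p with f-out-arc (nf-reduced w) p
    ... | k , e = k , nf-injective
      (trans (f-injective (nf-reduced w′) (nf-reduced (nf w ++ [ (k , ω) ])) e) (sym (nf-append w k)))

-- Exchanging two neighbours, and transport along isomorphisms

-- A connected set that contains v, but neither x, y nor any vertex adjacent to
-- just one of x and y, is disjoint from Q and hence fixed by β.
record Swap {c ℓ a} (D : Digraph c ℓ a) (v x y : Digraph.Vertex D) : Set (c ⊔ˡ ℓ ⊔ˡ a) where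
  open Graph D
  field
    β      : D ≅ D
    Q      : Vertex → Bool
    Q-resp : ∀ {u w} → u ≈ w → Q u ≡ Q w
    moves  : Iso.to β x ≈ y
    fixes  : ∀ u → Q u ≡ false → Iso.to β u ≈ u
    base   : Q v ≡ false
    exits  : ∀ u w → Q u ≡ true → Q w ≡ false → u ∼ w →
             (u ≈ x ⊎ u ≈ y) ⊎ (u ∼ x × ¬ u ∼ y ⊎ u ∼ y × ¬ u ∼ x)

Swappable : ∀ {c ℓ a} → Digraph c ℓ a → Set _
Swappable D = ∀ s {v x y} → Neighbour s v x → Neighbour s v y → ¬ x ≈ y → Swap D v x y
  where open Graph D

Transitive : ∀ {c ℓ a} → Digraph c ℓ a → Set _
Transitive D = ∀ v v′ → ∃[ α ] Graph._≈_ D (Iso.to {D = D} {E = D} α v) v′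

module _ {c ℓ a c′ ℓ′ a′} {D : Digraph c ℓ a} {E : Digraph c′ ℓ′ a′} (α : D ≅ E) where
  private
    module D = Graph D
    module E = Graph E
  open Iso α

  conjugate : D ≅ D → E ≅ E
  conjugate β = ≅-trans (≅-sym α) (≅-trans β α)

  adj-from⁺ : ∀ {u w} → u E.∼ w → from u D.∼ from w
  adj-from⁺ = Iso.adj⁺ (≅-sym α)

  swap-transport : ∀ {v x y v′ x′ y′} → to v E.≈ v′ → to x E.≈ x′ → to y E.≈ y′ → Swap D v x y → Swap E v′ x′ y′
  swap-transport {v} {x} {y} {v′} {x′} {y′} ev ex ey s = record
    { β      = conjugate β
    ; Q      = λ u → Q (from u)
    ; Q-resp = λ e → Q-resp (from-cong e)
    ; moves  = E.≈-trans (to-cong (D.≈-trans (Iso.to-cong β (from-image ex)) moves)) ey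
    ; fixes  = λ u p → E.≈-trans (to-cong (fixes (from u) p)) (to-from u)
    ; base   = trans (Q-resp (from-image ev)) base
    ; exits  = λ u w p q adj → relocate u (exits (from u) (from w) p q (adj-from⁺ adj))
    }
    where
    open Swap s
    from-image : ∀ {z z′} → to z E.≈ z′ → from z′ D.≈ z
    from-image e = D.≈-trans (from-cong (E.≈-sym e)) (from-to _)
    coincides : ∀ {u z z′} → to z E.≈ z′ → from u D.≈ z → u E.≈ z′
    coincides e f = E.≈-trans (E.≈-sym (to-from _)) (E.≈-trans (to-cong f) e)
    adjacent : ∀ {u z z′} → to z E.≈ z′ → from u D.∼ z → u E.∼ z′
    adjacent e p = E.∼-respˡ (to-from _) (E.∼-respʳ e (adj⁺ p))
    apart : ∀ {u z z′} → to z E.≈ z′ → ¬ from u D.∼ z → ¬ u E.∼ z′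
    apart e p q = p (D.∼-respʳ (from-image e) (adj-from⁺ q))
    relocate : ∀ u → (from u D.≈ x ⊎ from u D.≈ y) ⊎ (from u D.∼ x × ¬ from u D.∼ y ⊎ from u D.∼ y × ¬ from u D.∼ x) →
               (u E.≈ x′ ⊎ u E.≈ y′) ⊎ (u E.∼ x′ × ¬ u E.∼ y′ ⊎ u E.∼ y′ × ¬ u E.∼ x′)
    relocate u (inj₁ (inj₁ e)) = inj₁ (inj₁ (coincides ex e))
    relocate u (inj₁ (inj₂ e)) = inj₁ (inj₂ (coincides ey e))
    relocate u (inj₂ (inj₁ (p , q))) = inj₂ (inj₁ (adjacent ex p , apart ey q))
    relocate u (inj₂ (inj₂ (p , q))) = inj₂ (inj₂ (adjacent ey p , apart ex q))

module _ {c ℓ a c′ ℓ′ a′} {D : Digraph c ℓ a} {E : Digraph c′ ℓ′ a′} (α : D ≅ E) where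
  private
    module D = Graph D
    module E = Graph E

  transitive-transport : Transitive E → Transitive D
  transitive-transport tr v v′ with tr (Iso.to α v) (Iso.to α v′)
  ... | β , e = conjugate (≅-sym α) β , D.≈-trans (Iso.from-cong α e) (Iso.from-to α v′)

  swappable-transport : Swappable E → Swappable D
  swappable-transport sw s p q ne = swap-transport (≅-sym α) (Iso.from-to α _) (Iso.from-to α _) (Iso.from-to α _)
    (sw s (Iso.neighbour⁺ α s p) (Iso.neighbour⁺ α s q) (λ e → ne (Iso.injective α e)))

-- Extending partial isomorphisms

module Extension (em : ∀ {ℓ} → ExcludedMiddle ℓ) {c ℓ a} (D : Digraph c ℓ a)
                 (transitive : Transitive D) (swappable : Swappable D) where
  open Classical em
  open Graph D using (Vertex; _≈_; _∼_; ≈-sym; ≈-trans; ≈-refl; neighbour-resp)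
  open Iso using (to)

  module _ (xs ys : List Vertex) (φ : induced D (λ x → Digraph._∈_ D x xs) ≅ induced D (λ y → Digraph._∈_ D y ys)) where
    private
      A = induced D (λ x → Digraph._∈_ D x xs)
      module A = Graph A

    ι : A.Vertex → Vertex
    ι = proj₁

    image : A.Vertex → Vertex
    image x = proj₁ (Iso.to φ x)

    ι-neighbour : ∀ s {x y} → A.Neighbour s x y → Graph.Neighbour D s (ι x) (ι y)
    ι-neighbour true  p = p
    ι-neighbour false p = p

    image-neighbour : ∀ s {x y} → A.Neighbour s x y → Graph.Neighbour D s (image x) (image y)
    image-neighbour true  p = Iso.arc⁺ φ p
    image-neighbour false p = Iso.arc⁺ φ p

    adjacent-ι : ∀ {x y} → x A.∼ y → ι x ∼ ι y
    adjacent-ι (fwd p) = fwd p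
    adjacent-ι (bwd p) = bwd p

    image-adjacent : ∀ {x y} → ι x ∼ ι y → image x ∼ image y
    image-adjacent (fwd p) = fwd (Iso.arc⁺ φ p)
    image-adjacent (bwd p) = bwd (Iso.arc⁺ φ p)

    adjacent-image : ∀ {x y} → image x ∼ image y → ι x ∼ ι y
    adjacent-image (fwd p) = fwd (Iso.arc⁻ φ p)
    adjacent-image (bwd p) = bwd (Iso.arc⁻ φ p)

    Agrees : (α : D ≅ D) → List A.Vertex → Set _
    Agrees α bs = ∀ b → b A.∈ bs → to α (ι b) ≈ image b

    -- Connectedness of the subdigraph induced by bs, by two-valued invariants.
    Linked : List A.Vertex → Set _
    Linked bs = ∀ (Q : A.Vertex → Bool) → (∀ {x y} → x A.≈ y → Q x ≡ Q y) →
      (∀ b b′ → b A.∈ bs → b′ A.∈ bs → b A.∼ b′ → Q b ≡ true → Q b′ ≡ true) →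
      ∀ b b′ → b A.∈ bs → b′ A.∈ bs → Q b ≡ true → Q b′ ≡ true

    linked-cons : ∀ {bs v x} → Linked bs → v A.∈ bs → v A.∼ x → Linked (x ∷ bs)
    linked-cons {bs} {v} {x} linked v∈ v∼x Q resp closed b b′ i j q = out j (into i q)
      where
      closed′ : ∀ b b′ → b A.∈ bs → b′ A.∈ bs → Q b ≡ true → Q b′ ≡ true
      closed′ = linked Q resp (λ b b′ i j → closed b b′ (there i) (there j))
      into : ∀ {b} → b A.∈ (x ∷ bs) → Q b ≡ true → Q v ≡ true
      into {b} (here e) q = closed x v (here ≈-refl) (there v∈) (A.∼-sym v∼x) (trans (sym (resp {b} {x} e)) q)
      into (there i)    q = closed′ _ v i v∈ q
      out : ∀ {b} → b A.∈ (x ∷ bs) → Q v ≡ true → Q b ≡ true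
      out {b} (here e) q = trans (resp {b} {x} e) (closed v x (there v∈) (here ≈-refl) v∼x q)
      out (there i)    q = closed′ v _ v∈ i q

    -- If `α` misplaces `x`, the place it gives and the right one are neighbours of `image v` with
    -- the same orientation, so they can be exchanged. A placed vertex equals neither, and it is
    -- adjacent to both or to none, since both adjacencies mirror the one to `x`. Hence the linked
    -- set of placed vertices cannot enter `Q` and stays fixed.
    extend-by : ∀ {bs v x} α → Agrees α bs → Linked bs → v A.∈ bs → v A.∼ x → ¬ x A.∈ bs → ∃[ α′ ] Agrees α′ (x ∷ bs)
    extend-by {bs} {v} {x} α agrees linked v∈ v∼x x∉ with dec (to α (ι x) ≈ image x)
    ... | yes e = α , λ
      { b (here f) → ≈-trans (Iso.to-cong α f) (≈-trans e (≈-sym (Iso.to-cong φ {b} {x} f)))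
      ; b (there i) → agrees b i }
    ... | no ne with A.neighbour-side v∼x
    ...   | s , vx = ≅-trans α β , agrees′
      where
      exchange : Swap D (image v) (to α (ι x)) (image x)
      exchange = swappable s
        (neighbour-resp s (agrees v v∈) ≈-refl (Iso.neighbour⁺ α s (ι-neighbour s vx)))
        (image-neighbour s vx) ne
      open Swap exchange

      same-side : ∀ b b′ → b A.∈ bs → b′ A.∈ bs → b A.∼ b′ → Q (image b) ≡ true → Q (image b′) ≡ true
      same-side b b′ i i′ adj q = ¬-not λ q′ → refute (exits (image b) (image b′) q q′ (image-adjacent (adjacent-ι adj)))
        where
        refute : _ → ⊥
        refute (inj₁ (inj₁ e)) = x∉ (A.∈-resp {b} {x} (Iso.injective α (≈-trans (agrees b i) e)) i)
        refute (inj₁ (inj₂ e)) = x∉ (A.∈-resp {b} {x} (Iso.injective φ {b} {x} e) i)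
        refute (inj₂ (inj₁ (p , ¬p))) = ¬p (image-adjacent (Iso.adj⁻ α (Graph.∼-respˡ D (≈-sym (agrees b i)) p)))
        refute (inj₂ (inj₂ (p , ¬p))) = ¬p (Graph.∼-respˡ D (agrees b i) (Iso.adj⁺ α (adjacent-image p)))

      outside : ∀ b → b A.∈ bs → Q (image b) ≡ false
      outside b i = ¬-not λ q → contradiction (trans (sym (v-inside q)) base) λ ()
        where
        v-inside : Q (image b) ≡ true → Q (image v) ≡ true
        v-inside = linked (λ b → Q (image b)) (λ {b} {b′} e → Q-resp (Iso.to-cong φ {b} {b′} e)) same-side b v i v∈

      agrees′ : Agrees (≅-trans α β) (x ∷ bs)
      agrees′ b (here e)  = ≈-trans (Iso.to-cong β (Iso.to-cong α e)) (≈-trans moves (≈-sym (Iso.to-cong φ {b} {x} e)))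
      agrees′ b (there i) = ≈-trans (Iso.to-cong β (agrees b i)) (fixes (image b) (outside b i))

    module _ (conn : Connected A) (x₀ : A.Vertex) where

      -- `rest` lists what may still have to be placed; connectedness always supplies an edge from a
      -- placed vertex to an unplaced one.
      exhaust : ∀ n rest {bs} α → length rest ≤ n → (∀ x → x A.∈ bs ⊎ x A.∈ rest) → Agrees α bs → Linked bs → x₀ A.∈ bs →
                ∃[ α′ ] (∀ x → to α′ (ι x) ≈ image x)
      exhaust n rest {bs} α len cov agrees linked x₀∈ with dec (∃[ x ] ¬ x A.∈ bs)
      ... | no ¬ex = α , λ x → agrees x (by-contradiction λ x∉ → ¬ex (x , x∉))
      ... | yes (x , x∉)
          with A.walk-exit (A._∈ bs) (λ y → dec (y A.∈ bs)) (λ {y} {z} → A.∈-resp {y} {z})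
                 (A.connected⇒walk conn x₀ x) x₀∈ x∉
      ...   | v , w , v∼w , v∈ , w∉ with cov w
      ...     | inj₁ w∈ = contradiction w∈ w∉
      exhaust zero [] α _ _ _ _ _ | yes _ | _ , _ , _ , _ , _ | inj₂ ()
      exhaust (suc n) rest {bs} α len cov agrees linked x₀∈ | yes _ | v , w , v∼w , v∈ , w∉ | inj₂ w∈
        with extend-by {x = w} α agrees linked v∈ v∼w w∉
      ... | α′ , agrees′ = exhaust n (sift (λ y → ¬ w A.≈ y) rest) α′
        (s≤s⁻¹ (≤-trans (sift-shorter (Any.map (λ e ne → ne e) w∈)) len)) cov′ agrees′
        (linked-cons linked v∈ v∼w) (there x₀∈)
        where
        cov′ : ∀ x → x A.∈ (w ∷ bs) ⊎ x A.∈ sift (λ y → ¬ w A.≈ y) rest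
        cov′ x with cov x | dec (x A.≈ w)
        ... | inj₁ i | _     = inj₁ (there i)
        ... | inj₂ i | yes e = inj₁ (here e)
        ... | inj₂ i | no ne = inj₂ (sift⁺ (λ {y} e f → ne (≈-trans e (≈-sym f))) i)

      extension : ∃[ α ] (∀ x → to {D = D} {D} α (ι x) ≈ image x)
      extension with transitive (ι x₀) (image x₀)
      ... | α , e = exhaust _ (enlist xs id) {x₀ ∷ []} α ≤-refl (λ x → inj₂ (enlisted xs id {x} (proj₂ x)))
        (λ { b (here f) → ≈-trans (Iso.to-cong α f) (≈-trans e (≈-sym (Iso.to-cong φ {b} {x₀} f))) })
        (λ { Q resp closed b b′ (here f) (here f′) q → trans (resp {b′} {b} (≈-trans f′ (≈-sym f))) q })
        (here ≈-refl)
        where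
        enlist : ∀ zs → (∀ {z} → Digraph._∈_ D z zs → Digraph._∈_ D z xs) → List A.Vertex
        enlist []       inc = []
        enlist (z ∷ zs) inc = (z , inc (here ≈-refl)) ∷ enlist zs (inc ∘ there)
        enlisted : ∀ zs (inc : ∀ {z} → Digraph._∈_ D z zs → Digraph._∈_ D z xs) {x} →
                   Digraph._∈_ D (ι x) zs → x A.∈ enlist zs inc
        enlisted (z ∷ zs) inc (here e)  = here e
        enlisted (z ∷ zs) inc {x} (there i) = there (enlisted zs (inc ∘ there) {x} i)

  homogeneous : ConnectedHomogeneous D
  homogeneous []       ys _    _ φ = ≅-refl , λ { (_ , ()) }
  homogeneous (x ∷ xs) ys conn _ φ = extension (x ∷ xs) ys φ conn (x , here ≈-refl)

-- Translations and branch exchanges of `T r`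

module CayleyDigraph (r : ℕ) where
  open NormalForm r
  open Graph (T r)

  translate : Word → T r ≅ T r
  translate u = record
    { bijection = record
      { to = u ++_ ; from = inv u ++_
      ; to-cong = ≋-++ (≋-refl {u}) ; from-cong = ≋-++ (≋-refl {inv u})
      ; inverse = (λ {x} {y} e → ≋-trans (≋-++ (≋-refl {u}) e) (cancel-right x))
                , (λ {x} {y} e → ≋-trans (≋-++ (≋-refl {inv u}) e) (cancel-left x)) }
    ; arcs = λ x y → mk⇔
        (λ (k , e) → k , ≋-trans (≋-++ (≋-refl {u}) e) (≋-reflexive (sym (++-assoc u x _))))
        (λ (k , e) → k , ≋-trans (≋-sym (cancel-left y)) (≋-trans (≋-++ (≋-refl {inv u}) e)
          (≋-trans (≋-reflexive (cong (inv u ++_) (++-assoc u x _))) (cancel-left (x ++ _)))))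
    }
    where
    cancel-left : ∀ x → inv u ++ (u ++ x) ≋ x
    cancel-left x = ≋-trans (≋-reflexive (sym (++-assoc (inv u) u x))) (≋-++ (inverseˡ u) (≋-refl {x}))
    cancel-right : ∀ x → u ++ (inv u ++ x) ≋ x
    cancel-right x = ≋-trans (≋-reflexive (sym (++-assoc u (inv u) x))) (≋-++ (inverseʳ u) (≋-refl {x}))

  transitive : Transitive (T r)
  transitive v v′ = ≅-trans (≅-sym (translate v)) (translate v′) ,
    ≋-trans (≋-++ (≋-refl {v′}) (inverseˡ v)) (≋-reflexive (++-identityʳ v′))

  -- Relabelling only the words whose normal form begins with i or j leaves the
  -- other branches at the identity fixed.
  module BranchSwap {i j : Fin r} (i≢j : i ≢ j) where

    τ : Fin r → Fin r
    τ k with k ≟ᶠ i | k ≟ᶠ j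
    ... | yes _ | _     = j
    ... | no _  | yes _ = i
    ... | no _  | no _  = k

    τ-i : τ i ≡ j
    τ-i with i ≟ᶠ i | i ≟ᶠ j
    ... | yes _ | _ = refl
    ... | no ne | _ = contradiction refl ne

    τ-j : τ j ≡ i
    τ-j with j ≟ᶠ i | j ≟ᶠ j
    ... | yes e | _     = contradiction (sym e) i≢j
    ... | no _  | yes _ = refl
    ... | no _  | no ne = contradiction refl ne

    τ-other : ∀ {k} → k ≢ i → k ≢ j → τ k ≡ k
    τ-other {k} ne ne′ with k ≟ᶠ i | k ≟ᶠ j
    ... | yes e | _     = contradiction e ne
    ... | no _  | yes e = contradiction e ne′
    ... | no _  | no _  = refl

    τ-involutive : ∀ k → τ (τ k) ≡ k
    τ-involutive k with k ≟ᶠ i | k ≟ᶠ j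
    ... | yes refl | _        = τ-j
    ... | no _     | yes refl = τ-i
    ... | no ne    | no ne′   = τ-other ne ne′

    exchanged : Fin r → Bool
    exchanged k = does (k ≟ᶠ i) ∨ does (k ≟ᶠ j)

    exchanged-i : exchanged i ≡ true
    exchanged-i with i ≟ᶠ i
    ... | yes _ = refl
    ... | no ne = contradiction refl ne

    exchanged-j : exchanged j ≡ true
    exchanged-j with j ≟ᶠ i | j ≟ᶠ j
    ... | yes _ | _     = refl
    ... | no _  | yes _ = refl
    ... | no _  | no ne = contradiction refl ne

    exchanged⁻ : ∀ k → exchanged k ≡ true → k ≡ i ⊎ k ≡ j
    exchanged⁻ k p with k ≟ᶠ i | k ≟ᶠ j
    ... | yes e | _     = inj₁ e
    ... | no _  | yes e = inj₂ e
    exchanged⁻ k () | no _ | no _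

    exchanged-τ : ∀ k → exchanged k ≡ true → exchanged (τ k) ≡ true
    exchanged-τ k p with exchanged⁻ k p
    ... | inj₁ refl = trans (cong exchanged τ-i) exchanged-j
    ... | inj₂ refl = trans (cong exchanged τ-j) exchanged-i

    relabel : Word → Word
    relabel = map (λ (k , x) → τ k , x)

    relabel-++ : ∀ u v → relabel (u ++ v) ≡ relabel u ++ relabel v
    relabel-++ = map-++ _

    relabel-cong : ∀ {u v} → u ≋ v → relabel u ≋ relabel v
    relabel-cong ≋-refl        = ≋-refl
    relabel-cong (≋-sym e)     = ≋-sym (relabel-cong e)
    relabel-cong (≋-trans e f) = ≋-trans (relabel-cong e) (relabel-cong f)
    relabel-cong (≋-++ {u} {u′} {v} {v′} e f) =
      ≋-trans (≋-reflexive (relabel-++ u v))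
        (≋-trans (≋-++ (relabel-cong e) (relabel-cong f)) (≋-reflexive (sym (relabel-++ u′ v′))))
    relabel-cong (≋-cong e)    = ≋-cong e
    relabel-cong ≋-unit        = ≋-unit
    relabel-cong ≋-mult        = ≋-mult

    relabel-involutive : ∀ u → relabel (relabel u) ≡ u
    relabel-involutive []            = refl
    relabel-involutive ((k , x) ∷ u) = cong₂ (λ l v → (l , x) ∷ v) (τ-involutive k) (relabel-involutive u)

    relabel-fresh : ∀ {k} u → Fresh k u → Fresh (τ k) (relabel u)
    relabel-fresh []            _  = tt
    relabel-fresh {k} ((l , _) ∷ _) ne = λ e → ne (trans (sym (τ-involutive k)) (trans (cong τ e) (τ-involutive l)))

    relabel-reduced : ∀ {u} → Reduced u → Reduced (relabel u)
    relabel-reduced []                         = []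
    relabel-reduced (letter {w = u} ne fr red) = letter ne (relabel-fresh u fr) (relabel-reduced red)

    nf-relabel : ∀ u → nf (relabel u) ≡ relabel (nf u)
    nf-relabel u = trans (nf-cong (relabel-cong (≋-sym (nf-sound u)))) (nf-idempotent (relabel-reduced (nf-reduced u)))

    begins : Word → Bool
    begins []            = false
    begins ((k , _) ∷ _) = exchanged k

    Q : Word → Bool
    Q u = begins (nf u)

    Q-resp : ∀ {u v} → u ≋ v → Q u ≡ Q v
    Q-resp e = cong begins (nf-cong e)

    Q-relabel : ∀ u → Q u ≡ true → Q (relabel u) ≡ true
    Q-relabel u p = trans (cong begins (nf-relabel u)) (begins-relabel (nf u) p)
      where
      begins-relabel : ∀ v → begins v ≡ true → begins (relabel v) ≡ true
      begins-relabel ((k , _) ∷ _) p = exchanged-τ k p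

    β : Word → Word
    β u = if Q u then relabel u else u

    β-moved : ∀ u → Q u ≡ true → β u ≡ relabel u
    β-moved u p rewrite p = refl

    β-fixed : ∀ u → Q u ≡ false → β u ≡ u
    β-fixed u p rewrite p = refl

    β-cong : ∀ {u v} → u ≋ v → β u ≋ β v
    β-cong {u} {v} e with Q u | Q v | Q-resp e
    ... | true  | .true  | refl = relabel-cong e
    ... | false | .false | refl = e

    β-involutive : ∀ u → β (β u) ≡ u
    β-involutive u with Q u in eq
    ... | true  = trans (β-moved (relabel u) (Q-relabel u eq)) (relabel-involutive u)
    ... | false = β-fixed u eq

    -- The leading index can change along an arc only where the arc leaves or enters the identity.
    data ArcView (u v : Word) : Set where
      source : nf u ≡ [] → ArcView u v
      target : ∀ {k x} → nf u ≡ [ (k , x) ] → nf v ≡ [] → ArcView u v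
      inside : Q u ≡ Q v → ArcView u v

    arc-view : ∀ u v → u ⟶ v → ArcView u v
    arc-view u v (k , e) with nf u in eq | nf-reduced u
    ... | [] | _ = source eq
    ... | (l , x) ∷ w | red = view (append k red) (trans (nf-cong e)
        (nf-cong (≋-++ (≋-trans (≋-sym (nf-sound u)) (≋-reflexive eq)) (≋-refl {[ (k , ω) ]}))))
      where
      same-letter : ∀ {z y t} → nf u ≡ (z , y) ∷ t → ∀ {y′ t′} → nf v ≡ (z , y′) ∷ t′ → Q u ≡ Q v
      same-letter p q = trans (cong begins p) (sym (cong begins q))
      view : ∀ {w′} → Append l x k w w′ → nf v ≡ w′ → ArcView u v
      view (extend _) q = inside (same-letter eq q)
      view (merge _)  q with push-[] l (x · ω)
      ... | inj₁ p = target eq (trans q p)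
      ... | inj₂ p = inside (same-letter eq (trans q p))

    relabel-arc : ∀ {u v} → u ⟶ v → relabel u ⟶ relabel v
    relabel-arc {u} (k , e) = τ k , ≋-trans (relabel-cong e) (≋-reflexive (relabel-++ u _))

    nf-[] : ∀ {u} → nf u ≡ [] → u ≋ []
    nf-[] {u} = nf-injective {u} {[]}

    -- An arc with just one end in the exchanged branches has the identity as its other end.
    -- Relabelling fixes the identity, so the arc may be relabelled as a whole.
    β-arc : ∀ u v → u ⟶ v → β u ⟶ β v
    β-arc u v p with arc-view u v p | Q u in eq | Q v in eq′
    ... | _             | true  | true  = relabel-arc p
    ... | _             | false | false = p
    ... | source e      | false | true  = ⟶-respˡ (≋-trans (relabel-cong (nf-[] {u} e)) (≋-sym (nf-[] {u} e))) (relabel-arc p)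
    ... | source e      | true  | false = contradiction (trans (sym eq) (cong begins e)) λ ()
    ... | target _ e    | true  | false = ⟶-respʳ (≋-trans (relabel-cong (nf-[] {v} e)) (≋-sym (nf-[] {v} e))) (relabel-arc p)
    ... | target _ e    | false | true  = contradiction (trans (sym eq′) (cong begins e)) λ ()
    ... | inside e      | true  | false = contradiction (trans (sym eq) (trans e eq′)) λ ()
    ... | inside e      | false | true  = contradiction (trans (sym eq) (trans e eq′)) λ ()

    β-auto : T r ≅ T r
    β-auto = record
      { bijection = record
        { to = β ; from = β ; to-cong = β-cong ; from-cong = β-cong
        ; inverse = (λ {x} e → ≋-trans (β-cong e) (≋-reflexive (β-involutive x)))
                  , (λ {x} e → ≋-trans (β-cong e) (≋-reflexive (β-involutive x))) }
      ; arcs = λ u v → mk⇔ (β-arc u v)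
          (λ p → ⟶-respˡ (≋-reflexive (β-involutive u)) (⟶-respʳ (≋-reflexive (β-involutive v)) (β-arc (β u) (β v) p)))
      }

    ExchangedLetter : Word → Set
    ExchangedLetter u = ∃[ k ] ∃[ x ] exchanged k ≡ true × x ≢ 1₃ × u ≋ [ (k , x) ]

    -- The branches are attached to the rest only at the identity, whose neighbours are single
    -- letters.
    exit-letter : ∀ u v → Q u ≡ true → Q v ≡ false → u ∼ v → ExchangedLetter u
    exit-letter u v p q adj = single u (go adj) p
      where
      single : ∀ u → (∃[ k ] ∃[ x ] nf u ≡ [ (k , x) ]) → Q u ≡ true → ExchangedLetter u
      single u (k , x , e) p with subst Reduced e (nf-reduced u)
      ... | letter ne _ _ = k , x , trans (sym (cong begins e)) p , ne , ≋-trans (≋-sym (nf-sound u)) (≋-reflexive e)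
      go : u ∼ v → ∃[ k ] ∃[ x ] nf u ≡ [ (k , x) ]
      go (fwd a) with arc-view u v a
      ... | source e   = contradiction (trans (sym p) (cong begins e)) λ ()
      ... | target e _ = _ , _ , e
      ... | inside e   = contradiction (trans (sym p) (trans e q)) λ ()
      go (bwd a@(k , f)) with arc-view v u a
      ... | source e   = k , ω , nf-cong (≋-trans f (≋-++ (nf-[] {v} e) (≋-refl {[ (k , ω) ]})))
      ... | target _ e = contradiction (trans (sym p) (cong begins e)) λ ()
      ... | inside e   = contradiction (trans (sym p) (trans (sym e) q)) λ ()

    no-cross-arc : ∀ {k l x y} → k ≢ l → x ≢ 1₃ → y ≢ 1₃ → ¬ [ (k , x) ] ⟶ [ (l , y) ]
    no-cross-arc {k} {l} {x} {y} k≢l x≢1 y≢1 (m , e) =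
      refute (append m (letter x≢1 tt [])) (trans (sym (nf-idempotent (letter y≢1 tt []))) (nf-cong e))
      where
      refute : ∀ {w} → Append k x m [] w → [ (l , y) ] ≡ w → ⊥
      refute (merge _) eq with push k (x · ω) [] | push-[] k (x · ω)
      refute (merge _) () | _ | inj₁ refl
      refute (merge _) eq | _ | inj₂ refl = k≢l (sym (cong proj₁ (∷-injectiveˡ eq)))
      refute (extend _) eq = k≢l (sym (cong proj₁ (∷-injectiveˡ eq)))

    no-cross-adjacency : ∀ {k l x y} → k ≢ l → x ≢ 1₃ → y ≢ 1₃ → ¬ [ (k , x) ] ∼ [ (l , y) ]
    no-cross-adjacency ne p q (fwd a) = no-cross-arc ne p q a
    no-cross-adjacency ne p q (bwd a) = no-cross-arc (λ e → ne (sym e)) q p a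

    same-triangle : ∀ k x y → x ≢ 1₃ → y ≢ 1₃ → [ (k , x) ] ≋ [ (k , y) ] ⊎ [ (k , x) ] ∼ [ (k , y) ]
    same-triangle k 1₃ _  p _ = contradiction refl p
    same-triangle k _  1₃ _ q = contradiction refl q
    same-triangle k ω  ω  _ _ = inj₁ ≋-refl
    same-triangle k ω² ω² _ _ = inj₁ ≋-refl
    same-triangle k ω  ω² _ _ = inj₂ (fwd (k , ≋-sym ≋-mult))
    same-triangle k ω² ω  _ _ = inj₂ (bwd (k , ≋-sym ≋-mult))

    -- An exit from the two branches is a corner of one of their triangles at the identity. It is
    -- either one of the two exchanged corners or the other corner of such a triangle, adjacent to
    -- exactly one of them.
    branch-swap : ∀ η → η ≢ 1₃ → Swap (T r) [] [ (i , η) ] [ (j , η) ]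
    branch-swap η η≢1 = record
      { β = β-auto ; Q = Q ; Q-resp = Q-resp
      ; moves = ≋-reflexive (trans (β-moved [ (i , η) ] Qi) (cong (λ k → [ (k , η) ]) τ-i))
      ; fixes = λ u p → ≋-reflexive (β-fixed u p)
      ; base = refl
      ; exits = λ u v p q adj → classify u (exit-letter u v p q adj)
      }
      where
      Qi : Q [ (i , η) ] ≡ true
      Qi = trans (cong begins (nf-idempotent (letter η≢1 tt []))) exchanged-i
      classify : ∀ u → ExchangedLetter u →
                 (u ≋ [ (i , η) ] ⊎ u ≋ [ (j , η) ]) ⊎
                 (u ∼ [ (i , η) ] × ¬ u ∼ [ (j , η) ] ⊎ u ∼ [ (j , η) ] × ¬ u ∼ [ (i , η) ])
      classify u (k , x , ex , x≢1 , e) with exchanged⁻ k ex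
      ... | inj₁ refl with same-triangle i x η x≢1 η≢1
      ...   | inj₁ f = inj₁ (inj₁ (≋-trans e f))
      ...   | inj₂ p = inj₂ (inj₁ (∼-respˡ (≋-sym e) p , λ q → no-cross-adjacency i≢j x≢1 η≢1 (∼-respˡ e q)))
      classify u (k , x , ex , x≢1 , e) | inj₂ refl with same-triangle j x η x≢1 η≢1
      ...   | inj₁ f = inj₁ (inj₂ (≋-trans e f))
      ...   | inj₂ p = inj₂ (inj₂ (∼-respˡ (≋-sym e) p , λ q → no-cross-adjacency (λ eq → i≢j (sym eq)) x≢1 η≢1 (∼-respˡ e q)))

  neighbour-letter : ∀ s → ∃[ η ] η ≢ 1₃ × (∀ {v x} → Neighbour s v x → ∃[ i ] v ++ [ (i , η) ] ≋ x)
  neighbour-letter true  = ω  , (λ ()) , λ (i , e) → i , ≋-sym e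
  -- In-neighbours are reached through the inverse generators, `ω²` being the inverse of `ω`.
  neighbour-letter false = ω² , (λ ()) , λ {v} {x} (i , e) → i ,
    ≋-trans (≋-++ e (≋-refl {[ (i , ω²) ]})) (≋-trans (≋-reflexive (++-assoc x _ _))
      (≋-trans (≋-++ (≋-refl {x}) (≋-trans ≋-mult ≋-unit)) (≋-reflexive (++-identityʳ x))))

  swappable : Swappable (T r)
  swappable s {v} {x} {y} p q x≉y with neighbour-letter s
  ... | η , η≢1 , letters with letters p | letters q
  ...   | i , e | j , f = swap-transport (translate v) (≋-reflexive (++-identityʳ v)) e f (BranchSwap.branch-swap i≢j η η≢1)
    where
    i≢j : i ≢ j
    i≢j refl = x≉y (≋-trans (≋-sym e) f)

theorem7p1 : (∀ {ℓ} → ExcludedMiddle ℓ) →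
    ∀ {c ℓ a} (D : Digraph c ℓ a) →
    Connected D →
    LocallyFinite D →
    MoreThanOneEnd D →
    EmbedsTriangle D →
    ConnectedHomogeneous D ⇔ (∃[ r ] D ≅ T r)
theorem7p1 em D conn lf ends triangle = mk⇔
  (λ ch → _ , ≅-sym (Classification.T≅D em D conn lf (Ends.finite-cut em D lf ends) ch triangle))
  (λ (r , α) → Extension.homogeneous em D
    (transitive-transport α (CayleyDigraph.transitive r)) (swappable-transport α (CayleyDigraph.swappable r)))
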